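{- There exist absolute constants $c>0$ and $N$ such that the following holds. Let $n>N$ be an integer with $\gcd(n,6)=1$, and let $a,b$ be integers coprime to $n$. Suppose that none of the pairs $(x,y)\in\{(1,a),(1,b),(a,b)\}$ satisfies $x+y\equiv 0\pmod n$ or $x-y\equiv 0\pmod n$, and that at least one of these three pairs $(x,y)$ satisfies none of the relations $x+3y\equiv0$, $x-3y\equiv 0$, $3x+y\equiv 0$, $3x-y\equiv 0\pmod n$. Then $$\#\left\{g\in(\mathbb{Z}/n)^*:\ \tfrac{(g)_n}{n}\in I,\ \tfrac{(ag)_n}{n}\in I,\ \tfrac{(bg)_n}{n}\in I\right\}\ge c\,\phi(n),$$ where $I=[0,1/2]$.
   Context: $(\mathbb{Z}/n)^*$ is the group of units modulo $n$; for an integer $x$, $(x)_n$ denotes the least non-negative integer congruent to $x$ modulo $n$; $\phi$ is Euler's totient function. -}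

module Defs where

open import Data.Nat as ℕ using (ℕ; zero; suc; _≤_; _≤?_)
open import Data.Nat.Coprimality using (Coprime; coprime?)
open import Data.Integer as ℤ using (ℤ; +_)
open import Data.Integer.DivMod using (_%ℕ_)
open import Data.Integer.Divisibility using (_∣_)
open import Data.List using (List; length; filter; upTo)
open import Data.Product using (_×_)
open import Data.Sum using (_⊎_)
open import Relation.Nullary using (¬_)
open import Relation.Nullary.Decidable using (_×-dec_)

-- (x)_n : least non-negative integer congruent to x modulo n (n ≥ 1; value 0 for n = 0 is irrelevant)
res : ℤ → ℕ → ℕ
res x zero    = 0
res x (suc m) = x %ℕ suc m

-- (x)_n / n ∈ I = [0,1/2]  ⟺  2·(x)_n ≤ n
InI : ℕ → ℤ → Set
InI n x = 2 ℕ.* res x n ≤ n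

inI? : (n : ℕ) (x : ℤ) → Relation.Nullary.Dec (InI n x)
inI? n x = (2 ℕ.* res x n) ≤? n

φ : ℕ → ℕ
φ n = length (filter (λ g → coprime? g n) (upTo n))

count : ℕ → ℤ → ℤ → ℕ
count n a b = length (filter
  (λ g → coprime? g n ×-dec inI? n (+ g) ×-dec inI? n (a ℤ.* + g) ×-dec inI? n (b ℤ.* + g))
  (upTo n))

PlusMinus : ℕ → ℤ → ℤ → Set
PlusMinus n x y = ((+ n) ∣ (x ℤ.+ y)) ⊎ ((+ n) ∣ (x ℤ.- y))

NoThreeRel : ℕ → ℤ → ℤ → Set
NoThreeRel n x y =
  ¬ ((+ n) ∣ (x ℤ.+ + 3 ℤ.* y)) × ¬ ((+ n) ∣ (x ℤ.- + 3 ℤ.* y)) ×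
  ¬ ((+ n) ∣ (+ 3 ℤ.* x ℤ.+ y)) × ¬ ((+ n) ∣ (+ 3 ℤ.* x ℤ.- y))

{-# OPTIONS --safe #-}
-- Let ψ be the odd square wave on ℤ/n.  Expanding (1 + ψ(g)) (1 + ψ(ag)) (1 + ψ(bg)) over the units g, the odd
-- terms cancel and 8 count = φ(n) + S(1,a) + S(1,b) + S(a,b), where S(x,y) = Σ_g ψ(xg) ψ(yg).  It remains
-- to bound the correlations: |S(1,a)| ≤ φ(n)/3 + o(φ(n)) unless a ≡ ±1, and 3/10 replaces 1/3 when moreover
-- a ≢ ±3 and 3a ≢ ±1; then the sum of the four terms is at least φ(n) (1 - 2/3 - 3/10) - o(φ(n)).
--
-- By Thue's lemma q a ≡ p modulo a divisor m = n/d with p, q coprime and d p, d q ≤ √n (replacing a by -a if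
-- needed).  The units are cut into the progressions g = c + d q t, along which (g, ag)/n runs through a line of
-- slope p/q on the torus.  An elementary sieve for units in progressions and summation by parts replace the
-- sum over units by the average along the line, with an error O(√n 2^Ω(n)) = o(φ(n)).  Averaging over shifts by
-- 1/p gives |S| ≤ φ(n)/p for odd p and 0 for even p; exchanging p and q, only p, q ∈ {1, 3} are left.
-- For q = 1 and d > 1, averaging over c gains a factor (1/l + 1)/(l - 1) ≤ 3/10 from a prime l ∣ d.
module Submission where

open import Defs
import Algebra.Properties.AbelianGroup as AbelianGroupProperties
open import Data.Bool using (if_then_else_)
open import Data.Fin as Fin using (Fin; toℕ; fromℕ<)
open import Data.Fin.Properties using (pigeonhole; toℕ<n; toℕ-fromℕ<)
open import Data.Integer using (ℤ; +_; ∣_∣; +≤+; -[1+_]) renaming (_+_ to infixl 6 _⊕_; _*_ to infixl 7 _⊛_; _-_ to infixl 6 _⊖_; _⊖_ to infixl 6 _⊟_; -_ to infix 8 ⊝_; _≤_ to infix 4 _≤ᶻ_)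
open import Data.Integer.DivMod using (_%ℕ_; _/ℕ_; n%ℕd<d; a≡a%ℕn+[a/ℕn]*n)
import Data.Integer.Properties as ℤₚ
import Data.Integer.Tactic.RingSolver as ℤ-Solver
open import Data.List using (List; []; _∷_; length; filter; applyUpTo)
open import Data.List.Relation.Unary.All using (All; []; _∷_)
open import Data.Nat
open import Data.Nat.Coprimality as Coprimality using (Coprime; coprime?)
open import Data.Nat.Divisibility
open import Data.Nat.DivMod
open import Data.Nat.GCD using (module Bézout; gcd; gcd[m,n]∣m; gcd[m,n]∣n; gcd-greatest)
open import Data.Nat.ListAction using (product)
open import Data.Nat.Primality
open import Data.Nat.Primality.Factorisation using (PrimeFactorisation; factorise)
open import Data.Nat.Properties
import Data.Nat.Tactic.RingSolver as ℕ-Solver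
open import Data.Product using (_×_; _,_; proj₁; proj₂; ∃-syntax)
open import Data.Sum using (_⊎_; inj₁; inj₂)
open import Data.Unit using (tt)
open import Function using (_∘_)
open import Relation.Binary using (Tri; tri<; tri≈; tri>)
open import Relation.Binary.PropositionalEquality
open import Relation.Nullary using (¬_; Dec; yes; no; does; contradiction)
open import Relation.Nullary.Decidable using (_×-dec_)

-- The condition gcd(n,6) = 1 acts in several ways. As `n` is odd, the wave is odd on units and the
-- endpoint 1/2 is never met. As all primes of `n` are at least 5, a prime `l ∣ d` yields 3/10, with
-- equality at `l = 5`. And 2^Ω(n) is at most n^0.44, so an error √n 2^Ω(n) is harmless although
-- primes are sieved with multiplicity; the form used is 2^Ω(n) n^(9/16) = O(φ(n)).
--
-- The obstacle is the modulus. The two numbers from the pigeonhole principle may have a common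
-- factor that is not invertible modulo `n`; cancelling it leaves a congruence modulo `n / d` only.
-- Then `a` can be 1 or 3 modulo `n / d` without being so modulo `n`, and the factor `1 / p` alone
-- is too weak. The average over the classes `c` modulo `d` closes this gap.
--
-- All densities and averages are cleared of denominators, and fractional exponents become sixteenth
-- powers. In sixtieths, the budget is 60 - 20 - 20 - 18 = 2; one part absorbs the error and the
-- other gives the constant 1/480.

-- Finite sums of integers.

∑ : ℕ → (ℕ → ℤ) → ℤ
∑ zero    f = + 0
∑ (suc n) f = ∑ n f ⊕ f n

∑-cong : ∀ n {f g : ℕ → ℤ} → (∀ t → t < n → f t ≡ g t) → ∑ n f ≡ ∑ n g
∑-cong zero    eq = refl
∑-cong (suc n) eq = cong₂ _⊕_ (∑-cong n λ t t<n → eq t (m<n⇒m<1+n t<n)) (eq n ≤-refl)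

∑-cong′ : ∀ n {f g : ℕ → ℤ} → (∀ t → f t ≡ g t) → ∑ n f ≡ ∑ n g
∑-cong′ n eq = ∑-cong n (λ t _ → eq t)

∑-+ : ∀ n (f g : ℕ → ℤ) → ∑ n (λ t → f t ⊕ g t) ≡ ∑ n f ⊕ ∑ n g
∑-+ zero    f g = refl
∑-+ (suc n) f g rewrite ∑-+ n f g = lemma (∑ n f) (∑ n g) (f n) (g n)
  where
  lemma : ∀ a b c d → (a ⊕ b) ⊕ (c ⊕ d) ≡ (a ⊕ c) ⊕ (b ⊕ d)
  lemma = ℤ-Solver.solve-∀

∑-*ˡ : ∀ n c (f : ℕ → ℤ) → ∑ n (λ t → c ⊛ f t) ≡ c ⊛ ∑ n f
∑-*ˡ zero    c f = sym (ℤₚ.*-zeroʳ c)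
∑-*ˡ (suc n) c f rewrite ∑-*ˡ n c f = sym (ℤₚ.*-distribˡ-+ c (∑ n f) (f n))

∑-*ʳ : ∀ n c (f : ℕ → ℤ) → ∑ n (λ t → f t ⊛ c) ≡ ∑ n f ⊛ c
∑-*ʳ n c f = trans (∑-cong′ n λ t → ℤₚ.*-comm (f t) c) (trans (∑-*ˡ n c f) (ℤₚ.*-comm c (∑ n f)))

∑-zero : ∀ n → ∑ n (λ _ → + 0) ≡ + 0
∑-zero zero    = refl
∑-zero (suc n) rewrite ∑-zero n = refl

∑-const : ∀ n c → ∑ n (λ _ → c) ≡ + n ⊛ c
∑-const zero    c = sym (ℤₚ.*-zeroˡ c)
∑-const (suc n) c rewrite ∑-const n c =
  trans (ℤₚ.+-comm (+ n ⊛ c) c) (sym (ℤₚ.suc-* (+ n) c))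

∑-neg : ∀ n f → ∑ n (λ t → ⊝ f t) ≡ ⊝ ∑ n f
∑-neg zero    f = refl
∑-neg (suc n) f = trans (cong (_⊕ ⊝ f n) (∑-neg n f)) (sym (ℤₚ.neg-distrib-+ (∑ n f) (f n)))

∑-⊖ : ∀ n f g → ∑ n (λ t → f t ⊖ g t) ≡ ∑ n f ⊖ ∑ n g
∑-⊖ n f g = trans (∑-+ n f (λ t → ⊝ g t)) (cong (∑ n f ⊕_) (∑-neg n g))

∑-swap : ∀ m n (f : ℕ → ℕ → ℤ) →
  ∑ m (λ a → ∑ n (λ b → f a b)) ≡ ∑ n (λ b → ∑ m (λ a → f a b))
∑-swap zero    n f = sym (∑-zero n)
∑-swap (suc m) n f rewrite ∑-swap m n f = sym (∑-+ n (λ b → ∑ m (λ a → f a b)) (f m))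

∑-split : ∀ m k (f : ℕ → ℤ) → ∑ (m + k) f ≡ ∑ m f ⊕ ∑ k (λ t → f (m + t))
∑-split m zero    f rewrite +-identityʳ m = sym (ℤₚ.+-identityʳ _)
∑-split m (suc k) f rewrite +-suc m k | ∑-split m k f = ℤₚ.+-assoc (∑ m f) _ _

∑-front : ∀ n (f : ℕ → ℤ) → ∑ (suc n) f ≡ f 0 ⊕ ∑ n (f ∘ suc)
∑-front n f = trans (∑-split 1 n f) (cong (_⊕ ∑ n (f ∘ suc)) (ℤₚ.+-identityˡ (f 0)))

∑-blocks : ∀ j m (f : ℕ → ℤ) → ∑ (j * m) f ≡ ∑ j (λ a → ∑ m (λ b → f (a * m + b)))
∑-blocks zero    m f = refl
∑-blocks (suc j) m f = begin
  ∑ (m + j * m) f                            ≡⟨ cong (λ k → ∑ k f) (+-comm m (j * m)) ⟩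
  ∑ (j * m + m) f                            ≡⟨ ∑-split (j * m) m f ⟩
  ∑ (j * m) f ⊕ ∑ m (λ b → f (j * m + b))    ≡⟨ cong (_⊕ ∑ m (λ b → f (j * m + b))) (∑-blocks j m f) ⟩
  _                                          ∎
  where open ≡-Reasoning

∑-single : ∀ n {f : ℕ → ℤ} {t₀} → t₀ < n → (∀ t → t < n → t ≢ t₀ → f t ≡ + 0) → ∑ n f ≡ f t₀
∑-single (suc n) {f} {t₀} t₀<1+n others with t₀ ≟ n
... | yes refl = trans (cong (_⊕ f n) (trans (∑-cong n λ t t<n → others t (m<n⇒m<1+n t<n) (<⇒≢ t<n)) (∑-zero n)))
                       (ℤₚ.+-identityˡ (f n))
... | no t₀≢n = trans (cong₂ _⊕_ (∑-single n (≤∧≢⇒< (≤-pred t₀<1+n) t₀≢n) λ t t<n → others t (m<n⇒m<1+n t<n))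
                                 (others n ≤-refl (t₀≢n ∘ sym)))
                      (ℤₚ.+-identityʳ (f t₀))

∣∑∣≤ : ∀ n {f g : ℕ → ℤ} → (∀ t → t < n → + ∣ f t ∣ ≤ᶻ g t) → + ∣ ∑ n f ∣ ≤ᶻ ∑ n g
∣∑∣≤ zero            le = ℤₚ.≤-refl
∣∑∣≤ (suc n) {f} {g} le = ℤₚ.≤-trans (+≤+ (ℤₚ.∣i+j∣≤∣i∣+∣j∣ (∑ n f) (f n)))
  (ℤₚ.+-mono-≤ (∣∑∣≤ n λ t t<n → le t (m<n⇒m<1+n t<n)) (le n ≤-refl))

∣∑∣≤* : ∀ n {f : ℕ → ℤ} C → (∀ t → t < n → ∣ f t ∣ ≤ C) → ∣ ∑ n f ∣ ≤ n * C
∣∑∣≤* zero        C le = z≤n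
∣∑∣≤* (suc n) {f} C le = ≤-trans (ℤₚ.∣i+j∣≤∣i∣+∣j∣ (∑ n f) (f n))
  (≤-trans (+-mono-≤ (∣∑∣≤* n C λ t t<n → le t (m<n⇒m<1+n t<n)) (le n ≤-refl)) (≤-reflexive (+-comm (n * C) C)))

-- Periodic functions and permutations of residues.

Periodic : ℕ → (ℕ → ℤ) → Set
Periodic n f = ∀ t → f (t + n) ≡ f t

periodic-* : ∀ {n f} → Periodic n f → ∀ t k → f (t + k * n) ≡ f t
periodic-* {n} {f} per t zero    = cong f (+-identityʳ t)
periodic-* {n} {f} per t (suc k) = trans (cong f (lemma t n (k * n))) (trans (per (t + k * n)) (periodic-* per t k))
  where
  lemma : ∀ t n j → t + (n + j) ≡ t + j + n
  lemma = ℕ-Solver.solve-∀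

periodic-% : ∀ {n f} .{{_ : NonZero n}} → Periodic n f → ∀ t → f t ≡ f (t % n)
periodic-% {n} {f} per t = trans (cong f (m≡m%n+[m/n]*n t n)) (periodic-* per (t % n) (t / n))

∑-suc : ∀ n {f} → Periodic n f → ∑ n (f ∘ suc) ≡ ∑ n f
∑-suc n {f} per = AbelianGroupProperties.∙-cancelˡ ℤₚ.+-0-abelianGroup (f 0) _ _ (begin
  f 0 ⊕ ∑ n (f ∘ suc) ≡⟨ ∑-front n f ⟨
  ∑ n f ⊕ f n         ≡⟨ cong (∑ n f ⊕_) (per 0) ⟩
  ∑ n f ⊕ f 0         ≡⟨ ℤₚ.+-comm (∑ n f) (f 0) ⟩
  f 0 ⊕ ∑ n f         ∎)
  where open ≡-Reasoning

∑-shift : ∀ n {f} c → Periodic n f → ∑ n (λ t → f (c + t)) ≡ ∑ n f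
∑-shift n zero    per = refl
∑-shift n {f} (suc c) per = trans (∑-shift n c (λ t → per (suc t))) (∑-suc n per)

inverse : ∀ {q n} .{{_ : NonZero n}} → Coprime q n → ∃[ q′ ] (q * q′) % n ≡ 1 % n
inverse {q} {n} cop with Coprimality.coprime-Bézout cop
... | Bézout.+- x y eq = x , (begin
  (q * x) % n     ≡⟨ cong (_% n) (*-comm q x) ⟩
  (x * q) % n     ≡⟨ cong (_% n) eq ⟨
  (1 + y * n) % n ≡⟨ [m+kn]%n≡m%n 1 y n ⟩
  1 % n           ∎)
  where open ≡-Reasoning
-- Here `1 + x * q ≡ y * n`, so the inverse is the negative of `x`, written `x * pred n`.
... | Bézout.-+ x y eq = x * pred n , (begin
  (q * (x * pred n)) % n           ≡⟨ [m+kn]%n≡m%n (q * (x * pred n)) y n ⟨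
  (q * (x * pred n) + y * n) % n   ≡⟨ cong (λ z → (q * (x * pred n) + z) % n) eq ⟨
  (q * (x * pred n) + (1 + x * q)) % n ≡⟨ cong (_% n) (lemma q x (pred n)) ⟩
  (1 + x * q * suc (pred n)) % n   ≡⟨ cong (λ z → (1 + x * q * z) % n) (suc-pred n) ⟩
  (1 + x * q * n) % n              ≡⟨ [m+kn]%n≡m%n 1 (x * q) n ⟩
  1 % n                            ∎)
  where
  open ≡-Reasoning
  lemma : ∀ q x n → q * (x * n) + (1 + x * q) ≡ 1 + x * q * suc n
  lemma = ℕ-Solver.solve-∀

inverse-*% : ∀ {n} q q′ t .{{_ : NonZero n}} → (q * q′) % n ≡ 1 % n → (q * ((q′ * t) % n)) % n ≡ t % n
inverse-*% {n} q q′ t eq = begin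
  (q * ((q′ * t) % n)) % n             ≡⟨ %-distribˡ-* q ((q′ * t) % n) n ⟩
  ((q % n) * ((q′ * t) % n % n)) % n   ≡⟨ cong (λ z → ((q % n) * z) % n) (m%n%n≡m%n (q′ * t) n) ⟩
  ((q % n) * ((q′ * t) % n)) % n       ≡⟨ %-distribˡ-* q (q′ * t) n ⟨
  (q * (q′ * t)) % n                   ≡⟨ cong (_% n) (*-assoc q q′ t) ⟨
  (q * q′ * t) % n                     ≡⟨ %-distribˡ-* (q * q′) t n ⟩
  ((q * q′) % n * (t % n)) % n         ≡⟨ cong (λ z → (z * (t % n)) % n) eq ⟩
  (1 % n * (t % n)) % n                ≡⟨ %-distribˡ-* 1 t n ⟨
  (1 * t) % n                          ≡⟨ cong (_% n) (*-identityˡ t) ⟩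
  t % n                                ∎
  where open ≡-Reasoning

𝟙 : ∀ {P : Set} → Dec P → ℤ
𝟙 d = if does d then + 1 else + 0

𝟙-yes : ∀ {P : Set} (d : Dec P) → P → 𝟙 d ≡ + 1
𝟙-yes (yes _) _ = refl
𝟙-yes (no ¬p) p = contradiction p ¬p

𝟙-no : ∀ {P : Set} (d : Dec P) → ¬ P → 𝟙 d ≡ + 0
𝟙-no (yes p) ¬p = contradiction p ¬p
𝟙-no (no _)  _  = refl

𝟙-cong : ∀ {P Q : Set} (d : Dec P) (e : Dec Q) → (P → Q) → (Q → P) → 𝟙 d ≡ 𝟙 e
𝟙-cong (yes p) e f g = sym (𝟙-yes e (f p))
𝟙-cong (no ¬p) e f g = sym (𝟙-no e (¬p ∘ g))

-- Each value is spread over all residues by an indicator and the sums are exchanged. The inner sum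
-- then counts the `t < n` with `q * t ≡ r`, and the inverse of `q` shows that there is exactly one.
∑-perm : ∀ q n {f} → Coprime q n → Periodic n f → ∑ n (λ t → f (q * t)) ≡ ∑ n f
∑-perm q zero    cop per = refl
∑-perm q n@(suc _) {f} cop per with inverse cop
... | q′ , qq′ = begin
  ∑ n (λ t → f (q * t))
    ≡⟨ ∑-cong′ n (λ t → periodic-% per (q * t)) ⟩
  ∑ n (λ t → f (q * t % n))
    ≡⟨ ∑-cong′ n (λ t → sym (pick (q * t % n) (m%n<n (q * t) n))) ⟩
  ∑ n (λ t → ∑ n (λ r → 𝟙 (q * t % n ≟ r) ⊛ f r))
    ≡⟨ ∑-swap n n _ ⟩
  ∑ n (λ r → ∑ n (λ t → 𝟙 (q * t % n ≟ r) ⊛ f r))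
    ≡⟨ ∑-cong n (λ r r<n → trans (∑-*ʳ n (f r) (λ t → 𝟙 (q * t % n ≟ r))) (trans (cong (_⊛ f r) (unique r r<n)) (ℤₚ.*-identityˡ (f r)))) ⟩
  ∑ n f ∎
  where
  open ≡-Reasoning
  pick : ∀ s → s < n → ∑ n (λ r → 𝟙 (s ≟ r) ⊛ f r) ≡ f s
  pick s s<n = trans
    (∑-single n s<n λ r _ r≢s → cong (_⊛ f r) (𝟙-no (s ≟ r) (r≢s ∘ sym)))
    (trans (cong (_⊛ f s) (𝟙-yes (s ≟ s) refl)) (ℤₚ.*-identityˡ (f s)))
  unique : ∀ r → r < n → ∑ n (λ t → 𝟙 (q * t % n ≟ r)) ≡ + 1
  unique r r<n = trans
    (∑-single n (m%n<n (q′ * r) n) λ t t<n t≢ → 𝟙-no (q * t % n ≟ r) λ eq → t≢ (begin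
      t                      ≡⟨ m<n⇒m%n≡m t<n ⟨
      t % n                  ≡⟨ inverse-*% q′ q t (trans (cong (_% n) (*-comm q′ q)) qq′) ⟨
      (q′ * (q * t % n)) % n ≡⟨ cong (λ z → (q′ * z) % n) eq ⟩
      (q′ * r) % n           ∎))
    (𝟙-yes (q * (q′ * r % n) % n ≟ r) (trans (inverse-*% q q′ r qq′) (m<n⇒m%n≡m r<n)))

∑-indicator : ∀ {P : ℕ → Set} (P? : ∀ g → Dec (P g)) (f : ℕ → ℕ) n →
  + length (filter P? (applyUpTo f n)) ≡ ∑ n (λ g → 𝟙 (P? (f g)))
∑-indicator P? f zero = refl
∑-indicator P? f (suc n) = trans (step (P? (f 0)) refl) (sym (∑-front n (λ g → 𝟙 (P? (f g)))))
  where
  rest = applyUpTo (f ∘ suc) n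
  step : ∀ d → P? (f 0) ≡ d → + length (filter P? (f 0 ∷ rest)) ≡ 𝟙 d ⊕ ∑ n (λ g → 𝟙 (P? (f (suc g))))
  step d eq with P? (f 0)
  step (yes p) refl | yes _ = cong (+ 1 ⊕_) (∑-indicator P? (f ∘ suc) n)
  step (no ¬p) refl | no _  = trans (∑-indicator P? (f ∘ suc) n) (sym (ℤₚ.+-identityˡ _))

-- Signs and the square wave.

sgn : ℕ → ℤ
sgn zero    = + 1
sgn (suc k) = ⊝ sgn k

sgn-+ : ∀ a b → sgn (a + b) ≡ sgn a ⊛ sgn b
sgn-+ zero    b = sym (ℤₚ.*-identityˡ (sgn b))
sgn-+ (suc a) b = trans (cong ⊝_ (sgn-+ a b)) (ℤₚ.neg-distribˡ-* (sgn a) (sgn b))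

sgn-square : ∀ a → sgn a ⊛ sgn a ≡ + 1
sgn-square zero    = refl
sgn-square (suc a) = trans (lemma (sgn a)) (sgn-square a)
  where
  lemma : ∀ x → ⊝ x ⊛ ⊝ x ≡ x ⊛ x
  lemma = ℤ-Solver.solve-∀

sgn-2* : ∀ a → sgn (2 * a) ≡ + 1
sgn-2* a = trans (cong (λ z → sgn (a + z)) (+-identityʳ a)) (trans (sgn-+ a a) (sgn-square a))

sgn-+2* : ∀ a k → sgn (a + 2 * k) ≡ sgn a
sgn-+2* a k = trans (sgn-+ a (2 * k)) (trans (cong (sgn a ⊛_) (sgn-2* k)) (ℤₚ.*-identityʳ (sgn a)))

sgn-cases : ∀ a → sgn a ≡ + 1 ⊎ sgn a ≡ ⊝ + 1
sgn-cases zero    = inj₁ refl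
sgn-cases (suc a) with sgn-cases a
... | inj₁ eq = inj₂ (cong ⊝_ eq)
... | inj₂ eq = inj₁ (cong ⊝_ eq)

∣sgn∣ : ∀ a → ∣ sgn a ∣ ≡ 1
∣sgn∣ zero    = refl
∣sgn∣ (suc a) = trans (ℤₚ.∣-i∣≡∣i∣ (sgn a)) (∣sgn∣ a)

sgn-variation : ∀ a k → ∣ sgn (a + k) ⊖ sgn a ∣ ≤ 2 * k
sgn-variation a zero    = ≤-reflexive (trans (cong (λ z → ∣ sgn z ⊖ sgn a ∣) (+-identityʳ a)) (cong ∣_∣ (ℤₚ.+-inverseʳ (sgn a))))
sgn-variation a (suc k) = begin
  ∣ sgn (a + suc k) ⊖ sgn a ∣                                     ≡⟨ cong (λ z → ∣ sgn z ⊖ sgn a ∣) (+-suc a k) ⟩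
  ∣ ⊝ sgn (a + k) ⊖ sgn a ∣                                       ≡⟨ cong ∣_∣ (lemma (sgn (a + k)) (sgn a)) ⟩
  ∣ (⊝ sgn (a + k) ⊖ sgn (a + k)) ⊕ (sgn (a + k) ⊖ sgn a) ∣       ≤⟨ ℤₚ.∣i+j∣≤∣i∣+∣j∣ (⊝ sgn (a + k) ⊖ sgn (a + k)) (sgn (a + k) ⊖ sgn a) ⟩
  ∣ ⊝ sgn (a + k) ⊖ sgn (a + k) ∣ + ∣ sgn (a + k) ⊖ sgn a ∣
    ≤⟨ +-mono-≤ (≤-trans (ℤₚ.∣i-j∣≤∣i∣+∣j∣ (⊝ sgn (a + k)) (sgn (a + k))) (≤-reflexive (cong₂ _+_ (∣sgn∣ (suc (a + k))) (∣sgn∣ (a + k))))) (sgn-variation a k) ⟩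
  2 + 2 * k                                                       ≡⟨ *-suc 2 k ⟨
  2 * suc k                                                       ∎
  where
  open ≤-Reasoning
  lemma : ∀ x y → ⊝ x ⊖ y ≡ (⊝ x ⊖ x) ⊕ (x ⊖ y)
  lemma = ℤ-Solver.solve-∀

-- The parity of `⌊2x/N⌋` gives the wave without a case distinction. It is not odd at `0` and `N/2`,
-- which is why `ψ-neg` excludes `n ∣ 2 * z`. The value for period `0` is a dummy.
ψ : ℕ → ℕ → ℤ
ψ zero      x = + 1
ψ N@(suc _) x = sgn (2 * x / N)

ψ-/ : ∀ N x .{{_ : NonZero N}} → ψ N x ≡ sgn (2 * x / N)
ψ-/ (suc _) x = refl

ψ-cases : ∀ N x → ψ N x ≡ + 1 ⊎ ψ N x ≡ ⊝ + 1
ψ-cases zero      x = inj₁ refl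
ψ-cases N@(suc _) x = sgn-cases (2 * x / N)

∣ψψ∣ : ∀ M N x y → ∣ ψ M x ⊛ ψ N y ∣ ≡ 1
∣ψψ∣ M N x y with ψ M x | ψ-cases M x | ψ N y | ψ-cases N y
... | _ | inj₁ refl | _ | inj₁ refl = refl
... | _ | inj₁ refl | _ | inj₂ refl = refl
... | _ | inj₂ refl | _ | inj₁ refl = refl
... | _ | inj₂ refl | _ | inj₂ refl = refl

[m+k*n]/n≡m/n+k : ∀ m k n .{{_ : NonZero n}} → (m + k * n) / n ≡ m / n + k
[m+k*n]/n≡m/n+k m k n = trans (+-distrib-/-∣ʳ m (n∣m*n k)) (cong (λ z → m / n + z) (m*n/n≡m k n))

ψ-+* : ∀ N x k → ψ N (x + k * N) ≡ ψ N x
ψ-+* zero      x k = refl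
ψ-+* N@(suc _) x k = begin
  sgn (2 * (x + k * N) / N)     ≡⟨ cong (λ z → sgn (z / N)) (lemma x k N) ⟩
  sgn ((2 * x + 2 * k * N) / N) ≡⟨ cong sgn ([m+k*n]/n≡m/n+k (2 * x) (2 * k) N) ⟩
  sgn (2 * x / N + 2 * k)       ≡⟨ sgn-+2* (2 * x / N) k ⟩
  sgn (2 * x / N)               ∎
  where
  open ≡-Reasoning
  lemma : ∀ x k N → 2 * (x + k * N) ≡ 2 * x + 2 * k * N
  lemma = ℕ-Solver.solve-∀

ψ-periodic : ∀ N → Periodic N (ψ N)
ψ-periodic N x = trans (cong (λ z → ψ N (x + z)) (sym (*-identityˡ N))) (ψ-+* N x 1)

ψ-scale : ∀ p N x .{{_ : NonZero p}} → ψ (p * N) (p * x) ≡ ψ N x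
ψ-scale p zero      x = cong (λ z → ψ z (p * x)) (*-zeroʳ p)
ψ-scale p N@(suc _) x = begin
  ψ (p * N) (p * x)           ≡⟨ ψ-/ (p * N) (p * x) ⟩
  sgn (2 * (p * x) / (p * N)) ≡⟨ cong (λ z → sgn (z / (p * N))) (lemma p x) ⟩
  sgn (p * (2 * x) / (p * N)) ≡⟨ cong sgn (m*n/m*o≡n/o p (2 * x) N) ⟩
  sgn (2 * x / N)             ∎
  where
  open ≡-Reasoning
  instance _ = m*n≢0 p N
  lemma : ∀ p x → 2 * (p * x) ≡ p * (2 * x)
  lemma = ℕ-Solver.solve-∀

-- Floors compose, so `x` enters only through the integer `⌊2x/N⌋`. The multiplication formula
-- thereby becomes an identity between sums of signs over residues modulo `p`.
ψ-refine : ∀ p N x j .{{_ : NonZero p}} .{{_ : NonZero N}} → ψ (p * N) (x + j * N) ≡ sgn ((2 * x / N + 2 * j) / p)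
ψ-refine p N x j = begin
  ψ (p * N) (x + j * N)                ≡⟨ cong (λ z → ψ z (x + j * N)) (*-comm p N) ⟩
  ψ (N * p) (x + j * N)                ≡⟨ ψ-/ (N * p) (x + j * N) ⟩
  sgn (2 * (x + j * N) / (N * p))      ≡⟨ cong sgn (m/n/o≡m/[n*o] (2 * (x + j * N)) N p) ⟨
  sgn (2 * (x + j * N) / N / p)        ≡⟨ cong (λ z → sgn (z / N / p)) (lemma x j N) ⟩
  sgn ((2 * x + 2 * j * N) / N / p)    ≡⟨ cong (λ z → sgn (z / p)) ([m+k*n]/n≡m/n+k (2 * x) (2 * j) N) ⟩
  sgn ((2 * x / N + 2 * j) / p)        ∎
  where
  open ≡-Reasoning
  instance _ = m*n≢0 N p
  lemma : ∀ x j N → 2 * (x + j * N) ≡ 2 * x + 2 * j * N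
  lemma = ℕ-Solver.solve-∀

-- The multiplication formula for the square wave.

∑-sgn : ∀ k → ∑ (1 + 2 * k) sgn ≡ + 1
∑-sgn zero    = refl
∑-sgn (suc k) = trans (cong (λ z → ∑ (1 + z) sgn) (*-suc 2 k))
  (trans (cancel (∑ (1 + 2 * k) sgn) (sgn (1 + 2 * k))) (∑-sgn k))
  where
  cancel : ∀ s x → s ⊕ x ⊕ ⊝ x ≡ s
  cancel = ℤ-Solver.solve-∀

coprime-2 : ∀ k → Coprime 2 (1 + 2 * k)
coprime-2 k {d} (d∣2 , d∣1+2k) = ∣1⇒≡1 (∣m+n∣m⇒∣n (subst (d ∣_) (+-comm 1 (2 * k)) d∣1+2k) (∣-trans d∣2 (m∣m*n k)))

-- For odd p the function i ↦ (-1)^i (-1)^⌊i/p⌋ has period p, so the sum can be permuted by 2.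
∑-sgn-odd : ∀ k u → ∑ (1 + 2 * k) (λ j → sgn ((u + 2 * j) / (1 + 2 * k))) ≡ sgn u
∑-sgn-odd k u = begin
  ∑ p (λ j → sgn ((u + 2 * j) / p))       ≡⟨ ∑-cong′ p twist ⟩
  ∑ p (λ j → sgn u ⊛ f (u + 2 * j))       ≡⟨ ∑-*ˡ p (sgn u) (λ j → f (u + 2 * j)) ⟩
  sgn u ⊛ ∑ p (λ j → f (u + 2 * j))       ≡⟨ cong (sgn u ⊛_) (∑-perm 2 p (coprime-2 k) f-periodic′) ⟩
  sgn u ⊛ ∑ p (λ j → f (u + j))           ≡⟨ cong (sgn u ⊛_) (∑-shift p u f-periodic) ⟩
  sgn u ⊛ ∑ p f
    ≡⟨ cong (sgn u ⊛_) (∑-cong p λ i i<p → trans (cong (λ z → sgn i ⊛ sgn z) (m<n⇒m/n≡0 i<p)) (ℤₚ.*-identityʳ (sgn i))) ⟩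
  sgn u ⊛ ∑ p sgn                         ≡⟨ cong (sgn u ⊛_) (∑-sgn k) ⟩
  sgn u ⊛ + 1                             ≡⟨ ℤₚ.*-identityʳ (sgn u) ⟩
  sgn u                                   ∎
  where
  open ≡-Reasoning
  p = 1 + 2 * k
  f : ℕ → ℤ
  f i = sgn i ⊛ sgn (i / p)
  twist : ∀ j → sgn ((u + 2 * j) / p) ≡ sgn u ⊛ f (u + 2 * j)
  twist j = sym (begin
    sgn u ⊛ (sgn (u + 2 * j) ⊛ s) ≡⟨ cong (λ z → sgn u ⊛ (z ⊛ s)) (sgn-+2* u j) ⟩
    sgn u ⊛ (sgn u ⊛ s)           ≡⟨ ℤₚ.*-assoc (sgn u) (sgn u) s ⟨
    sgn u ⊛ sgn u ⊛ s             ≡⟨ cong (_⊛ s) (sgn-square u) ⟩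
    + 1 ⊛ s                       ≡⟨ ℤₚ.*-identityˡ s ⟩
    s                             ∎)
    where s = sgn ((u + 2 * j) / p)
  f-periodic : Periodic p f
  f-periodic i = begin
    sgn (i + p) ⊛ sgn ((i + p) / p)      ≡⟨ cong₂ _⊛_ (trans (cong sgn (+-suc i (2 * k))) (cong ⊝_ (sgn-+2* i k)))
                                                      (cong sgn (trans (cong (λ z → (i + z) / p) (sym (*-identityˡ p))) (trans ([m+k*n]/n≡m/n+k i 1 p) (+-comm (i / p) 1)))) ⟩
    ⊝ sgn i ⊛ ⊝ sgn (i / p)              ≡⟨ neg-neg (sgn i) (sgn (i / p)) ⟩
    sgn i ⊛ sgn (i / p)                  ∎
    where
    neg-neg : ∀ x y → ⊝ x ⊛ ⊝ y ≡ x ⊛ y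
    neg-neg = ℤ-Solver.solve-∀
  f-periodic′ : Periodic p (λ i → f (u + i))
  f-periodic′ i = trans (cong f (sym (+-assoc u i p))) (f-periodic (u + i))

-- Shifting `j` by `k`, half of the range, raises the quotient by one, so the two halves cancel.
∑-sgn-even : ∀ k u .{{_ : NonZero (2 * k)}} → ∑ (2 * k) (λ j → sgn ((u + 2 * j) / (2 * k))) ≡ + 0
∑-sgn-even k u = begin
  ∑ (2 * k) f                         ≡⟨ cong (λ z → ∑ (k + z) f) (+-identityʳ k) ⟩
  ∑ (k + k) f                         ≡⟨ ∑-split k k f ⟩
  ∑ k f ⊕ ∑ k (λ j → f (k + j))       ≡⟨ ∑-+ k f (λ j → f (k + j)) ⟨
  ∑ k (λ j → f j ⊕ f (k + j))         ≡⟨ ∑-cong′ k (λ j → trans (cong (f j ⊕_) (antiperiodic j)) (ℤₚ.+-inverseʳ (f j))) ⟩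
  ∑ k (λ _ → + 0)                     ≡⟨ ∑-zero k ⟩
  + 0                                 ∎
  where
  open ≡-Reasoning
  f : ℕ → ℤ
  f j = sgn ((u + 2 * j) / (2 * k))
  antiperiodic : ∀ j → f (k + j) ≡ ⊝ f j
  antiperiodic j = cong sgn (begin
    (u + 2 * (k + j)) / (2 * k)           ≡⟨ cong (_/ (2 * k)) (lemma u k j) ⟩
    (u + 2 * j + 1 * (2 * k)) / (2 * k)   ≡⟨ [m+k*n]/n≡m/n+k (u + 2 * j) 1 (2 * k) ⟩
    (u + 2 * j) / (2 * k) + 1             ≡⟨ +-comm _ 1 ⟩
    suc ((u + 2 * j) / (2 * k))           ∎)
    where
    lemma : ∀ u k j → u + 2 * (k + j) ≡ u + 2 * j + 1 * (2 * k)
    lemma = ℕ-Solver.solve-∀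

-- The Fourier picture: summing over the `p` shifts keeps the frequencies divisible by `p` and
-- multiplies them by `p`. The wave has the odd frequencies `i`, with weights proportional to
-- `1 / i`; so odd `p` reproduces the wave with period `N`, while even `p` leaves nothing.
ψ-multiplication-odd : ∀ {p} k N x → p ≡ 1 + 2 * k → .{{_ : NonZero N}} →
  ∑ p (λ j → ψ (p * N) (x + j * N)) ≡ ψ N x
ψ-multiplication-odd k N x refl = trans
  (∑-cong′ (1 + 2 * k) λ j → ψ-refine (1 + 2 * k) N x j)
  (trans (∑-sgn-odd k (2 * x / N)) (sym (ψ-/ N x)))

ψ-multiplication-even : ∀ {p} k N x → p ≡ 2 * k → .{{_ : NonZero p}} .{{_ : NonZero N}} →
  ∑ p (λ j → ψ (p * N) (x + j * N)) ≡ + 0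
ψ-multiplication-even k N x refl = trans
  (∑-cong′ (2 * k) λ j → ψ-refine (2 * k) N x j)
  (∑-sgn-even k (2 * x / N))

ψ-multiplication-perm : ∀ p q N x → Coprime q p →
  ∑ p (λ j → ψ (p * N) (x + q * j * N)) ≡ ∑ p (λ j → ψ (p * N) (x + j * N))
ψ-multiplication-perm p q N x cop = ∑-perm q p cop λ j →
  trans (cong (ψ (p * N)) (lemma x j p N)) (ψ-+* (p * N) (x + j * N) 1)
  where
  lemma : ∀ x j p N → x + (j + p) * N ≡ x + j * N + 1 * (p * N)
  lemma = ℕ-Solver.solve-∀

-- Autocorrelations of the square wave.

autocorrelation : ℕ → ℕ → ℤ
autocorrelation n δ = ∑ n (λ s → ψ n s ⊛ ψ n (s + δ))

autocorrelation-periodic : ∀ n δ k → autocorrelation n (δ + k * n) ≡ autocorrelation n δ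
autocorrelation-periodic n δ k = ∑-cong′ n λ s → cong (ψ n s ⊛_)
  (trans (cong (ψ n) (sym (+-assoc s δ (k * n)))) (ψ-+* n (s + δ) k))

∣autocorrelation∣≤ : ∀ n δ → ∣ autocorrelation n δ ∣ ≤ n
∣autocorrelation∣≤ n δ = ≤-trans
  (∣∑∣≤* n 1 λ s _ → ≤-reflexive (∣ψψ∣ n n s (s + δ)))
  (≤-reflexive (*-identityʳ n))

-- The multiplication formula applies twice, to the shifts `j` and then to the blocks of `s`, and
-- leaves a single autocorrelation with period `N`. The trivial bound would be `l * l * N`.
∣∑-autocorrelation∣≤ : ∀ {l} k N δ → l ≡ 1 + 2 * k → .{{_ : NonZero N}} →
  ∣ ∑ l (λ j → autocorrelation (l * N) (δ + j * N)) ∣ ≤ N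
∣∑-autocorrelation∣≤ {l} k N δ l-odd = begin
  ∣ ∑ l (λ j → ∑ n (λ s → ψ n s ⊛ ψ n (s + (δ + j * N)))) ∣    ≡⟨ cong ∣_∣ identity ⟩
  ∣ ∑ N (λ b → ψ N b ⊛ ψ N (b + δ)) ∣                          ≤⟨ ∣autocorrelation∣≤ N δ ⟩
  N                                                            ∎
  where
  open ≤-Reasoning
  n = l * N
  module E = ≡-Reasoning
  lemma : ∀ i b δ N → i * N + b + δ ≡ b + δ + i * N
  lemma = ℕ-Solver.solve-∀
  identity : ∑ l (λ j → ∑ n (λ s → ψ n s ⊛ ψ n (s + (δ + j * N)))) ≡ ∑ N (λ b → ψ N b ⊛ ψ N (b + δ))
  identity = E.begin
    ∑ l (λ j → ∑ n (λ s → ψ n s ⊛ ψ n (s + (δ + j * N))))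
      E.≡⟨ ∑-swap l n _ ⟩
    ∑ n (λ s → ∑ l (λ j → ψ n s ⊛ ψ n (s + (δ + j * N))))
      E.≡⟨ ∑-cong′ n (λ s → trans (∑-*ˡ l (ψ n s) (λ j → ψ n (s + (δ + j * N)))) (cong (ψ n s ⊛_)
             (trans (∑-cong′ l λ j → cong (ψ n) (sym (+-assoc s δ (j * N)))) (ψ-multiplication-odd k N (s + δ) l-odd)))) ⟩
    ∑ n (λ s → ψ n s ⊛ ψ N (s + δ))
      E.≡⟨ ∑-blocks l N _ ⟩
    ∑ l (λ i → ∑ N (λ b → ψ n (i * N + b) ⊛ ψ N (i * N + b + δ)))
      E.≡⟨ ∑-swap l N _ ⟩
    ∑ N (λ b → ∑ l (λ i → ψ n (i * N + b) ⊛ ψ N (i * N + b + δ)))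
      E.≡⟨ ∑-cong′ N (λ b → ∑-cong′ l λ i → cong₂ _⊛_ (cong (ψ n) (+-comm (i * N) b))
             (trans (cong (ψ N) (lemma i b δ N)) (ψ-+* N (b + δ) i))) ⟩
    ∑ N (λ b → ∑ l (λ i → ψ n (b + i * N) ⊛ ψ N (b + δ)))
      E.≡⟨ ∑-cong′ N (λ b → trans (∑-*ʳ l (ψ N (b + δ)) (λ i → ψ n (b + i * N))) (cong (_⊛ ψ N (b + δ)) (ψ-multiplication-odd k N b l-odd))) ⟩
    ∑ N (λ b → ψ N b ⊛ ψ N (b + δ)) E.∎

-- The indicator of units and coprimality.

abstract
  χ : ℕ → ℕ → ℤ
  χ n g = 𝟙 (coprime? g n)

  χ≡𝟙 : ∀ n g → χ n g ≡ 𝟙 (coprime? g n)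
  χ≡𝟙 n g = refl

χ-coprime : ∀ n g → Coprime g n → χ n g ≡ + 1
χ-coprime n g g⊥n = trans (χ≡𝟙 n g) (𝟙-yes (coprime? g n) g⊥n)

χ-¬coprime : ∀ n g → ¬ Coprime g n → χ n g ≡ + 0
χ-¬coprime n g ¬g⊥n = trans (χ≡𝟙 n g) (𝟙-no (coprime? g n) ¬g⊥n)

χ-cong : ∀ m x n y → (Coprime x m → Coprime y n) → (Coprime y n → Coprime x m) → χ m x ≡ χ n y
χ-cong m x n y f g = trans (χ≡𝟙 m x) (trans (𝟙-cong (coprime? x m) (coprime? y n) f g) (sym (χ≡𝟙 n y)))

coprime-* : ∀ {x m n} → Coprime x m → Coprime x n → Coprime x (m * n)
coprime-* {x} {m} {n} x⊥m x⊥n {r} (r∣x , r∣mn) = x⊥n (r∣x , Coprimality.coprime-divisor {r} {m} {n} r⊥m r∣mn)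
  where
  r⊥m : Coprime r m
  r⊥m (d∣r , d∣m) = x⊥m (∣-trans d∣r r∣x , d∣m)

coprime-∣ : ∀ {x y m n} → x ∣ y → m ∣ n → Coprime y n → Coprime x m
coprime-∣ x∣y m∣n y⊥n (d∣x , d∣m) = y⊥n (∣-trans d∣x x∣y , ∣-trans d∣m m∣n)

∣m+n∣n⇒∣m : ∀ {d m n} → d ∣ m + n → d ∣ n → d ∣ m
∣m+n∣n⇒∣m {d} {m} {n} d∣m+n = ∣m+n∣m⇒∣n (subst (d ∣_) (+-comm m n) d∣m+n)

prime-∤⇒coprime : ∀ {l x} → Prime l → ¬ l ∣ x → Coprime x l
prime-∤⇒coprime {l} l-prime l∤x (d∣x , d∣l) with prime⇒irreducible l-prime d∣l
... | inj₁ d≡1  = d≡1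
... | inj₂ refl = contradiction d∣x l∤x

prime≢1 : ∀ {l} → Prime l → l ≢ 1
prime≢1 l-prime refl = ¬prime[1] l-prime

∑-sparse : ∀ {r t₁} (D G : ℕ → ℤ) → t₁ < r →
  (∀ y → D (t₁ + r * y) ≡ G y) →
  (∀ t y → t < t₁ + r * y → t₁ + r * y < t + r → D t ≡ + 0) →
  ∀ X → ∃[ X′ ] (X ≤ t₁ + r * X′ × t₁ + r * X′ < X + r × ∑ X D ≡ ∑ X′ G)
∑-sparse {r} {t₁} D G t₁<r on off zero = 0 , z≤n , subst (_< r) (sym (trans (cong (λ z → t₁ + z) (*-zeroʳ r)) (+-identityʳ t₁))) t₁<r , refl
∑-sparse {r} {t₁} D G t₁<r on off (suc X) with ∑-sparse D G t₁<r on off X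
... | X′ , lo , hi , eq with X ≟ t₁ + r * X′
... | yes X≡ = suc X′
    , ≤-trans (+-monoˡ-≤ X (≤-trans (s≤s z≤n) t₁<r)) (≤-reflexive (trans (+-comm r X) (sym next)))
    , ≤-reflexive (cong suc next)
    , cong₂ _⊕_ eq (trans (cong D X≡) (on X′))
    where
    lemma : ∀ t r x → t + r * suc x ≡ t + r * x + r
    lemma = ℕ-Solver.solve-∀
    next : t₁ + r * suc X′ ≡ X + r
    next = trans (lemma t₁ r X′) (cong (_+ r) (sym X≡))
... | no X≢ = X′ , ≤∧≢⇒< lo X≢ , m<n⇒m<1+n hi
    , trans (cong₂ _⊕_ eq (off X X′ (≤∧≢⇒< lo X≢) hi)) (ℤₚ.+-identityʳ (∑ X′ G))

∣⊖∣≤ : ∀ {x y z} → x ≤ y + z → y ≤ x + z → ∣ + x ⊖ + y ∣ ≤ z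
∣⊖∣≤ {x} {y} {z} x≤ y≤ = subst (_≤ z) (cong ∣_∣ (sym (ℤₚ.m-n≡m⊖n x y))) (case (≤-total x y))
  where
  case : x ≤ y ⊎ y ≤ x → ∣ x ⊟ y ∣ ≤ z
  case (inj₁ x≤y) = subst (_≤ z) (sym (ℤₚ.∣⊖∣-≤ x≤y)) (m≤n+o⇒m∸n≤o y x y≤)
  case (inj₂ y≤x) = subst (_≤ z) (sym (trans (ℤₚ.∣m⊖n∣≡∣n⊖m∣ x y) (ℤₚ.∣⊖∣-≤ y≤x))) (m≤n+o⇒m∸n≤o x y x≤)

-- For primes `ls`, the numerator over `product ls` of the proportion of units in a progression with
-- step `e`. A prime counts once, at its last occurrence, and only if it does not divide `e`; for
-- `e = 1` this is Euler's product for φ.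
density : ℕ → List ℕ → ℕ
density e []       = 1
density e (l ∷ ls) with l ∣? e * product ls
... | yes _ = l * density e ls
... | no  _ = pred l * density e ls

density≤product : ∀ e ls → density e ls ≤ product ls
density≤product e []       = ≤-refl
density≤product e (l ∷ ls) with l ∣? e * product ls
... | yes _ = *-monoʳ-≤ l (density≤product e ls)
... | no  _ = *-mono-≤ (pred[n]≤n {l}) (density≤product e ls)

sieveError : List ℕ → ℕ
sieveError []       = 0
sieveError (_ ∷ ls) = suc (2 * sieveError ls)

suc-sieveError : ∀ ls → suc (sieveError ls) ≡ 2 ^ length ls
suc-sieveError []       = refl
suc-sieveError (_ ∷ ls) = trans (sym (*-suc 2 (sieveError ls))) (cong (2 *_) (suc-sieveError ls))

-- No common factor with `m` is forced on all terms `c + e * t`. This is weaker than `c` being prime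
-- to `m` and survives the change of `c` in the sieve.
Admissible : ℕ → ℕ → ℕ → Set
Admissible e m c = ∀ {r} → r ∣ c → r ∣ e → r ∣ m → r ≡ 1

root : ∀ {l} c e → Prime l → ¬ l ∣ e → ∃[ t₁ ] (t₁ < l × l ∣ c + e * t₁)
root {l} c e l-prime l∤e with inverse {e} {l} {{prime⇒nonZero l-prime}} (prime-∤⇒coprime l-prime l∤e)
... | e′ , ee′ = t₁ , m%n<n _ l , m%n≡0⇒n∣m (c + e * t₁) l (begin
  (c + e * t₁) % l                   ≡⟨ %-distribˡ-+ c (e * t₁) l ⟩
  (c % l + (e * t₁) % l) % l         ≡⟨ cong (λ z → (c % l + z) % l) (inverse-*% e e′ (c * pred l) ee′) ⟩
  (c % l + (c * pred l) % l) % l     ≡⟨ %-distribˡ-+ c (c * pred l) l ⟨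
  (c + c * pred l) % l               ≡⟨ cong (_% l) (trans (sym (*-suc c (pred l))) (cong (c *_) (suc-pred l))) ⟩
  (c * l) % l                        ≡⟨ m*n%n≡0 c l ⟩
  0                                  ∎)
  where
  open ≡-Reasoning
  instance _ = prime⇒nonZero l-prime
  -- `c * pred l` represents the negative of `c` modulo `l`.
  t₁ = (e′ * (c * pred l)) % l

-- A prime that divides `e` or recurs in `ls` removes nothing new. Otherwise the terms divisible by
-- `l` are `l * (c′ + e * y)`, up to the factor `l` again a progression with step `e`. Both counts
-- thus have density `B`, and their difference gives `(l - 1) * B`. The errors of the two counts and
-- the rounding of `X / l` add up to `2 * E + 1`.
sieve : ∀ e ls → All Prime ls → ∀ c → Admissible e (product ls) c → ∀ X →
  ∣ + product ls ⊛ ∑ X (λ t → χ (product ls) (c + e * t)) ⊖ + density e ls ⊛ + X ∣ ≤ product ls * sieveError ls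
sieve e [] [] c adm X = ≤-reflexive (cong ∣_∣ (trans
  (cong (λ z → + 1 ⊛ z ⊖ + 1 ⊛ + X) (trans
    (∑-cong′ X λ t → χ-coprime 1 (c + e * t) λ d → ∣1⇒≡1 (proj₂ d))
    (trans (∑-const X (+ 1)) (ℤₚ.*-identityʳ (+ X)))))
  (ℤₚ.+-inverseʳ (+ 1 ⊛ + X))))
sieve e (l ∷ ls) (l-prime ∷ ls-prime) c adm X with l ∣? e * product ls
... | yes l∣em = begin
  ∣ + (l * m) ⊛ ∑ X (λ t → χ (l * m) (c + e * t)) ⊖ + (l * B) ⊛ + X ∣
    ≡⟨ cong ∣_∣ (trans (trans (cong (λ z → + (l * m) ⊛ z ⊖ + (l * B) ⊛ + X) (∑-cong′ X same))
                              (cong₂ (λ u v → u ⊛ K ⊖ v ⊛ + X) (ℤₚ.pos-* l m) (ℤₚ.pos-* l B)))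
                       (factor (+ l) (+ m) K (+ B) (+ X))) ⟩
  ∣ + l ⊛ (+ m ⊛ K ⊖ + B ⊛ + X) ∣
    ≡⟨ ℤₚ.∣i*j∣≡∣i∣*∣j∣ (+ l) _ ⟩
  l * ∣ + m ⊛ K ⊖ + B ⊛ + X ∣
    ≤⟨ *-monoʳ-≤ l (sieve e ls ls-prime c adm′ X) ⟩
  l * (m * E)
    ≡⟨ *-assoc l m E ⟨
  l * m * E
    ≤⟨ *-monoʳ-≤ (l * m) (≤-trans (m≤m+n E (E + 0)) (n≤1+n (2 * E))) ⟩
  l * m * suc (2 * E) ∎
  where
  open ≤-Reasoning
  m = product ls
  B = density e ls
  E = sieveError ls
  K = ∑ X (λ t → χ m (c + e * t))
  adm′ : Admissible e m c
  adm′ r∣c r∣e r∣m = adm r∣c r∣e (∣n⇒∣m*n l r∣m)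
  factor : ∀ l m k b x → l ⊛ m ⊛ k ⊖ l ⊛ b ⊛ x ≡ l ⊛ (m ⊛ k ⊖ b ⊛ x)
  factor = ℤ-Solver.solve-∀
  l∤ : ∀ t → Coprime (c + e * t) m → ¬ l ∣ c + e * t
  l∤ t cop l∣x with euclidsLemma e m l-prime l∣em
  ... | inj₁ l∣e = prime≢1 l-prime (adm (∣m+n∣n⇒∣m l∣x (∣m⇒∣m*n t l∣e)) l∣e (m∣m*n m))
  ... | inj₂ l∣m = prime≢1 l-prime (cop (l∣x , l∣m))
  same : ∀ t → χ (l * m) (c + e * t) ≡ χ m (c + e * t)
  same t = χ-cong (l * m) (c + e * t) m (c + e * t)
    (coprime-∣ ∣-refl (n∣m*n l))
    (λ cop → coprime-* (prime-∤⇒coprime l-prime (l∤ t cop)) cop)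
... | no l∤em with root c e l-prime (λ l∣e → l∤em (∣m⇒∣m*n (product ls) l∣e))
... | t₁ , t₁<l , divides c′ c+et₁≡ = bound (∑-sparse D G t₁<l on off X)
  where
  open ≤-Reasoning
  m = product ls
  B = density e ls
  E = sieveError ls
  K = ∑ X (λ t → χ m (c + e * t))
  l∤e : ¬ l ∣ e
  l∤e l∣e = l∤em (∣m⇒∣m*n m l∣e)
  l∤m : ¬ l ∣ m
  l∤m l∣m = l∤em (∣n⇒∣m*n e l∣m)
  D G : ℕ → ℤ
  D t = 𝟙 (l ∣? c + e * t) ⊛ χ m (c + e * t)
  G y = χ m (c′ + e * y)
  adm₁ : Admissible e m c
  adm₁ r∣c r∣e r∣m = adm r∣c r∣e (∣n⇒∣m*n l r∣m)
  adm₂ : Admissible e m c′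
  adm₂ {r} r∣c′ r∣e r∣m = adm (∣m+n∣n⇒∣m (subst (r ∣_) (sym c+et₁≡) (∣m⇒∣m*n l r∣c′)) (∣m⇒∣m*n t₁ r∣e)) r∣e (∣n⇒∣m*n l r∣m)
  on : ∀ y → D (t₁ + l * y) ≡ G y
  on y = trans (cong (λ z → 𝟙 (l ∣? z) ⊛ χ m z) on-line)
    (trans (cong₂ _⊛_ (𝟙-yes (l ∣? l * (c′ + e * y)) (m∣m*n _))
                      (χ-cong m (l * (c′ + e * y)) m (c′ + e * y)
                        (coprime-∣ (n∣m*n l) ∣-refl)
                        (λ cop → Coprimality.sym (coprime-* (prime-∤⇒coprime l-prime l∤m) (Coprimality.sym cop)))))
           (ℤₚ.*-identityˡ (G y)))
    where
    expand : ∀ c e t l y → c + e * (t + l * y) ≡ c + e * t + l * (e * y)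
    expand = ℕ-Solver.solve-∀
    collect : ∀ c′ l e y → c′ * l + l * (e * y) ≡ l * (c′ + e * y)
    collect = ℕ-Solver.solve-∀
    on-line : c + e * (t₁ + l * y) ≡ l * (c′ + e * y)
    on-line = trans (expand c e t₁ l y) (trans (cong (_+ l * (e * y)) c+et₁≡) (collect c′ l e y))
  off : ∀ t y → t < t₁ + l * y → t₁ + l * y < t + l → D t ≡ + 0
  off t y t<s s<t+l = cong (_⊛ χ m (c + e * t)) (𝟙-no (l ∣? c + e * t) λ l∣x →
    no-multiple (∣m+n∣m⇒∣n (subst (l ∣_) split l∣s) l∣x))
    where
    s = t₁ + l * y
    l∣s : l ∣ c + e * s
    l∣s = subst (l ∣_) (sym (expand c e t₁ l y)) (∣m∣n⇒∣m+n (divides c′ c+et₁≡) (m∣m*n (e * y)))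
      where
      expand : ∀ c e t l y → c + e * (t + l * y) ≡ c + e * t + l * (e * y)
      expand = ℕ-Solver.solve-∀
    split : c + e * s ≡ c + e * t + e * (s ∸ t)
    split = trans (cong (λ z → c + e * z) (sym (m+[n∸m]≡n (<⇒≤ t<s)))) (expand c e t (s ∸ t))
      where
      expand : ∀ c e t u → c + e * (t + u) ≡ c + e * t + e * u
      expand = ℕ-Solver.solve-∀
    no-multiple : ¬ l ∣ e * (s ∸ t)
    no-multiple l∣ with euclidsLemma e (s ∸ t) l-prime l∣
    ... | inj₁ l∣e = l∤e l∣e
    ... | inj₂ l∣s-t = <⇒≱ (m<n+o⇒m∸n<o s t {{nz}} s<t+l) (∣⇒≤ {{>-nonZero (m<n⇒0<n∸m t<s)}} l∣s-t)
      where nz = prime⇒nonZero l-prime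
  removed : ∀ t → χ (l * m) (c + e * t) ≡ χ m (c + e * t) ⊕ ⊝ D t
  removed t with l ∣? c + e * t
  ... | yes l∣x = trans (χ-¬coprime (l * m) (c + e * t) (λ cop → prime≢1 l-prime (cop (l∣x , m∣m*n m)))) (cancel (χ m (c + e * t)))
    where
    cancel : ∀ x → + 0 ≡ x ⊕ ⊝ (+ 1 ⊛ x)
    cancel = ℤ-Solver.solve-∀
  ... | no l∤x = trans
    (χ-cong (l * m) (c + e * t) m (c + e * t)
      (coprime-∣ ∣-refl (n∣m*n l)) (coprime-* (prime-∤⇒coprime l-prime l∤x)))
    (cancel (χ m (c + e * t)))
    where
    cancel : ∀ x → x ≡ x ⊕ ⊝ (+ 0 ⊛ x)
    cancel = ℤ-Solver.solve-∀
  bound : ∃[ X′ ] (X ≤ t₁ + l * X′ × t₁ + l * X′ < X + l × ∑ X D ≡ ∑ X′ G) →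
    ∣ + (l * m) ⊛ ∑ X (λ t → χ (l * m) (c + e * t)) ⊖ + (pred l * B) ⊛ + X ∣ ≤ l * m * suc (2 * E)
  bound (X′ , lo , hi , ∑D≡) = begin
    ∣ + (l * m) ⊛ ∑ X (λ t → χ (l * m) (c + e * t)) ⊖ + (pred l * B) ⊛ + X ∣
      ≡⟨ cong ∣_∣ (trans (cong₂ _⊖_
           (cong₂ _⊛_ (ℤₚ.pos-* l m) (trans (∑-cong′ X removed) (trans (∑-+ X _ _) (cong (K ⊕_) (trans (∑-neg X D) (cong ⊝_ ∑D≡))))))
           (cong (_⊛ + X) (trans (ℤₚ.pos-* (pred l) B) (cong (_⊛ + B) pred-l))))
           (trans (rearrange (+ l) (+ m) K K₂ (+ B) (+ X) (+ X′))
             (cong (λ z → + l ⊛ (+ m ⊛ K ⊖ + B ⊛ + X) ⊖ + l ⊛ (+ m ⊛ K₂ ⊖ + B ⊛ + X′) ⊖ + B ⊛ (z ⊖ + X)) (sym (ℤₚ.pos-* l X′))))) ⟩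
    ∣ + l ⊛ u ⊖ + l ⊛ v ⊖ + B ⊛ w ∣
      ≤⟨ ℤₚ.∣i-j∣≤∣i∣+∣j∣ (+ l ⊛ u ⊖ + l ⊛ v) (+ B ⊛ w) ⟩
    ∣ + l ⊛ u ⊖ + l ⊛ v ∣ + ∣ + B ⊛ w ∣
      ≤⟨ +-monoˡ-≤ ∣ + B ⊛ w ∣ (ℤₚ.∣i-j∣≤∣i∣+∣j∣ (+ l ⊛ u) (+ l ⊛ v)) ⟩
    ∣ + l ⊛ u ∣ + ∣ + l ⊛ v ∣ + ∣ + B ⊛ w ∣
      ≡⟨ cong₂ _+_ (cong₂ _+_ (ℤₚ.∣i*j∣≡∣i∣*∣j∣ (+ l) u) (ℤₚ.∣i*j∣≡∣i∣*∣j∣ (+ l) v)) (ℤₚ.∣i*j∣≡∣i∣*∣j∣ (+ B) w) ⟩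
    l * ∣ u ∣ + l * ∣ v ∣ + B * ∣ w ∣
      ≤⟨ +-mono-≤ (+-mono-≤ (*-monoʳ-≤ l (sieve e ls ls-prime c adm₁ X)) (*-monoʳ-≤ l (sieve e ls ls-prime c′ adm₂ X′)))
                  (*-mono-≤ (density≤product e ls) ∣w∣≤l) ⟩
    l * (m * E) + l * (m * E) + m * l
      ≡⟨ collect l m E ⟩
    l * m * suc (2 * E) ∎
    where
    K₂ = ∑ X′ G
    u = + m ⊛ K ⊖ + B ⊛ + X
    v = + m ⊛ K₂ ⊖ + B ⊛ + X′
    w = + (l * X′) ⊖ + X
    pred-l : + pred l ≡ + l ⊖ + 1
    pred-l = trans (lemma (+ pred l)) (cong (_⊖ + 1) (cong +_ (suc-pred l {{prime⇒nonZero l-prime}})))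
      where
      lemma : ∀ x → x ≡ + 1 ⊕ x ⊖ + 1
      lemma = ℤ-Solver.solve-∀
    rearrange : ∀ l m k k₂ b x x′ → l ⊛ m ⊛ (k ⊕ ⊝ k₂) ⊖ (l ⊖ + 1) ⊛ b ⊛ x ≡
      l ⊛ (m ⊛ k ⊖ b ⊛ x) ⊖ l ⊛ (m ⊛ k₂ ⊖ b ⊛ x′) ⊖ b ⊛ (l ⊛ x′ ⊖ x)
    rearrange = ℤ-Solver.solve-∀
    collect : ∀ l m E → l * (m * E) + l * (m * E) + m * l ≡ l * m * suc (2 * E)
    collect = ℕ-Solver.solve-∀
    ∣w∣≤l : ∣ w ∣ ≤ l
    ∣w∣≤l = ∣⊖∣≤ (≤-trans (m≤n+m (l * X′) t₁) (<⇒≤ hi))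
                 (≤-trans lo (≤-trans (+-monoˡ-≤ (l * X′) (<⇒≤ t₁<l)) (≤-reflexive (+-comm l (l * X′)))))

-- Lower bound for the density of units.

*-^ : ∀ k a b → (a * b) ^ k ≡ a ^ k * b ^ k
*-^ zero    a b = refl
*-^ (suc k) a b = trans (cong (a * b *_) (*-^ k a b)) (lemma a b (a ^ k) (b ^ k))
  where
  lemma : ∀ a b c d → a * b * (c * d) ≡ a * c * (b * d)
  lemma = ℕ-Solver.solve-∀

-- After multiplication by `suc y ^ 9`, nine of the sixteen factors `y` pair with `y + 2` through
-- `y * (y + 2) ≤ (y + 1)²`, and the other seven only grow.
power-step : ∀ C y → C * suc y ^ 9 ≤ y ^ 16 → C * suc (suc y) ^ 9 ≤ suc y ^ 16
power-step C y C*≤ = *-cancelˡ-≤ (suc y ^ 9) {{m^n≢0 (suc y) 9}} (power-step′ (suc y) (suc (suc y)) (n≤1+n y) z[2+y] C*≤)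
  where
  open ≤-Reasoning
  z[2+y] : y * suc (suc y) ≤ suc y * suc y
  z[2+y] = ≤-trans (n≤1+n (y * suc (suc y))) (≤-reflexive (lemma y))
    where
    lemma : ∀ y → suc (y * suc (suc y)) ≡ suc y * suc y
    lemma = ℕ-Solver.solve-∀
  assoc₁ : ∀ a b c → a * (b * c) ≡ b * a * c
  assoc₁ = ℕ-Solver.solve-∀
  assoc₂ : ∀ a b → a * (b * b) ≡ b * (a * b)
  assoc₂ = ℕ-Solver.solve-∀
  power-step′ : ∀ z w → y ≤ z → y * w ≤ z * z → C * z ^ 9 ≤ y ^ 16 → z ^ 9 * (C * w ^ 9) ≤ z ^ 9 * z ^ 16
  power-step′ z w y≤z yw≤zz C*≤ = begin
    z ^ 9 * (C * w ^ 9)      ≡⟨ assoc₁ (z ^ 9) C (w ^ 9) ⟩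
    C * z ^ 9 * w ^ 9        ≤⟨ *-monoˡ-≤ (w ^ 9) C*≤ ⟩
    y ^ 16 * w ^ 9           ≡⟨ cong (_* w ^ 9) (^-distribˡ-+-* y 7 9) ⟩
    y ^ 7 * y ^ 9 * w ^ 9    ≡⟨ *-assoc (y ^ 7) (y ^ 9) (w ^ 9) ⟩
    y ^ 7 * (y ^ 9 * w ^ 9)  ≡⟨ cong (y ^ 7 *_) (*-^ 9 y w) ⟨
    y ^ 7 * (y * w) ^ 9      ≤⟨ *-mono-≤ (^-monoˡ-≤ 7 y≤z) (^-monoˡ-≤ 9 yw≤zz) ⟩
    z ^ 7 * (z * z) ^ 9      ≡⟨ cong (z ^ 7 *_) (*-^ 9 z z) ⟩
    z ^ 7 * (z ^ 9 * z ^ 9)  ≡⟨ assoc₂ (z ^ 7) (z ^ 9) ⟩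
    z ^ 9 * (z ^ 7 * z ^ 9)  ≡⟨ cong (z ^ 9 *_) (^-distribˡ-+-* z 7 9) ⟨
    z ^ 9 * z ^ 16           ∎

power-bound : ∀ C → C * 7 ^ 9 ≤ 6 ^ 16 → ∀ y → 6 ≤ y → C * suc y ^ 9 ≤ y ^ 16
power-bound C base (suc y) 6≤1+y with m≤n⇒m<n∨m≡n 6≤1+y
... | inj₁ 6<1+y = power-step C y (power-bound C base y (≤-pred 6<1+y))
... | inj₂ 6≡1+y = subst (λ z → C * suc z ^ 9 ≤ z ^ 16) 6≡1+y base

-- For `C = 2 ^ 16` this is the sixteenth power of 2^Ω(n) n^(9/16), where `n = product ls`; it is
-- compared with the sixteenth power of the density.
weight : ℕ → List ℕ → ℕ
weight C ls = C ^ length ls * product ls ^ 9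

weight-∷ : ∀ C l ls k k′ f → C * l ^ 9 * k ≤ k′ * f ^ 16 →
  weight C ls ≤ k * density 1 ls ^ 16 → weight C (l ∷ ls) ≤ k′ * (f * density 1 ls) ^ 16
weight-∷ C l ls k k′ f factor≤ ls≤ = begin
  C * c * (l * m) ^ 9          ≡⟨ cong (C * c *_) (*-^ 9 l m) ⟩
  C * c * (l ^ 9 * m ^ 9)      ≡⟨ interchange C c (l ^ 9) (m ^ 9) ⟩
  C * l ^ 9 * (c * m ^ 9)      ≤⟨ *-monoʳ-≤ (C * l ^ 9) ls≤ ⟩
  C * l ^ 9 * (k * B ^ 16)     ≡⟨ *-assoc (C * l ^ 9) k (B ^ 16) ⟨
  C * l ^ 9 * k * B ^ 16       ≤⟨ *-monoˡ-≤ (B ^ 16) factor≤ ⟩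
  k′ * f ^ 16 * B ^ 16         ≡⟨ *-assoc k′ (f ^ 16) (B ^ 16) ⟩
  k′ * (f ^ 16 * B ^ 16)       ≡⟨ cong (k′ *_) (*-^ 16 f B) ⟨
  k′ * (f * B) ^ 16            ∎
  where
  open ≤-Reasoning
  c = C ^ length ls
  m = product ls
  B = density 1 ls
  interchange : ∀ a b c d → a * b * (c * d) ≡ a * c * (b * d)
  interchange = ℕ-Solver.solve-∀

FiveOrMore : ℕ → Set
FiveOrMore l = l ≡ 5 ⊎ 7 ≤ l

-- Among the primes l ≥ 5 only l = 5 violates 2^16 l^9 ≤ (l - 1)^16, by a factor less than 30, and
-- it contributes l - 1 to the density only once.
weight≤density : ∀ C k → C * 7 ^ 9 ≤ 6 ^ 16 → C * 5 ^ 9 * k ≤ k * 5 ^ 16 → C * 5 ^ 9 * 1 ≤ k * 4 ^ 16 → 1 ≤ k →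
  ∀ ls → All FiveOrMore ls →
  (¬ 5 ∣ product ls → weight C ls ≤ 1 * density 1 ls ^ 16) × weight C ls ≤ k * density 1 ls ^ 16
weight≤density C k C7 C5 C5′ 1≤k = go
  where
  large : ∀ k {l} → 7 ≤ l → C * l ^ 9 * k ≤ k * pred l ^ 16
  large k {suc y} (s≤s 6≤y) = ≤-trans (*-monoˡ-≤ k (power-bound C C7 y 6≤y)) (≤-reflexive (*-comm (y ^ 16) k))
  large′ : ∀ k {l} → 7 ≤ l → C * l ^ 9 * k ≤ k * l ^ 16
  large′ k {l} 7≤l = ≤-trans (large k 7≤l) (*-monoʳ-≤ k (^-monoˡ-≤ 16 (pred[n]≤n {l})))
  go : ∀ ls → All FiveOrMore ls →
    (¬ 5 ∣ product ls → weight C ls ≤ 1 * density 1 ls ^ 16) × weight C ls ≤ k * density 1 ls ^ 16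
  go [] [] = (λ _ → ≤-refl) , ≤-trans 1≤k (≤-reflexive (sym (*-identityʳ k)))
  go (l ∷ ls) (l-cases ∷ ls-cases) with go ls ls-cases | l ∣? 1 * product ls | l-cases
  ... | without , always | yes _ | inj₁ refl =
    (λ 5∤ → contradiction (m∣m*n (product ls)) 5∤) , weight-∷ C 5 ls k k 5 C5 always
  -- The last `5` of the list: the rest contains none, so its sharper bound with constant `1` is
  -- available, and the step from `1` to `k` pays for the loss.
  ... | without , always | no 5∤ | inj₁ refl =
    (λ 5∤ → contradiction (m∣m*n (product ls)) 5∤) ,
    weight-∷ C 5 ls 1 k 4 C5′ (without (λ 5∣ → 5∤ (subst (5 ∣_) (sym (*-identityˡ (product ls))) 5∣)))
  ... | without , always | yes _ | inj₂ 7≤l =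
    (λ 5∤ → weight-∷ C l ls 1 1 l (large′ 1 7≤l) (without (λ 5∣ → 5∤ (∣n⇒∣m*n l 5∣)))) ,
    weight-∷ C l ls k k l (large′ k 7≤l) always
  ... | without , always | no _ | inj₂ 7≤l =
    (λ 5∤ → weight-∷ C l ls 1 1 (pred l) (large 1 7≤l) (without (λ 5∣ → 5∤ (∣n⇒∣m*n l 5∣)))) ,
    weight-∷ C l ls k k (pred l) (large k 7≤l) always

-- Summation by parts and total variation.

variation : ℕ → (ℕ → ℤ) → ℕ
variation zero    h = 0
variation (suc M) h = variation M h + ∣ h (suc M) ⊖ h M ∣

∑-by-parts : ∀ M (v h : ℕ → ℤ) →
  ∑ M (λ s → v s ⊛ h s) ≡ ∑ M v ⊛ h M ⊖ ∑ M (λ s → ∑ (suc s) v ⊛ (h (suc s) ⊖ h s))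
∑-by-parts zero    v h = sym (cong (_⊖ + 0) (ℤₚ.*-zeroˡ (h 0)))
∑-by-parts (suc M) v h = trans (cong (_⊕ v M ⊛ h M) (∑-by-parts M v h))
  (lemma (∑ M v) (v M) (h M) (h (suc M)) (∑ M (λ s → ∑ (suc s) v ⊛ (h (suc s) ⊖ h s))))
  where
  lemma : ∀ V v h h′ R → V ⊛ h ⊖ R ⊕ v ⊛ h ≡ (V ⊕ v) ⊛ h′ ⊖ (R ⊕ (V ⊕ v) ⊛ (h′ ⊖ h))
  lemma = ℤ-Solver.solve-∀

∣∑-by-parts∣≤ : ∀ M (v h : ℕ → ℤ) E → (∀ Y → ∣ ∑ Y v ∣ ≤ E) → ∣ h M ∣ ≤ 1 →
  ∣ ∑ M (λ s → v s ⊛ h s) ∣ ≤ E * (1 + variation M h)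
∣∑-by-parts∣≤ M v h E prefix hM = begin
  ∣ ∑ M (λ s → v s ⊛ h s) ∣               ≡⟨ cong ∣_∣ (∑-by-parts M v h) ⟩
  ∣ ∑ M v ⊛ h M ⊖ ∑ M r ∣                 ≤⟨ ℤₚ.∣i-j∣≤∣i∣+∣j∣ (∑ M v ⊛ h M) (∑ M r) ⟩
  ∣ ∑ M v ⊛ h M ∣ + ∣ ∑ M r ∣             ≡⟨ cong (_+ ∣ ∑ M r ∣) (ℤₚ.∣i*j∣≡∣i∣*∣j∣ (∑ M v) (h M)) ⟩
  ∣ ∑ M v ∣ * ∣ h M ∣ + ∣ ∑ M r ∣         ≤⟨ +-mono-≤ (*-mono-≤ (prefix M) hM) (rest M) ⟩
  E * 1 + E * variation M h               ≡⟨ *-distribˡ-+ E 1 (variation M h) ⟨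
  E * (1 + variation M h)                 ∎
  where
  open ≤-Reasoning
  r : ℕ → ℤ
  r s = ∑ (suc s) v ⊛ (h (suc s) ⊖ h s)
  rest : ∀ M → ∣ ∑ M r ∣ ≤ E * variation M h
  rest zero    = z≤n
  rest (suc M) = begin
    ∣ ∑ M r ⊕ r M ∣                                             ≤⟨ ℤₚ.∣i+j∣≤∣i∣+∣j∣ (∑ M r) (r M) ⟩
    ∣ ∑ M r ∣ + ∣ r M ∣                                         ≡⟨ cong (λ z → ∣ ∑ M r ∣ + z) (ℤₚ.∣i*j∣≡∣i∣*∣j∣ (∑ (suc M) v) (h (suc M) ⊖ h M)) ⟩
    ∣ ∑ M r ∣ + ∣ ∑ (suc M) v ∣ * ∣ h (suc M) ⊖ h M ∣           ≤⟨ +-mono-≤ (rest M) (*-monoˡ-≤ ∣ h (suc M) ⊖ h M ∣ (prefix (suc M))) ⟩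
    E * variation M h + E * ∣ h (suc M) ⊖ h M ∣                 ≡⟨ *-distribˡ-+ E (variation M h) ∣ h (suc M) ⊖ h M ∣ ⟨
    E * (variation M h + ∣ h (suc M) ⊖ h M ∣)                   ∎

-- Each unit of growth of `F` costs one sign change, of size `2`; by monotonicity the costs
-- telescope.
variation-sgn : ∀ M (F : ℕ → ℕ) → (∀ s → F s ≤ F (suc s)) → variation M (sgn ∘ F) + 2 * F 0 ≤ 2 * F M
variation-sgn zero    F mono = ≤-refl
variation-sgn (suc M) F mono = begin
  variation M (sgn ∘ F) + ∣ sgn (F (suc M)) ⊖ sgn (F M) ∣ + 2 * F 0  ≤⟨ +-monoˡ-≤ (2 * F 0) (+-monoʳ-≤ (variation M (sgn ∘ F)) jump) ⟩
  variation M (sgn ∘ F) + 2 * j + 2 * F 0                            ≡⟨ swap (variation M (sgn ∘ F)) (2 * j) (2 * F 0) ⟩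
  variation M (sgn ∘ F) + 2 * F 0 + 2 * j                            ≤⟨ +-monoˡ-≤ (2 * j) (variation-sgn M F mono) ⟩
  2 * F M + 2 * j                                                    ≡⟨ *-distribˡ-+ 2 (F M) j ⟨
  2 * (F M + j)                                                      ≡⟨ cong (2 *_) (m+[n∸m]≡n (mono M)) ⟩
  2 * F (suc M)                                                      ∎
  where
  open ≤-Reasoning
  j = F (suc M) ∸ F M
  swap : ∀ a b c → a + b + c ≡ a + c + b
  swap = ℕ-Solver.solve-∀
  jump : ∣ sgn (F (suc M)) ⊖ sgn (F M) ∣ ≤ 2 * j
  jump = subst (λ z → ∣ sgn z ⊖ sgn (F M) ∣ ≤ 2 * j) (m+[n∸m]≡n (mono M)) (sgn-variation (F M) j)

-- Correlations over units compared with averages along lines.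

χ-periodic : ∀ n → Periodic n (χ n)
χ-periodic n g = χ-cong n (g + n) n g
  (λ cop (d∣g , d∣n) → cop (∣m∣n⇒∣m+n d∣g d∣n , d∣n))
  (λ cop (d∣g+n , d∣n) → cop (∣m+n∣n⇒∣m d∣g+n d∣n , d∣n))

SieveBound : (n e B E : ℕ) → Set
SieveBound n e B E = ∀ c → Admissible e n c → ∀ X → ∣ + n ⊛ ∑ X (λ t → χ n (c + e * t)) ⊖ + B ⊛ + X ∣ ≤ n * E

correlation : (n x y : ℕ) → ℤ
correlation n x y = ∑ n (λ g → χ n g ⊛ (ψ n (x * g) ⊛ ψ n (y * g)))

Φ : ℕ → ℤ
Φ n = ∑ n (χ n)

-- The units g of ℤ/n are split into the progressions c + d q t, along which ag moves in steps of dp;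
-- s = p d t is a common parameter, and it refines t so that shifts by 1/p of the period stay integral.
module Progressions
  (n d m p q k a B E : ℕ) .{{_ : NonZero n}} .{{_ : NonZero p}}
  (n≡dm : n ≡ d * m) (qa≡p+km : q * a ≡ p + k * m) (p⊥q : Coprime p q)
  (B≤n : B ≤ n) (sieved : SieveBound n (d * q) B E)
  where

  private
    dm≢0 : NonZero (d * m)
    dm≢0 = subst NonZero n≡dm (≢-nonZero (≢-nonZero⁻¹ n))
    instance
      d≢0 : NonZero d
      d≢0 = m*n≢0⇒m≢0 d {{dm≢0}}
      R≢0 : NonZero (p * d)
      R≢0 = m*n≢0 p d
      pn≢0 : NonZero (p * n)
      pn≢0 = m*n≢0 p n

  R : ℕ
  R = p * d

  pn≡Rm : p * n ≡ R * m
  pn≡Rm = trans (cong (p *_) n≡dm) (sym (*-assoc p d m))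

  q⊥m : Coprime q m
  q⊥m {r} (r∣q , r∣m) = p⊥q (∣m+n∣n⇒∣m (subst (r ∣_) qa≡p+km (∣m⇒∣m*n a r∣q)) (∣n⇒∣m*n k r∣m) , r∣q)

  admissible : ∀ {c} → Coprime c d → Admissible (d * q) n c
  admissible {c} c⊥d {r} r∣c r∣dq r∣n = q⊥m
    ( Coprimality.coprime-divisor {r} {d} r⊥d r∣dq
    , Coprimality.coprime-divisor {r} {d} r⊥d (subst (r ∣_) n≡dm r∣n))
    where
    r⊥d : Coprime r d
    r⊥d (x∣r , x∣d) = c⊥d (∣-trans x∣r r∣c , x∣d)

  -- After splitting into classes modulo `d`, `t` is replaced by `q * t`, a permutation modulo `m`.
  -- With the step `d * q`, multiplication by `a` moves by `d * p` modulo `n`.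
  decompose : ∀ F → Periodic n F → ∑ n F ≡ ∑ d (λ c → ∑ m (λ t → F (c + d * q * t)))
  decompose F per = begin
    ∑ n F                                      ≡⟨ cong (λ z → ∑ z F) (trans n≡dm (*-comm d m)) ⟩
    ∑ (m * d) F                                ≡⟨ ∑-blocks m d F ⟩
    ∑ m (λ t → ∑ d (λ c → F (t * d + c)))      ≡⟨ ∑-swap m d _ ⟩
    ∑ d (λ c → ∑ m (λ t → F (t * d + c)))      ≡⟨ ∑-cong′ d (λ c → sym (∑-perm q m q⊥m (per′ c))) ⟩
    ∑ d (λ c → ∑ m (λ t → F (q * t * d + c)))  ≡⟨ ∑-cong′ d (λ c → ∑-cong′ m λ t → cong F (lemma q t d c)) ⟩
    ∑ d (λ c → ∑ m (λ t → F (c + d * q * t)))  ∎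
    where
    open ≡-Reasoning
    lemma : ∀ q t d c → q * t * d + c ≡ c + d * q * t
    lemma = ℕ-Solver.solve-∀
    per′ : ∀ c → Periodic m (λ t → F (t * d + c))
    per′ c t = trans (cong F (trans (expand t m d c) (cong (λ z → t * d + c + z) (sym n≡dm)))) (per (t * d + c))
      where
      expand : ∀ t m d c → (t + m) * d + c ≡ t * d + c + d * m
      expand = ℕ-Solver.solve-∀

  -- At `s = R * t`, with `g = c + d * q * t`, the arguments are `p * g` and, modulo `n`, `a * g`;
  -- the period `p * n` of the first wave absorbs its factor `p`. Over `p * n` values of `s` the
  -- waves complete `q` and `p` periods, so the line closes up.
  H : ℕ → ℕ → ℤ
  H c s = ψ (p * n) (c * p + q * s) ⊛ ψ n (a * c + s)

  K : ℕ → ℤ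
  K c = ∑ m (λ t → χ n (c + d * q * t) ⊛ H c (R * t))

  U : ℕ → ℤ
  U c = ∑ m (λ t → χ n (c + d * q * t))

  coprime-class : ∀ c t → Coprime (c + d * q * t) n → Coprime c d
  coprime-class c t cop {r} (r∣c , r∣d) = cop
    ( ∣m∣n⇒∣m+n r∣c (∣m⇒∣m*n t (∣m⇒∣m*n q r∣d))
    , subst (r ∣_) (sym n≡dm) (∣m⇒∣m*n m r∣d))

  -- A class not prime to `d` contains no unit of `n`. The extra factor confines all sums to classes
  -- for which `admissible` supplies the sieve.
  χ-class : ∀ c t → χ n (c + d * q * t) ≡ χ d c ⊛ χ n (c + d * q * t)
  χ-class c t with coprime? c d
  ... | yes c⊥d = sym (trans (cong (_⊛ χ n (c + d * q * t)) (χ-coprime d c c⊥d)) (ℤₚ.*-identityˡ (χ n (c + d * q * t))))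
  ... | no ¬c⊥d = trans (χ-¬coprime n (c + d * q * t) (¬c⊥d ∘ coprime-class c t)) (sym (trans (cong (_⊛ χ n (c + d * q * t)) (χ-¬coprime d c ¬c⊥d)) (ℤₚ.*-zeroˡ (χ n (c + d * q * t)))))

  Φ-decomposition : Φ n ≡ ∑ d (λ c → χ d c ⊛ U c)
  Φ-decomposition = trans (decompose (χ n) (χ-periodic n)) (∑-cong′ d λ c →
    trans (∑-cong′ m (χ-class c)) (∑-*ˡ m (χ d c) (λ t → χ n (c + d * q * t))))

  correlation-decomposition : correlation n 1 a ≡ ∑ d (λ c → χ d c ⊛ K c)
  correlation-decomposition = trans (decompose F F-periodic) (∑-cong′ d λ c →
    trans (∑-cong′ m (F-class c)) (∑-*ˡ m (χ d c) (λ t → χ n (c + d * q * t) ⊛ H c (R * t))))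
    where
    F : ℕ → ℤ
    F g = χ n g ⊛ (ψ n (1 * g) ⊛ ψ n (a * g))
    F-periodic : Periodic n F
    F-periodic g = cong₂ _⊛_ (χ-periodic n g) (cong₂ _⊛_
      (trans (cong (ψ n) (*-distribˡ-+ 1 g n)) (ψ-+* n (1 * g) 1))
      (trans (cong (ψ n) (*-distribˡ-+ a g n)) (ψ-+* n (a * g) a)))
    first : ∀ c t → ψ n (1 * (c + d * q * t)) ≡ ψ (p * n) (c * p + q * (R * t))
    first c t = trans (sym (ψ-scale p n (1 * (c + d * q * t)))) (cong (ψ (p * n)) (lemma p c d q t))
      where
      lemma : ∀ p c d q t → p * (1 * (c + d * q * t)) ≡ c * p + q * (p * d * t)
      lemma = ℕ-Solver.solve-∀
    second : ∀ c t → ψ n (a * (c + d * q * t)) ≡ ψ n (a * c + R * t)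
    second c t = trans (cong (ψ n) along) (ψ-+* n (a * c + R * t) (k * t))
      where
      expand : ∀ a c d q t → a * (c + d * q * t) ≡ a * c + d * t * (q * a)
      expand = ℕ-Solver.solve-∀
      collect : ∀ a c d t p k m → a * c + d * t * (p + k * m) ≡ a * c + p * d * t + k * t * (d * m)
      collect = ℕ-Solver.solve-∀
      along : a * (c + d * q * t) ≡ a * c + R * t + k * t * n
      along = trans (expand a c d q t) (trans (cong (λ z → a * c + d * t * z) qa≡p+km)
        (trans (collect a c d t p k m) (cong (λ z → a * c + R * t + k * t * z) (sym n≡dm))))
    F-class : ∀ c t → F (c + d * q * t) ≡ χ d c ⊛ (χ n (c + d * q * t) ⊛ H c (R * t))
    F-class c t = trans (cong₂ _⊛_ (χ-class c t) (cong₂ _⊛_ (first c t) (second c t)))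
                        (ℤₚ.*-assoc (χ d c) (χ n (c + d * q * t)) (H c (R * t)))

  ∑H : ℕ → ℤ
  ∑H c = ∑ (p * n) (H c)

  ∣H∣≡1 : ∀ c s → ∣ H c s ∣ ≡ 1
  ∣H∣≡1 c s = ∣ψψ∣ (p * n) n (c * p + q * s) (a * c + s)

  -- The product of the two signs is `sgn` of the sum of the two floors, which grows by
  -- `2 * (p + q)` along the closed line.
  variation-H : ∀ c → variation (p * n) (H c) ≤ 4 * (p + q)
  variation-H c = +-cancelʳ-≤ (2 * F 0) (variation (p * n) (H c)) (4 * (p + q)) (begin
    variation (p * n) (H c) + 2 * F 0      ≡⟨ cong (_+ 2 * F 0) (variation-cong (p * n)) ⟩
    variation (p * n) (sgn ∘ F) + 2 * F 0  ≤⟨ variation-sgn (p * n) F F-mono ⟩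
    2 * F (p * n)                          ≡⟨ cong (2 *_) F-end ⟩
    2 * (F 0 + 2 * (p + q))                ≡⟨ lemma (F 0) (p + q) ⟩
    4 * (p + q) + 2 * F 0                  ∎)
    where
    open ≤-Reasoning
    lemma : ∀ f x → 2 * (f + 2 * x) ≡ 4 * x + 2 * f
    lemma = ℕ-Solver.solve-∀
    F₁ F₂ F : ℕ → ℕ
    F₁ s = 2 * (c * p + q * s) / (p * n)
    F₂ s = 2 * (a * c + s) / n
    F s = F₁ s + F₂ s
    H≡sgn : ∀ s → H c s ≡ sgn (F s)
    H≡sgn s = trans (cong₂ _⊛_ (ψ-/ (p * n) (c * p + q * s)) (ψ-/ n (a * c + s))) (sym (sgn-+ (F₁ s) (F₂ s)))
    variation-cong : ∀ M → variation M (H c) ≡ variation M (sgn ∘ F)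
    variation-cong zero    = refl
    variation-cong (suc M) = cong₂ _+_ (variation-cong M) (cong ∣_∣ (cong₂ _⊖_ (H≡sgn (suc M)) (H≡sgn M)))
    F-mono : ∀ s → F s ≤ F (suc s)
    F-mono s = +-mono-≤
      (/-monoˡ-≤ (p * n) (*-monoʳ-≤ 2 (+-monoʳ-≤ (c * p) (*-monoʳ-≤ q (n≤1+n s)))))
      (/-monoˡ-≤ n (*-monoʳ-≤ 2 (+-monoʳ-≤ (a * c) (n≤1+n s))))
    F₁-end : F₁ (p * n) ≡ F₁ 0 + 2 * q
    F₁-end = trans (cong (_/ (p * n)) (expand c p q (p * n))) ([m+k*n]/n≡m/n+k (2 * (c * p + q * 0)) (2 * q) (p * n))
      where
      expand : ∀ c p q x → 2 * (c * p + q * x) ≡ 2 * (c * p + q * 0) + 2 * q * x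
      expand = ℕ-Solver.solve-∀
    F₂-end : F₂ (p * n) ≡ F₂ 0 + 2 * p
    F₂-end = trans (cong (_/ n) (expand (a * c) p n)) ([m+k*n]/n≡m/n+k (2 * (a * c + 0)) (2 * p) n)
      where
      expand : ∀ x p n → 2 * (x + p * n) ≡ 2 * (x + 0) + 2 * p * n
      expand = ℕ-Solver.solve-∀
    F-end : F (p * n) ≡ F 0 + 2 * (p + q)
    F-end = trans (cong₂ _+_ F₁-end F₂-end) (collect (F₁ 0) (F₂ 0) p q)
      where
      collect : ∀ x y p q → x + 2 * q + (y + 2 * p) ≡ x + y + 2 * (p + q)
      collect = ℕ-Solver.solve-∀

  classError : ℕ
  classError = n * R * suc E * (1 + 4 * (p + q))

  -- The weight `v` compares the units, placed at the multiples of `R`, with their mean density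
  -- `B / (n * R)` among all `s`. The sieve and the rounding to a multiple of `R` bound its prefix
  -- sums, and `H c` has few sign changes, so summation by parts applies.
  class-bound : ∀ c → Coprime c d → ∣ + (n * R) ⊛ K c ⊖ + B ⊛ ∑H c ∣ ≤ classError
  class-bound c c⊥d = begin
    ∣ + (n * R) ⊛ K c ⊖ + B ⊛ ∑H c ∣                ≡⟨ cong ∣_∣ (sym weighted) ⟩
    ∣ ∑ (p * n) (λ s → v s ⊛ H c s) ∣               ≤⟨ ∣∑-by-parts∣≤ (p * n) v (H c) (n * R * suc E) prefix (≤-reflexive (∣H∣≡1 c (p * n))) ⟩
    n * R * suc E * (1 + variation (p * n) (H c))   ≤⟨ *-monoʳ-≤ (n * R * suc E) (+-monoʳ-≤ 1 (variation-H c)) ⟩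
    classError                                      ∎
    where
    open ≤-Reasoning
    G D v : ℕ → ℤ
    G t = χ n (c + d * q * t)
    D s = 𝟙 (R ∣? s) ⊛ G (s / R)
    v s = + (n * R) ⊛ D s ⊖ + B
    0<R : 0 < R
    0<R = >-nonZero⁻¹ R
    on : ∀ y → D (0 + R * y) ≡ G y
    on y = trans (cong₂ _⊛_ (𝟙-yes (R ∣? R * y) (m∣m*n y)) (cong G (trans (cong (_/ R) (*-comm R y)) (m*n/n≡m y R)))) (ℤₚ.*-identityˡ (G y))
    not-multiple : ∀ s y → s < R * y → R * y < s + R → ¬ R ∣ s
    not-multiple s y s<Ry Ry<s+R R∣s = <⇒≱ (m<n+o⇒m∸n<o (R * y) s Ry<s+R)
      (∣⇒≤ {{>-nonZero (m<n⇒0<n∸m s<Ry)}} (∣m+n∣m⇒∣n (subst (R ∣_) (sym (m+[n∸m]≡n (<⇒≤ s<Ry))) (m∣m*n y)) R∣s))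
    off : ∀ s y → s < 0 + R * y → 0 + R * y < s + R → D s ≡ + 0
    off s y s<Ry Ry<s+R = trans (cong (_⊛ G (s / R)) (𝟙-no (R ∣? s) (not-multiple s y s<Ry Ry<s+R))) (ℤₚ.*-zeroˡ (G (s / R)))
    ∑DH : ∑ (p * n) (λ s → D s ⊛ H c s) ≡ K c
    ∑DH with ∑-sparse {R} {0} (λ s → D s ⊛ H c s) (λ t → G t ⊛ H c (R * t)) 0<R
               (λ y → cong (_⊛ H c (R * y)) (on y))
               (λ s y lo hi → trans (cong (_⊛ H c s) (off s y lo hi)) (ℤₚ.*-zeroˡ (H c s))) (p * n)
    ... | X , lo , hi , eq = trans eq (cong (λ z → ∑ z (λ t → G t ⊛ H c (R * t))) (≤-antisym
            (≤-pred (*-cancelˡ-< R X (suc m) (<-≤-trans hi (≤-reflexive (trans (cong (_+ R) pn≡Rm) (trans (+-comm (R * m) R) (sym (*-suc R m))))))))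
            (*-cancelˡ-≤ R (≤-trans (≤-reflexive (sym pn≡Rm)) lo))))
    weighted : ∑ (p * n) (λ s → v s ⊛ H c s) ≡ + (n * R) ⊛ K c ⊖ + B ⊛ ∑H c
    weighted = E.begin
      ∑ (p * n) (λ s → v s ⊛ H c s)
        E.≡⟨ ∑-cong′ (p * n) (λ s → expand (+ (n * R)) (D s) (+ B) (H c s)) ⟩
      ∑ (p * n) (λ s → + (n * R) ⊛ (D s ⊛ H c s) ⊖ + B ⊛ H c s)
        E.≡⟨ ∑-⊖ (p * n) _ _ ⟩
      ∑ (p * n) (λ s → + (n * R) ⊛ (D s ⊛ H c s)) ⊖ ∑ (p * n) (λ s → + B ⊛ H c s)
        E.≡⟨ cong₂ _⊖_ (trans (∑-*ˡ (p * n) (+ (n * R)) (λ s → D s ⊛ H c s)) (cong (+ (n * R) ⊛_) ∑DH)) (∑-*ˡ (p * n) (+ B) (H c)) ⟩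
      + (n * R) ⊛ K c ⊖ + B ⊛ ∑H c E.∎
      where
      module E = ≡-Reasoning
      expand : ∀ x D b h → (x ⊛ D ⊖ b) ⊛ h ≡ x ⊛ (D ⊛ h) ⊖ b ⊛ h
      expand = ℤ-Solver.solve-∀
    prefix : ∀ Y → ∣ ∑ Y v ∣ ≤ n * R * suc E
    prefix Y with ∑-sparse {R} {0} D G 0<R on off Y
    ... | X , lo , hi , eq = begin
      ∣ ∑ Y v ∣
        ≡⟨ cong ∣_∣ (trans (∑-⊖ Y _ _) (trans
             (cong₂ _⊖_ (trans (∑-*ˡ Y (+ (n * R)) D) (cong₂ _⊛_ (ℤₚ.pos-* n R) eq)) (∑-const Y (+ B)))
             (trans (rearrange (+ n) (+ R) (∑ X G) (+ Y) (+ B) (+ X)) (cong (λ z → + R ⊛ u ⊕ + B ⊛ (z ⊖ + Y)) (sym (ℤₚ.pos-* R X)))))) ⟩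
      ∣ + R ⊛ u ⊕ + B ⊛ w ∣
        ≤⟨ ℤₚ.∣i+j∣≤∣i∣+∣j∣ (+ R ⊛ u) (+ B ⊛ w) ⟩
      ∣ + R ⊛ u ∣ + ∣ + B ⊛ w ∣
        ≡⟨ cong₂ _+_ (ℤₚ.∣i*j∣≡∣i∣*∣j∣ (+ R) u) (ℤₚ.∣i*j∣≡∣i∣*∣j∣ (+ B) w) ⟩
      R * ∣ u ∣ + B * ∣ w ∣
        ≤⟨ +-mono-≤ (*-monoʳ-≤ R (sieved c (admissible c⊥d) X))
             (*-mono-≤ B≤n (∣⊖∣≤ (<⇒≤ hi) (≤-trans lo (m≤m+n (R * X) R)))) ⟩
      R * (n * E) + n * R
        ≡⟨ collect R n E ⟩
      n * R * suc E ∎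
      where
      u = + n ⊛ ∑ X G ⊖ + B ⊛ + X
      w = + (R * X) ⊖ + Y
      rearrange : ∀ n r g y b x → n ⊛ r ⊛ g ⊖ y ⊛ b ≡ r ⊛ (n ⊛ g ⊖ b ⊛ x) ⊕ b ⊛ (r ⊛ x ⊖ y)
      rearrange = ℤ-Solver.solve-∀
      collect : ∀ R n E → R * (n * E) + n * R ≡ n * R * suc E
      collect = ℕ-Solver.solve-∀

  ∣∑χ∣≤ : ∀ C (f : ℕ → ℤ) → (∀ c → Coprime c d → ∣ f c ∣ ≤ C) → ∣ ∑ d (λ c → χ d c ⊛ f c) ∣ ≤ d * C
  ∣∑χ∣≤ C f bound = ∣∑∣≤* d C λ c _ → term c
    where
    term : ∀ c → ∣ χ d c ⊛ f c ∣ ≤ C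
    term c with coprime? c d
    ... | yes c⊥d = ≤-trans (≤-reflexive (cong ∣_∣ (trans (cong (_⊛ f c) (χ-coprime d c c⊥d)) (ℤₚ.*-identityˡ (f c))))) (bound c c⊥d)
    ... | no ¬c⊥d = ≤-trans (≤-reflexive (cong ∣_∣ (trans (cong (_⊛ f c) (χ-¬coprime d c ¬c⊥d)) (ℤₚ.*-zeroˡ (f c))))) z≤n

  ∑χ-linear : ∀ x y (f g : ℕ → ℤ) →
    ∑ d (λ c → χ d c ⊛ (x ⊛ f c ⊖ y ⊛ g c)) ≡ x ⊛ ∑ d (λ c → χ d c ⊛ f c) ⊖ y ⊛ ∑ d (λ c → χ d c ⊛ g c)
  ∑χ-linear x y f g = begin
    ∑ d (λ c → χ d c ⊛ (x ⊛ f c ⊖ y ⊛ g c))                     ≡⟨ ∑-cong′ d (λ c → lemma (χ d c) x (f c) y (g c)) ⟩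
    ∑ d (λ c → x ⊛ (χ d c ⊛ f c) ⊖ y ⊛ (χ d c ⊛ g c))           ≡⟨ ∑-⊖ d _ _ ⟩
    ∑ d (λ c → x ⊛ (χ d c ⊛ f c)) ⊖ ∑ d (λ c → y ⊛ (χ d c ⊛ g c)) ≡⟨ cong₂ _⊖_ (∑-*ˡ d x (λ c → χ d c ⊛ f c)) (∑-*ˡ d y (λ c → χ d c ⊛ g c)) ⟩
    x ⊛ ∑ d (λ c → χ d c ⊛ f c) ⊖ y ⊛ ∑ d (λ c → χ d c ⊛ g c)   ∎
    where
    open ≡-Reasoning
    lemma : ∀ w x f y g → w ⊛ (x ⊛ f ⊖ y ⊛ g) ≡ x ⊛ (w ⊛ f) ⊖ y ⊛ (w ⊛ g)
    lemma = ℤ-Solver.solve-∀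

  𝓗 : ℤ
  𝓗 = ∑ d (λ c → χ d c ⊛ ∑H c)

  correlation-estimate : ∣ + (n * R) ⊛ correlation n 1 a ⊖ + B ⊛ 𝓗 ∣ ≤ d * classError
  correlation-estimate = subst (λ z → ∣ z ∣ ≤ d * classError)
    (trans (∑χ-linear (+ (n * R)) (+ B) K ∑H) (cong (λ z → + (n * R) ⊛ z ⊖ + B ⊛ 𝓗) (sym correlation-decomposition)))
    (∣∑χ∣≤ classError (λ c → + (n * R) ⊛ K c ⊖ + B ⊛ ∑H c) class-bound)

  -- The same decomposition with the constant `1` in place of the waves. It eliminates `B` in favour
  -- of `Φ n`, so the density for the step `d * q` never has to be evaluated.
  Φ-estimate : ∣ + n ⊛ Φ n ⊖ + B ⊛ (+ m ⊛ Φ d) ∣ ≤ d * (n * E)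
  Φ-estimate = subst (λ z → ∣ z ∣ ≤ d * (n * E))
    (trans (∑χ-linear (+ n) (+ B) U (λ _ → + m)) (cong₂ (λ y z → + n ⊛ y ⊖ + B ⊛ z) (sym Φ-decomposition) (trans (∑-*ʳ d (+ m) (χ d)) (ℤₚ.*-comm (Φ d) (+ m)))))
    (∣∑χ∣≤ (n * E) (λ c → + n ⊛ U c ⊖ + B ⊛ + m) (λ c c⊥d → sieved c (admissible c⊥d) m))

  -- `α` will be `0`, `3` or `10`. The trivial bound for `𝓗` has `p * n` in place of `n`; this
  -- difference is the source of the saving `1 / p`.
  conclusion : ∀ α → 10 * ∣ 𝓗 ∣ ≤ α * (∣ Φ d ∣ * n) →
    10 * p * ∣ correlation n 1 a ∣ ≤ α * (∣ Φ n ∣ + d * E) + 10 * p * (d * (suc E * (1 + 4 * (p + q))))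
  conclusion α small = *-cancelˡ-≤ (n * d) {{m*n≢0 n d}} (begin
    n * d * (10 * p * ∣S∣)                                 ≡⟨ shuffle₁ n d p ∣S∣ ⟩
    10 * (n * R * ∣S∣)                                     ≤⟨ *-monoʳ-≤ 10 S-bound ⟩
    10 * (B * ∣ 𝓗 ∣ + d * classError)                      ≡⟨ shuffle₂ B ∣ 𝓗 ∣ (d * classError) ⟩
    B * (10 * ∣ 𝓗 ∣) + 10 * (d * classError)               ≤⟨ +-monoˡ-≤ (10 * (d * classError)) (*-monoʳ-≤ B small) ⟩
    B * (α * (∣ Φ d ∣ * n)) + 10 * (d * classError)
      ≡⟨ cong (_+ 10 * (d * classError)) (trans (cong (λ z → B * (α * (∣ Φ d ∣ * z))) n≡dm) (shuffle₃ B α ∣ Φ d ∣ d m)) ⟩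
    α * d * (B * (m * ∣ Φ d ∣)) + 10 * (d * classError)    ≤⟨ +-monoˡ-≤ (10 * (d * classError)) (*-monoʳ-≤ (α * d) Φ-bound) ⟩
    α * d * (n * ∣ Φ n ∣ + d * (n * E)) + 10 * (d * classError)
      ≡⟨ shuffle₄ α d n ∣ Φ n ∣ E p (suc E * (1 + 4 * (p + q))) (1 + 4 * (p + q)) (suc E) refl ⟩
    n * d * (α * (∣ Φ n ∣ + d * E) + 10 * p * (d * (suc E * (1 + 4 * (p + q))))) ∎)
    where
    open ≤-Reasoning
    ∣S∣ = ∣ correlation n 1 a ∣
    shuffle₁ : ∀ n d p s → n * d * (10 * p * s) ≡ 10 * (n * (p * d) * s)
    shuffle₁ = ℕ-Solver.solve-∀
    shuffle₂ : ∀ b h w → 10 * (b * h + w) ≡ b * (10 * h) + 10 * w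
    shuffle₂ = ℕ-Solver.solve-∀
    shuffle₃ : ∀ b α f d m → b * (α * (f * (d * m))) ≡ α * d * (b * (m * f))
    shuffle₃ = ℕ-Solver.solve-∀
    shuffle₄ : ∀ α d n f E p w x y → w ≡ y * x → α * d * (n * f + d * (n * E)) + 10 * (d * (n * (p * d) * y * x)) ≡
      n * d * (α * (f + d * E) + 10 * p * (d * w))
    shuffle₄ α d n f E p w x y refl = lemma α d n f E p x y
      where
      lemma : ∀ α d n f E p x y → α * d * (n * f + d * (n * E)) + 10 * (d * (n * (p * d) * y * x)) ≡
        n * d * (α * (f + d * E) + 10 * p * (d * (y * x)))
      lemma = ℕ-Solver.solve-∀
    S-bound : n * R * ∣S∣ ≤ B * ∣ 𝓗 ∣ + d * classError
    S-bound = begin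
      n * R * ∣S∣                                                       ≡⟨ ℤₚ.∣i*j∣≡∣i∣*∣j∣ (+ (n * R)) (correlation n 1 a) ⟨
      ∣ x ∣                                                             ≡⟨ cong ∣_∣ (lemma x (+ B ⊛ 𝓗)) ⟩
      ∣ + B ⊛ 𝓗 ⊕ (x ⊖ + B ⊛ 𝓗) ∣                                       ≤⟨ ℤₚ.∣i+j∣≤∣i∣+∣j∣ (+ B ⊛ 𝓗) (x ⊖ + B ⊛ 𝓗) ⟩
      ∣ + B ⊛ 𝓗 ∣ + ∣ x ⊖ + B ⊛ 𝓗 ∣                                     ≤⟨ +-mono-≤ (≤-reflexive (ℤₚ.∣i*j∣≡∣i∣*∣j∣ (+ B) 𝓗)) correlation-estimate ⟩
      B * ∣ 𝓗 ∣ + d * classError                                        ∎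
      where
      x = + (n * R) ⊛ correlation n 1 a
      lemma : ∀ x y → x ≡ y ⊕ (x ⊖ y)
      lemma = ℤ-Solver.solve-∀
    Φ-bound : B * (m * ∣ Φ d ∣) ≤ n * ∣ Φ n ∣ + d * (n * E)
    Φ-bound = begin
      B * (m * ∣ Φ d ∣)                      ≡⟨ cong (B *_) (ℤₚ.∣i*j∣≡∣i∣*∣j∣ (+ m) (Φ d)) ⟨
      B * ∣ + m ⊛ Φ d ∣                      ≡⟨ ℤₚ.∣i*j∣≡∣i∣*∣j∣ (+ B) (+ m ⊛ Φ d) ⟨
      ∣ y ∣                                  ≡⟨ cong ∣_∣ (lemma x y) ⟩
      ∣ x ⊖ (x ⊖ y) ∣                        ≤⟨ ℤₚ.∣i-j∣≤∣i∣+∣j∣ x (x ⊖ y) ⟩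
      ∣ x ∣ + ∣ x ⊖ y ∣                      ≤⟨ +-mono-≤ (≤-reflexive (ℤₚ.∣i*j∣≡∣i∣*∣j∣ (+ n) (Φ n))) Φ-estimate ⟩
      n * ∣ Φ n ∣ + d * (n * E)              ∎
      where
      x = + n ⊛ Φ n
      y = + B ⊛ (+ m ⊛ Φ d)
      lemma : ∀ x y → y ≡ x ⊖ (x ⊖ y)
      lemma = ℤ-Solver.solve-∀

-- Averages along a line.

+≤⇒≤∣∣ : ∀ {x y} → + x ≤ᶻ y → x ≤ ∣ y ∣
+≤⇒≤∣∣ (+≤+ x≤y) = x≤y

-- The factor is `Φ d` and not `d` because this bound serves the main term, where no constant may be
-- lost.
∣∑χ∣≤Φ : ∀ d C (f : ℕ → ℤ) → (∀ c → ∣ f c ∣ ≤ C) → ∣ ∑ d (λ c → χ d c ⊛ f c) ∣ ≤ ∣ Φ d ∣ * C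
∣∑χ∣≤Φ d C f bound = ≤-trans
  (+≤⇒≤∣∣ (ℤₚ.≤-trans (∣∑∣≤ d λ c _ → term c) (ℤₚ.≤-reflexive (∑-*ʳ d (+ C) (χ d)))))
  (≤-reflexive (ℤₚ.∣i*j∣≡∣i∣*∣j∣ (Φ d) (+ C)))
  where
  term : ∀ c → + ∣ χ d c ⊛ f c ∣ ≤ᶻ χ d c ⊛ + C
  term c with coprime? c d
  ... | yes c⊥d rewrite χ-coprime d c c⊥d | ℤₚ.*-identityˡ (f c) | ℤₚ.*-identityˡ (+ C) = +≤+ (bound c)
  ... | no ¬c⊥d rewrite χ-¬coprime d c ¬c⊥d | ℤₚ.*-zeroˡ (f c) | ℤₚ.*-zeroˡ (+ C) = +≤+ z≤n

-- By definition the sum `∑H c` of `Progressions`, freed from the parameters of that module.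
cross : (n p q a c : ℕ) → ℤ
cross n p q a c = ∑ (p * n) (λ s → ψ (p * n) (c * p + q * s) ⊛ ψ n (a * c + s))

cross-blocks : ∀ n p q a c → Coprime q p →
  cross n p q a c ≡ ∑ n (λ s → ∑ p (λ j → ψ (p * n) (c * p + q * s + j * n)) ⊛ ψ n (a * c + s))
cross-blocks n p q a c q⊥p = begin
  cross n p q a c
    ≡⟨ ∑-blocks p n _ ⟩
  ∑ p (λ j → ∑ n (λ s → ψ (p * n) (c * p + q * (j * n + s)) ⊛ ψ n (a * c + (j * n + s))))
    ≡⟨ ∑-swap p n _ ⟩
  ∑ n (λ s → ∑ p (λ j → ψ (p * n) (c * p + q * (j * n + s)) ⊛ ψ n (a * c + (j * n + s))))
    ≡⟨ ∑-cong′ n (λ s → ∑-cong′ p λ j → cong₂ _⊛_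
         (cong (ψ (p * n)) (first c p q j n s))
         (trans (cong (ψ n) (second a c j n s)) (ψ-+* n (a * c + s) j))) ⟩
  ∑ n (λ s → ∑ p (λ j → ψ (p * n) (c * p + q * s + q * j * n) ⊛ ψ n (a * c + s)))
    ≡⟨ ∑-cong′ n (λ s → trans (∑-*ʳ p (ψ n (a * c + s)) (λ j → ψ (p * n) (c * p + q * s + q * j * n)))
         (cong (_⊛ ψ n (a * c + s)) (ψ-multiplication-perm p q n (c * p + q * s) q⊥p))) ⟩
  ∑ n (λ s → ∑ p (λ j → ψ (p * n) (c * p + q * s + j * n)) ⊛ ψ n (a * c + s)) ∎
  where
  open ≡-Reasoning
  first : ∀ c p q j n s → c * p + q * (j * n + s) ≡ c * p + q * s + q * j * n
  first = ℕ-Solver.solve-∀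
  second : ∀ a c j n s → a * c + (j * n + s) ≡ a * c + s + j * n
  second = ℕ-Solver.solve-∀

cross-odd : ∀ n {p} q a c h → Coprime q p → p ≡ 1 + 2 * h → .{{_ : NonZero n}} →
  cross n p q a c ≡ ∑ n (λ s → ψ n (c * p + q * s) ⊛ ψ n (a * c + s))
cross-odd n {p} q a c h q⊥p p-odd = trans (cross-blocks n p q a c q⊥p)
  (∑-cong′ n λ s → cong (_⊛ ψ n (a * c + s)) (ψ-multiplication-odd h n (c * p + q * s) p-odd))

cross-even : ∀ n {p} q a c h → Coprime q p → p ≡ 2 * h → .{{_ : NonZero p}} .{{_ : NonZero n}} → cross n p q a c ≡ + 0
cross-even n {p} q a c h q⊥p p-even = trans (cross-blocks n p q a c q⊥p)
  (trans (∑-cong′ n λ s → trans (cong (_⊛ ψ n (a * c + s)) (ψ-multiplication-even h n (c * p + q * s) p-even)) (ℤₚ.*-zeroˡ (ψ n (a * c + s))))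
         (∑-zero n))

∣cross-odd∣≤ : ∀ n {p} q a c h → Coprime q p → p ≡ 1 + 2 * h → .{{_ : NonZero n}} → ∣ cross n p q a c ∣ ≤ n
∣cross-odd∣≤ n {p} q a c h q⊥p p-odd = ≤-trans (≤-reflexive (cong ∣_∣ (cross-odd n q a c h q⊥p p-odd)))
  (≤-trans (∣∑∣≤* n 1 λ s _ → ≤-reflexive (∣ψψ∣ n n (c * p + q * s) (a * c + s))) (≤-reflexive (*-identityʳ n)))

-- With `p` averaged out and `q = 1`, both waves advance at the same speed, and only their offset
-- `a * c - p * c` matters.
cross-1 : ∀ n {p} a c h b → p ≡ 1 + 2 * h → a ≡ p + b → .{{_ : NonZero n}} →
  cross n p 1 a c ≡ autocorrelation n (b * c)
cross-1 n {p} a c h b p-odd refl = begin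
  cross n p 1 (p + b) c                                          ≡⟨ cross-odd n 1 (p + b) c h (Coprimality.1-coprimeTo p) p-odd ⟩
  ∑ n (λ s → ψ n (c * p + 1 * s) ⊛ ψ n ((p + b) * c + s))
    ≡⟨ ∑-cong′ n (λ s → cong₂ _⊛_ (cong (λ z → ψ n (c * p + z)) (*-identityˡ s)) (cong (ψ n) (lemma p b c s))) ⟩
  ∑ n (λ s → F (c * p + s))                                      ≡⟨ ∑-shift n (c * p) F-periodic ⟩
  ∑ n F                                                          ∎
  where
  open ≡-Reasoning
  F : ℕ → ℤ
  F u = ψ n u ⊛ ψ n (u + b * c)
  lemma : ∀ p b c s → (p + b) * c + s ≡ c * p + s + b * c
  lemma = ℕ-Solver.solve-∀
  F-periodic : Periodic n F
  F-periodic u = cong₂ _⊛_ (ψ-periodic n u) (trans (cong (ψ n) (swap u n (b * c))) (ψ-periodic n (u + b * c)))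
    where
    swap : ∀ u n x → u + n + x ≡ u + x + n
    swap = ℕ-Solver.solve-∀

-- The gain from a prime divisor of `d`.

private
  unique-multiple : ∀ {l} d c i j → Prime l → Coprime c d → i < j → j < l → l ∣ i * d + c → ¬ l ∣ j * d + c
  unique-multiple {l} d c i j l-prime c⊥d i<j j<l l∣i l∣j with euclidsLemma (j ∸ i) d l-prime difference
    where
    split : j * d + c ≡ i * d + c + (j ∸ i) * d
    split = trans (cong (λ z → z * d + c) (sym (m+[n∸m]≡n (<⇒≤ i<j)))) (lemma i (j ∸ i) d c)
      where
      lemma : ∀ i x d c → (i + x) * d + c ≡ i * d + c + x * d
      lemma = ℕ-Solver.solve-∀
    difference : l ∣ (j ∸ i) * d
    difference = ∣m+n∣m⇒∣n (subst (l ∣_) split l∣j) l∣i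
  ... | inj₁ l∣j-i = <⇒≱ (≤-<-trans (m∸n≤m j i) j<l) (∣⇒≤ {{>-nonZero (m<n⇒0<n∸m i<j)}} l∣j-i)
  ... | inj₂ l∣d   = prime≢1 l-prime (c⊥d (∣m+n∣m⇒∣n l∣i (∣n⇒∣m*n i l∣d) , l∣d))

-- For a prime l ∣ d, write c = j d′ + c₀ with d = l d′.  The autocorrelations over all j < l nearly
-- cancel, and at most one j makes c a non-unit.
∣∑χ-autocorrelation∣≤ : ∀ n d m k {l} h → n ≡ d * m → Coprime k d → Prime l → l ∣ d → 5 ≤ l → l ≡ 1 + 2 * h → .{{_ : NonZero n}} →
  10 * ∣ ∑ d (λ c → χ d c ⊛ autocorrelation n (k * m * c)) ∣ ≤ 3 * (∣ Φ d ∣ * n)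
∣∑χ-autocorrelation∣≤ n d m k {l} h n≡dm k⊥d l-prime (divides d′ d≡d′l) 5≤l l-odd = begin
  10 * ∣ 𝓗 ∣                                 ≡⟨ ℤₚ.∣i*j∣≡∣i∣*∣j∣ (+ 10) 𝓗 ⟨
  ∣ + 10 ⊛ 𝓗 ∣                               ≡⟨ cong ∣_∣ (trans (cong (+ 10 ⊛_) (classes F)) (sym (∑-*ˡ d′ (+ 10) I))) ⟩
  ∣ ∑ d′ (λ c → + 10 ⊛ I c) ∣                ≤⟨ +≤⇒≤∣∣ (ℤₚ.≤-trans (∣∑∣≤ d′ λ c _ → class c) (ℤₚ.≤-reflexive total)) ⟩
  ∣ + (3 * n) ⊛ Φ d ∣
    ≡⟨ trans (ℤₚ.∣i*j∣≡∣i∣*∣j∣ (+ (3 * n)) (Φ d)) (trans (*-assoc 3 n ∣ Φ d ∣) (cong (3 *_) (*-comm n ∣ Φ d ∣))) ⟩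
  3 * (∣ Φ d ∣ * n)                          ∎
  where
  open ≤-Reasoning
  N = d′ * m
  d≡ : d ≡ l * d′
  d≡ = trans d≡d′l (*-comm d′ l)
  n≡lN : n ≡ l * N
  n≡lN = trans n≡dm (trans (cong (_* m) d≡) (*-assoc l d′ m))
  N≢0 : NonZero N
  N≢0 = m*n≢0⇒n≢0 l {{subst NonZero n≡lN (≢-nonZero (≢-nonZero⁻¹ n))}}
  V : ℕ → ℤ
  V c = autocorrelation n (k * m * c)
  F : ℕ → ℤ
  F c = χ d c ⊛ V c
  𝓗 = ∑ d F
  I Q : ℕ → ℤ
  I c = ∑ l (λ j → F (j * d′ + c))
  Q c = ∑ l (λ j → χ d (j * d′ + c))
  classes : ∀ f → ∑ d f ≡ ∑ d′ (λ c → ∑ l (λ j → f (j * d′ + c)))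
  classes f = trans (cong (λ z → ∑ z f) d≡) (trans (∑-blocks l d′ f) (∑-swap l d′ _))
  total : ∑ d′ (λ c → + (3 * n) ⊛ Q c) ≡ + (3 * n) ⊛ Φ d
  total = trans (∑-*ˡ d′ (+ (3 * n)) Q) (cong (+ (3 * n) ⊛_) (sym (classes (χ d))))
  -- The shifts are `k * m * c + k * j * N`. As `k` is prime to `l`, the `k * j` may be replaced by
  -- `j`, which gives a full set of shifts.
  ∑V : ∀ c → ∣ ∑ l (λ j → V (j * d′ + c)) ∣ ≤ N
  ∑V c = ≤-trans (≤-reflexive (cong ∣_∣ (trans
      (∑-cong′ l λ j → trans (cong (autocorrelation n) (lemma k m j d′ c)) (cong (λ z → autocorrelation z (k * m * c + k * j * N)) n≡lN))
      (∑-perm k l k⊥l λ j → trans (cong (autocorrelation (l * N)) (shift (k * m * c) j l N)) (autocorrelation-periodic (l * N) (k * m * c + j * N) 1)))))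
    (∣∑-autocorrelation∣≤ h N (k * m * c) l-odd {{N≢0}})
    where
    lemma : ∀ k m j d′ c → k * m * (j * d′ + c) ≡ k * m * c + k * j * (d′ * m)
    lemma = ℕ-Solver.solve-∀
    shift : ∀ x j l N → x + (j + l) * N ≡ x + j * N + 1 * (l * N)
    shift = ℕ-Solver.solve-∀
    k⊥l : Coprime k l
    k⊥l = coprime-∣ ∣-refl (divides d′ d≡d′l) k⊥d
  finish : ∀ c w → Q c ≡ + w → 10 * ∣ I c ∣ ≤ 3 * n * w → + ∣ + 10 ⊛ I c ∣ ≤ᶻ + (3 * n) ⊛ Q c
  finish c w Q≡w le = ℤₚ.≤-trans (+≤+ (≤-trans (≤-reflexive (ℤₚ.∣i*j∣≡∣i∣*∣j∣ (+ 10) (I c))) le))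
    (ℤₚ.≤-reflexive (trans (ℤₚ.pos-* (3 * n) w) (cong (+ (3 * n) ⊛_) (sym Q≡w))))
  -- The trivial bound for `l - 1` autocorrelations is `l * N * (l - 1)`. Equality at `l = 5` is the
  -- origin of 3/10.
  excess : ∀ {l} → 5 ≤ l → ∀ N → 10 * (N + l * N) ≤ 3 * (l * N) * pred l
  excess {l} 5≤l N with m≤n⇒∃[o]m+o≡n 5≤l
  ... | i , refl = ≤-trans (m≤m+n _ ((17 * i + 3 * i * i) * N)) (≤-reflexive (lemma i N))
    where
    lemma : ∀ i N → 10 * (N + (5 + i) * N) + (17 * i + 3 * i * i) * N ≡ 3 * ((5 + i) * N) * (4 + i)
    lemma = ℕ-Solver.solve-∀
  class : ∀ c → + ∣ + 10 ⊛ I c ∣ ≤ᶻ + (3 * n) ⊛ Q c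
  class c with coprime? c d′
  ... | no ¬c⊥d′ = finish c 0
    (trans (∑-cong′ l λ j → vanish j) (∑-zero l))
    (≤-trans (≤-reflexive (cong (λ z → 10 * ∣ z ∣) (trans (∑-cong′ l λ j → trans (cong (_⊛ V (j * d′ + c)) (vanish j)) (ℤₚ.*-zeroˡ (V (j * d′ + c)))) (∑-zero l)))) z≤n)
    where
    vanish : ∀ j → χ d (j * d′ + c) ≡ + 0
    vanish j = χ-¬coprime d (j * d′ + c) λ cop → ¬c⊥d′ λ (r∣c , r∣d′) →
      cop (∣m∣n⇒∣m+n (∣n⇒∣m*n j r∣d′) r∣c , ∣-trans r∣d′ (divides l d≡))
  ... | yes c⊥d′ with anyUpTo? (λ j → l ∣? j * d′ + c) l
  -- This is the case when `l` also divides `d′`: all `l` terms are units.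
  ... | no none = finish c l
    (trans (∑-cong l λ j j<l → unit j (none′ j j<l)) (trans (∑-const l (+ 1)) (ℤₚ.*-identityʳ (+ l))))
    (≤-trans (*-monoʳ-≤ 10 (≤-trans (≤-reflexive (cong ∣_∣ (∑-cong l λ j j<l → trans (cong (_⊛ V (j * d′ + c)) (unit j (none′ j j<l))) (ℤₚ.*-identityˡ (V (j * d′ + c)))))) (∑V c)))
      (≤-trans (*-monoʳ-≤ 10 (m≤m+n N (l * N))) (≤-trans (excess 5≤l N) (≤-trans (≤-reflexive (cong (λ z → 3 * z * pred l) (sym n≡lN))) (*-monoʳ-≤ (3 * n) (pred[n]≤n {l}))))))
    where
    none′ : ∀ j → j < l → ¬ l ∣ j * d′ + c
    none′ j j<l l∣ = none (j , j<l , l∣)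
    unit : ∀ j → ¬ l ∣ j * d′ + c → χ d (j * d′ + c) ≡ + 1
    unit j l∤ = χ-coprime d (j * d′ + c) (subst (Coprime (j * d′ + c)) (sym d≡) (coprime-* (prime-∤⇒coprime l-prime l∤)
      λ (r∣x , r∣d′) → c⊥d′ (∣m+n∣m⇒∣n r∣x (∣n⇒∣m*n j r∣d′) , r∣d′)))
  -- Exactly one term is lost. The full sum is at most `N`, and the missing autocorrelation is at
  -- most `n = l * N`.
  ... | yes (i , i<l , l∣i) = finish c (pred l)
    (trans (∑-cong l (λ j j<l → χ≡1-δ j j<l)) (trans (∑-⊖ l (λ _ → + 1) (λ j → 𝟙 (j ≟ i)))
      (trans (cong₂ _⊖_ (trans (∑-const l (+ 1)) (ℤₚ.*-identityʳ (+ l))) (trans (∑-single l i<l λ j _ j≢i → 𝟙-no (j ≟ i) j≢i) (𝟙-yes (i ≟ i) refl)))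
        (trans (cong (λ z → + z ⊖ + 1) (sym (suc-pred l {{prime⇒nonZero l-prime}}))) (cancel (+ pred l))))))
    (≤-trans (*-monoʳ-≤ 10 (≤-trans (≤-reflexive (cong ∣_∣ (trans (∑-cong l λ j j<l → trans (cong (_⊛ V (j * d′ + c)) (χ≡1-δ j j<l)) (expand (V (j * d′ + c)) (𝟙 (j ≟ i))))
                (trans (∑-⊖ l _ _) (cong (λ z → ∑ l (λ j → V (j * d′ + c)) ⊖ z) (trans (∑-single l i<l λ j _ j≢i → trans (cong (_⊛ V (j * d′ + c)) (𝟙-no (j ≟ i) j≢i)) (ℤₚ.*-zeroˡ (V (j * d′ + c))))
                  (trans (cong (_⊛ V (i * d′ + c)) (𝟙-yes (i ≟ i) refl)) (ℤₚ.*-identityˡ (V (i * d′ + c))))))))))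
        (≤-trans (ℤₚ.∣i-j∣≤∣i∣+∣j∣ (∑ l (λ j → V (j * d′ + c))) (V (i * d′ + c)))
          (+-mono-≤ (∑V c) (≤-trans (∣autocorrelation∣≤ n (k * m * (i * d′ + c))) (≤-reflexive n≡lN))))))
      (≤-trans (excess 5≤l N) (≤-reflexive (cong (λ z → 3 * z * pred l) (sym n≡lN)))))
    where
    cancel : ∀ x → + 1 ⊕ x ⊖ + 1 ≡ x
    cancel = ℤ-Solver.solve-∀
    expand : ∀ v e → (+ 1 ⊖ e) ⊛ v ≡ v ⊖ e ⊛ v
    expand = ℤ-Solver.solve-∀
    χ≡1-δ : ∀ j → j < l → χ d (j * d′ + c) ≡ + 1 ⊖ 𝟙 (j ≟ i)
    χ≡1-δ j j<l with j ≟ i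
    ... | yes refl = trans (χ-¬coprime d (j * d′ + c) λ cop → prime≢1 l-prime (cop (l∣i , divides d′ d≡d′l))) (cong (+ 1 ⊖_) (sym (𝟙-yes (j ≟ j) refl)))
    ... | no j≢i = trans
        (χ-coprime d (j * d′ + c) (subst (Coprime (j * d′ + c)) (sym d≡) (coprime-* (prime-∤⇒coprime l-prime (l∤ (<-cmp j i)))
          λ (r∣x , r∣d′) → c⊥d′ (∣m+n∣m⇒∣n r∣x (∣n⇒∣m*n j r∣d′) , r∣d′))))
        (cong (+ 1 ⊖_) (sym (𝟙-no (j ≟ i) j≢i)))
      where
      l∤ : Tri (j < i) (j ≡ i) (i < j) → ¬ l ∣ j * d′ + c
      l∤ (tri< j<i _ _) l∣j = unique-multiple d′ c j i l-prime c⊥d′ j<i i<l l∣j l∣i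
      l∤ (tri≈ _ j≡i _) _   = j≢i j≡i
      l∤ (tri> _ _ i<j) l∣j = unique-multiple d′ c i j l-prime c⊥d′ i<j j<l l∣i l∣j

-- Oddness of the wave and symmetries of sums over units.

≡0%⇒≡ : ∀ x k n .{{_ : NonZero n}} → 0 < x → x < n + n → x ≡ k * n → x ≡ n
≡0%⇒≡ x zero          n 0<x x<2n x≡0 = contradiction x≡0 (>⇒≢ 0<x)
≡0%⇒≡ x (suc zero)    n 0<x x<2n x≡n = trans x≡n (+-identityʳ n)
≡0%⇒≡ x (suc (suc k)) n 0<x x<2n x≡  = contradiction x<2n (≤⇒≯ (≤-trans (+-monoʳ-≤ n (m≤m+n n (k * n))) (≤-reflexive (sym x≡))))

-- The remainders add up to a multiple of `n` strictly between `0` and `2 * n`. The single `n` they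
-- take from the quotients is what changes the sign in `ψ-neg`.
/-complement : ∀ A B k n .{{_ : NonZero n}} → ¬ n ∣ A → A + B ≡ k * n → suc (A / n + B / n) ≡ k
/-complement A B k n n∤A A+B≡ = *-cancelʳ-≡ (suc (A / n + B / n)) k n (begin
  n + (A / n + B / n) * n                       ≡⟨ cong (_+ (A / n + B / n) * n) (sym remainders) ⟩
  A % n + B % n + (A / n + B / n) * n           ≡⟨ sym split ⟩
  A + B                                         ≡⟨ A+B≡ ⟩
  k * n                                         ∎)
  where
  open ≡-Reasoning
  interchange : ∀ a b x y n → a + x * n + (b + y * n) ≡ a + b + (x + y) * n
  interchange = ℕ-Solver.solve-∀
  split : A + B ≡ A % n + B % n + (A / n + B / n) * n
  split = trans (cong₂ _+_ (m≡m%n+[m/n]*n A n) (m≡m%n+[m/n]*n B n)) (interchange (A % n) (B % n) (A / n) (B / n) n)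
  n∣remainders : n ∣ A % n + B % n
  n∣remainders = ∣m+n∣n⇒∣m (subst (n ∣_) (trans (sym A+B≡) split) (n∣m*n k)) (n∣m*n (A / n + B / n))
  0<A%n : 0 < A % n
  0<A%n = n≢0⇒n>0 (λ A%n≡0 → n∤A (m%n≡0⇒n∣m A n A%n≡0))
  remainders : A % n + B % n ≡ n
  remainders = ≡0%⇒≡ (A % n + B % n) (quotient n∣remainders) n (≤-trans 0<A%n (m≤m+n (A % n) (B % n)))
    (+-mono-< (m%n<n A n) (m%n<n B n)) (_∣_.equality n∣remainders)

sgn-neg : ∀ a b k → suc (a + b) ≡ 2 * k → sgn b ≡ ⊝ sgn a
sgn-neg a b k a+b = begin
  sgn b                              ≡⟨ ℤₚ.*-identityˡ (sgn b) ⟨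
  + 1 ⊛ sgn b                        ≡⟨ cong (_⊛ sgn b) (sgn-square a) ⟨
  sgn a ⊛ sgn a ⊛ sgn b              ≡⟨ lemma (sgn a) (sgn b) ⟩
  ⊝ (sgn a ⊛ ⊝ (sgn a ⊛ sgn b))      ≡⟨ cong (λ z → ⊝ (sgn a ⊛ ⊝ z)) (sgn-+ a b) ⟨
  ⊝ (sgn a ⊛ sgn (suc (a + b)))      ≡⟨ cong (λ z → ⊝ (sgn a ⊛ sgn z)) a+b ⟩
  ⊝ (sgn a ⊛ sgn (2 * k))            ≡⟨ cong (λ z → ⊝ (sgn a ⊛ z)) (sgn-2* k) ⟩
  ⊝ (sgn a ⊛ + 1)                    ≡⟨ cong ⊝_ (ℤₚ.*-identityʳ (sgn a)) ⟩
  ⊝ sgn a                            ∎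
  where
  open ≡-Reasoning
  lemma : ∀ x y → x ⊛ x ⊛ y ≡ ⊝ (x ⊛ ⊝ (x ⊛ y))
  lemma = ℤ-Solver.solve-∀

ψ-neg : ∀ n z z′ k .{{_ : NonZero n}} → ¬ n ∣ 2 * z → z + z′ ≡ k * n → ψ n z′ ≡ ⊝ ψ n z
ψ-neg n z z′ k n∤2z z+z′ = trans (ψ-/ n z′) (trans
  (sgn-neg (2 * z / n) (2 * z′ / n) k (/-complement (2 * z) (2 * z′) (2 * k) n n∤2z
    (trans (sym (*-distribˡ-+ 2 z z′)) (trans (cong (2 *_) z+z′) (sym (*-assoc 2 k n))))))
  (cong ⊝_ (sym (ψ-/ n z))))

below-half : ℕ → ℕ → ℤ
below-half n r = 𝟙 (2 * r ≤? n)

module Units (n : ℕ) .{{_ : NonZero n}} (1<n : 1 < n) (2⊥n : Coprime 2 n) where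

  unit-∤ : ∀ {z} → Coprime z n → ¬ n ∣ 2 * z
  unit-∤ z⊥n n∣2z = >⇒≢ 1<n (z⊥n (Coprimality.coprime-divisor (Coprimality.sym 2⊥n) n∣2z , ∣-refl))

  unit-* : ∀ {x y} → Coprime x n → Coprime y n → Coprime (x * y) n
  unit-* x⊥n y⊥n = Coprimality.sym (coprime-* (Coprimality.sym x⊥n) (Coprimality.sym y⊥n))

  ψ-unit-neg : ∀ {z} z′ k → Coprime z n → z + z′ ≡ k * n → ψ n z′ ≡ ⊝ ψ n z
  ψ-unit-neg {z} z′ k z⊥n = ψ-neg n z z′ k (unit-∤ z⊥n)

  ψ-% : ∀ x y → x % n ≡ y % n → ψ n x ≡ ψ n y
  ψ-% x y eq = trans (periodic-% (ψ-periodic n) x) (trans (cong (ψ n) eq) (sym (periodic-% (ψ-periodic n) y)))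

  *-congˡ-% : ∀ {x y} g → x % n ≡ y % n → (x * g) % n ≡ (y * g) % n
  *-congˡ-% {x} {y} g eq = trans (%-distribˡ-* x g n) (trans (cong (λ z → (z * (g % n)) % n) eq) (sym (%-distribˡ-* y g n)))

  ∑χ-cong : ∀ {f h : ℕ → ℤ} → (∀ g → Coprime g n → f g ≡ h g) → ∑ n (λ g → χ n g ⊛ f g) ≡ ∑ n (λ g → χ n g ⊛ h g)
  ∑χ-cong {f} {h} eq = ∑-cong′ n term
    where
    term : ∀ g → χ n g ⊛ f g ≡ χ n g ⊛ h g
    term g with coprime? g n
    ... | yes g⊥n = cong (χ n g ⊛_) (eq g g⊥n)
    ... | no ¬g⊥n = trans (cong (_⊛ f g) (χ-¬coprime n g ¬g⊥n)) (trans (ℤₚ.*-zeroˡ (f g))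
                      (sym (trans (cong (_⊛ h g) (χ-¬coprime n g ¬g⊥n)) (ℤₚ.*-zeroˡ (h g)))))

  ∑χ-perm : ∀ u {f : ℕ → ℤ} → Coprime u n → Periodic n f → ∑ n (λ g → χ n g ⊛ f (u * g)) ≡ ∑ n (λ g → χ n g ⊛ f g)
  ∑χ-perm u {f} u⊥n per = trans (∑-cong′ n λ g → cong (_⊛ f (u * g)) (χ-cong n g n (u * g) (unit-* u⊥n) (coprime-∣ (n∣m*n u) ∣-refl)))
    (∑-perm u n u⊥n λ g → cong₂ _⊛_ (χ-periodic n g) (per g))

  ψ-*-periodic : ∀ x → Periodic n (λ g → ψ n (x * g))
  ψ-*-periodic x g = trans (cong (ψ n) (*-distribˡ-+ x g n)) (ψ-+* n (x * g) x)

  correlation-% : ∀ x x′ y y′ → x % n ≡ x′ % n → y % n ≡ y′ % n → correlation n x y ≡ correlation n x′ y′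
  correlation-% x x′ y y′ x≡ y≡ = ∑-cong′ n λ g → cong (χ n g ⊛_)
    (cong₂ _⊛_ (ψ-% (x * g) (x′ * g) (*-congˡ-% g x≡)) (ψ-% (y * g) (y′ * g) (*-congˡ-% g y≡)))

  correlation-comm : ∀ x y → correlation n x y ≡ correlation n y x
  correlation-comm x y = ∑-cong′ n λ g → cong (χ n g ⊛_) (ℤₚ.*-comm (ψ n (x * g)) (ψ n (y * g)))

  correlation-* : ∀ u x y → Coprime u n → correlation n (x * u) (y * u) ≡ correlation n x y
  correlation-* u x y u⊥n = trans
    (∑-cong′ n λ g → cong (χ n g ⊛_) (cong₂ _⊛_ (cong (ψ n) (*-assoc x u g)) (cong (ψ n) (*-assoc y u g))))
    (∑χ-perm u u⊥n λ g → cong₂ _⊛_ (ψ-*-periodic x g) (ψ-*-periodic y g))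

  correlation-neg : ∀ x y y′ → Coprime y n → n ∣ y + y′ → correlation n x y′ ≡ ⊝ correlation n x y
  correlation-neg x y y′ y⊥n (divides k y+y′) = trans
    (trans (∑χ-cong λ g g⊥n → cong (ψ n (x * g) ⊛_) (ψ-unit-neg (y′ * g) (k * g) (unit-* y⊥n g⊥n) (complement g)))
           (∑-cong′ n λ g → lemma (χ n g) (ψ n (x * g)) (ψ n (y * g))))
    (∑-neg n (λ g → χ n g ⊛ (ψ n (x * g) ⊛ ψ n (y * g))))
    where
    lemma : ∀ c u v → c ⊛ (u ⊛ ⊝ v) ≡ ⊝ (c ⊛ (u ⊛ v))
    lemma = ℤ-Solver.solve-∀
    swap : ∀ k n g → k * n * g ≡ k * g * n
    swap = ℕ-Solver.solve-∀
    complement : ∀ g → y * g + y′ * g ≡ k * g * n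
    complement g = trans (sym (*-distribʳ-+ g y y′)) (trans (cong (_* g) y+y′) (swap k n g))

  -- Multiplication by `pred n`, that is by -1, permutes the units, so the sum equals its own
  -- negative.
  odd-sum-vanishes : ∀ {f : ℕ → ℤ} → Periodic n f → (∀ g → Coprime g n → f (pred n * g) ≡ ⊝ f g) → ∑ n (λ g → χ n g ⊛ f g) ≡ + 0
  odd-sum-vanishes {f} per odd = x≡-x⇒x≡0 (trans (sym (∑χ-perm (pred n) n-1⊥n per)) (trans (∑χ-cong odd)
    (trans (∑-cong′ n λ g → lemma (χ n g) (f g)) (∑-neg n (λ g → χ n g ⊛ f g)))))
    where
    lemma : ∀ c x → c ⊛ ⊝ x ≡ ⊝ (c ⊛ x)
    lemma = ℤ-Solver.solve-∀
    x≡-x⇒x≡0 : ∀ {x} → x ≡ ⊝ x → x ≡ + 0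
    x≡-x⇒x≡0 {+ zero} _ = refl
    x≡-x⇒x≡0 {+ suc _} ()
    x≡-x⇒x≡0 { -[1+ _ ] } ()
    n-1⊥n : Coprime (pred n) n
    n-1⊥n {r} (r∣n-1 , r∣n) = ∣1⇒≡1 (∣m+n∣n⇒∣m (subst (r ∣_) (sym (suc-pred n)) r∣n) r∣n-1)

  odd-term : ∀ {x} → Coprime x n → ∀ g → Coprime g n → ψ n (x * (pred n * g)) ≡ ⊝ ψ n (x * g)
  odd-term {x} x⊥n g g⊥n = ψ-unit-neg (x * (pred n * g)) (x * g) (unit-* x⊥n g⊥n)
    (trans (lemma x g (pred n)) (cong (x * g *_) (suc-pred n)))
    where
    lemma : ∀ x g n → x * g + x * (n * g) ≡ x * g * suc n
    lemma = ℕ-Solver.solve-∀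

  below-half-ψ : ∀ z → + 2 ⊛ below-half n (z % n) ≡ + 1 ⊕ ψ n z
  below-half-ψ z = trans (split (2 * r ≤? n)) (cong (+ 1 ⊕_) (sym (trans (periodic-% (ψ-periodic n) z) (ψ-/ n r))))
    where
    r = z % n
    split : (d : Dec (2 * r ≤ n)) → + 2 ⊛ 𝟙 d ≡ + 1 ⊕ sgn (2 * r / n)
    split (yes 2r≤n) = cong (λ z → + 1 ⊕ sgn z) (sym (m<n⇒m/n≡0 (≤∧≢⇒< 2r≤n 2r≢n)))
      where
      -- Since `n` is odd, the closed endpoint 1/2 is never attained; only there would the indicator
      -- and the wave disagree.
      2r≢n : 2 * r ≢ n
      2r≢n 2r≡n = contradiction (2⊥n (∣-refl , subst (2 ∣_) 2r≡n (m∣m*n r))) λ ()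
    split (no 2r≰n) = cong (λ z → + 1 ⊕ sgn z) (sym (≤-antisym
      (≤-pred (m<n*o⇒m/o<n {2 * r} {2} {n} (*-monoʳ-< 2 (m%n<n z n))))
      (m≥n⇒m/n>0 (<⇒≤ (≰⇒> 2r≰n)))))

  count-formula : ∀ a b → Coprime a n → Coprime b n →
    + 8 ⊛ ∑ n (λ g → χ n g ⊛ (below-half n (g % n) ⊛ (below-half n ((a * g) % n) ⊛ below-half n ((b * g) % n))))
      ≡ Φ n ⊕ correlation n 1 a ⊕ correlation n 1 b ⊕ correlation n a b
  count-formula a b a⊥n b⊥n = begin
    + 8 ⊛ ∑ n (λ g → χ n g ⊛ (h g ⊛ (h (a * g) ⊛ h (b * g))))
      ≡⟨ ∑-*ˡ n (+ 8) _ ⟨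
    ∑ n (λ g → + 8 ⊛ (χ n g ⊛ (h g ⊛ (h (a * g) ⊛ h (b * g)))))
      ≡⟨ ∑-cong′ n (λ g → trans (double (χ n g) (h g) (h (a * g)) (h (b * g)))
           (trans (cong (χ n g ⊛_) (cong₂ _⊛_ (trans (below-half-ψ g) (cong (λ z → + 1 ⊕ ψ n z) (sym (*-identityˡ g)))) (cong₂ _⊛_ (below-half-ψ (a * g)) (below-half-ψ (b * g)))))
             (expand (χ n g) (ψ n (1 * g)) (ψ n (a * g)) (ψ n (b * g))))) ⟩
    ∑ n (λ g → even g ⊕ χ n g ⊛ odd g)
      ≡⟨ ∑-+ n even (λ g → χ n g ⊛ odd g) ⟩
    ∑ n even ⊕ ∑ n (λ g → χ n g ⊛ odd g)
      ≡⟨ cong₂ _⊕_ (trans (∑-+ n _ _) (cong (_⊕ correlation n a b) (trans (∑-+ n _ _) (cong (_⊕ correlation n 1 b) (∑-+ n _ _)))))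
                   (odd-sum-vanishes odd-periodic odd-odd) ⟩
    Φ n ⊕ correlation n 1 a ⊕ correlation n 1 b ⊕ correlation n a b ⊕ + 0
      ≡⟨ ℤₚ.+-identityʳ _ ⟩
    Φ n ⊕ correlation n 1 a ⊕ correlation n 1 b ⊕ correlation n a b ∎
    where
    open ≡-Reasoning
    h : ℕ → ℤ
    h z = below-half n (z % n)
    cubic : ℤ → ℤ → ℤ → ℤ
    cubic x y z = x ⊕ y ⊕ z ⊕ x ⊛ (y ⊛ z)
    cong-cubic : ∀ {x x′ y y′ z z′} → x ≡ x′ → y ≡ y′ → z ≡ z′ → cubic x y z ≡ cubic x′ y′ z′
    cong-cubic refl refl refl = refl
    odd even : ℕ → ℤ
    odd g = cubic (ψ n (1 * g)) (ψ n (a * g)) (ψ n (b * g))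
    even g = χ n g ⊕ χ n g ⊛ (ψ n (1 * g) ⊛ ψ n (a * g)) ⊕ χ n g ⊛ (ψ n (1 * g) ⊛ ψ n (b * g)) ⊕ χ n g ⊛ (ψ n (a * g) ⊛ ψ n (b * g))
    double : ∀ c x y z → + 8 ⊛ (c ⊛ (x ⊛ (y ⊛ z))) ≡ c ⊛ (+ 2 ⊛ x ⊛ (+ 2 ⊛ y ⊛ (+ 2 ⊛ z)))
    double = ℤ-Solver.solve-∀
    expand : ∀ c x y z → c ⊛ ((+ 1 ⊕ x) ⊛ ((+ 1 ⊕ y) ⊛ (+ 1 ⊕ z))) ≡
      c ⊕ c ⊛ (x ⊛ y) ⊕ c ⊛ (x ⊛ z) ⊕ c ⊛ (y ⊛ z) ⊕ c ⊛ (x ⊕ y ⊕ z ⊕ x ⊛ (y ⊛ z))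
    expand = ℤ-Solver.solve-∀
    odd-periodic : Periodic n odd
    odd-periodic g = cong-cubic (ψ-*-periodic 1 g) (ψ-*-periodic a g) (ψ-*-periodic b g)
    odd-odd : ∀ g → Coprime g n → odd (pred n * g) ≡ ⊝ odd g
    odd-odd g g⊥n = trans
      (cong-cubic (odd-term (Coprimality.1-coprimeTo n) g g⊥n) (odd-term a⊥n g g⊥n) (odd-term b⊥n g g⊥n))
      (negate (ψ n (1 * g)) (ψ n (a * g)) (ψ n (b * g)))
      where
      negate : ∀ x y z → ⊝ x ⊕ ⊝ y ⊕ ⊝ z ⊕ ⊝ x ⊛ (⊝ y ⊛ ⊝ z) ≡ ⊝ (x ⊕ y ⊕ z ⊕ x ⊛ (y ⊛ z))
      negate = ℤ-Solver.solve-∀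

-- Thue's lemma and modular inverses.

even⊎odd : ∀ p → ∃[ h ] p ≡ 2 * h ⊎ ∃[ h ] p ≡ 1 + 2 * h
even⊎odd zero    = inj₁ (0 , refl)
even⊎odd (suc p) with even⊎odd p
... | inj₁ (h , refl) = inj₂ (h , refl)
... | inj₂ (h , refl) = inj₁ (suc h , sym (*-suc 2 h))

gcd-split : ∀ x y → .{{_ : NonZero y}} →
  ∃[ g ] ∃[ x′ ] ∃[ y′ ] (x ≡ x′ * g × y ≡ y′ * g × Coprime x′ y′ × NonZero g)
gcd-split x y with gcd[m,n]∣m x y | gcd[m,n]∣n x y
... | divides x′ x≡ | divides y′ y≡ = gcd x y , x′ , y′ , x≡ , y≡ , cop , g≢0
  where
  g≢0 : NonZero (gcd x y)
  g≢0 = m*n≢0⇒n≢0 y′ {{subst NonZero y≡ (≢-nonZero (≢-nonZero⁻¹ y))}}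
  cop : Coprime x′ y′
  cop {r} (divides u x′≡ , divides v y′≡) = ∣1⇒≡1 (*-cancelʳ-∣ (gcd x y) {{g≢0}}
    (subst (r * gcd x y ∣_) (sym (*-identityˡ (gcd x y))) (gcd-greatest
      (divides u (trans x≡ (trans (cong (_* gcd x y) x′≡) (*-assoc u r (gcd x y)))))
      (divides v (trans y≡ (trans (cong (_* gcd x y) y′≡) (*-assoc v r (gcd x y))))))))

primeDivisor : ∀ d .{{_ : NonZero d}} → d ≢ 1 → ∃[ l ] (Prime l × l ∣ d)
primeDivisor d d≢1 with factorise d
... | record { factors = [] ; isFactorisation = d≡1 } = contradiction d≡1 d≢1
... | record { factors = l ∷ ls ; isFactorisation = d≡ ; factorsPrime = l-prime ∷ _ } =
  l , l-prime , subst (l ∣_) (sym d≡) (m∣m*n (product ls))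

%≡⇒∣+ : ∀ {n x y z} .{{_ : NonZero n}} → n ∣ x + y → y % n ≡ z % n → n ∣ x + z
%≡⇒∣+ {n} {x} {y} {z} n∣x+y y≡z = m%n≡0⇒n∣m (x + z) n (begin
  (x + z) % n           ≡⟨ %-distribˡ-+ x z n ⟩
  (x % n + z % n) % n   ≡⟨ cong (λ w → (x % n + w) % n) y≡z ⟨
  (x % n + y % n) % n   ≡⟨ %-distribˡ-+ x y n ⟨
  (x + y) % n           ≡⟨ n∣m⇒m%n≡0 (x + y) n n∣x+y ⟩
  0                     ∎)
  where open ≡-Reasoning

+∣⇒%≡ : ∀ {n j} x .{{_ : NonZero n}} → n ∣ j → (x + j) % n ≡ x % n
+∣⇒%≡ {n} x (divides k refl) = [m+kn]%n≡m%n x k n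

-- Pigeonhole for the residues of `x * a + y` with `x` and `y` at most `s`. In a collision the order
-- of the two `y` decides the sign. Equal `x` would force equal `y` because `s < n`, and equal `y`
-- would make `n` divide `q * a`; hence `p` and `q` are positive.
thue : ∀ n s a .{{_ : NonZero n}} → n < suc s * suc s → s < n → Coprime a n →
  ∃[ p ] ∃[ q ] (0 < p × p ≤ s × 0 < q × q ≤ s × ((q * a) % n ≡ p % n ⊎ n ∣ q * a + p))
thue n s a n<S² s<n a⊥n = search (pigeonhole n<S² f)
  where
  S = suc s
  X Y : Fin (S * S) → ℕ
  X i = toℕ i / S
  Y i = toℕ i % S
  f : Fin (S * S) → Fin n
  f i = fromℕ< (m%n<n (X i * a + Y i) n)
  X≤s : ∀ i → X i ≤ s
  X≤s i = ≤-pred (m<n*o⇒m/o<n (toℕ<n i))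
  Y≤s : ∀ i → Y i ≤ s
  Y≤s i = ≤-pred (m%n<n (toℕ i) S)
  small-multiple : ∀ q → 0 < q → q ≤ s → ¬ n ∣ q * a
  small-multiple q 0<q q≤s n∣qa = <⇒≱ (≤-<-trans q≤s s<n)
    (∣⇒≤ {{>-nonZero 0<q}} (Coprimality.coprime-divisor (Coprimality.sym a⊥n) (subst (n ∣_) (*-comm q a) n∣qa)))
  same : ∀ i j → f i ≡ f j → (X i * a + Y i) % n ≡ (X j * a + Y j) % n
  same i j eq = trans (sym (toℕ-fromℕ< (m%n<n (X i * a + Y i) n))) (trans (cong toℕ eq) (toℕ-fromℕ< (m%n<n (X j * a + Y j) n)))
  cancel-% : ∀ x y z → (x + y) % n ≡ (x + z) % n → y % n ≡ z % n
  cancel-% x y z eq = begin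
    y % n                                ≡⟨ +∣⇒%≡ y (divides x refl) ⟨
    (y + x * n) % n                      ≡⟨ cong (_% n) (shuffle y) ⟩
    (x * pred n + (x + y)) % n           ≡⟨ %-distribˡ-+ (x * pred n) (x + y) n ⟩
    (x * pred n % n + (x + y) % n) % n   ≡⟨ cong (λ w → (x * pred n % n + w) % n) eq ⟩
    (x * pred n % n + (x + z) % n) % n   ≡⟨ %-distribˡ-+ (x * pred n) (x + z) n ⟨
    (x * pred n + (x + z)) % n           ≡⟨ cong (_% n) (shuffle z) ⟨
    (z + x * n) % n                      ≡⟨ +∣⇒%≡ z (divides x refl) ⟩
    z % n                                ∎
    where
    open ≡-Reasoning
    lemma : ∀ w x m → w + x * suc m ≡ x * m + (x + w)
    lemma = ℕ-Solver.solve-∀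
    shuffle : ∀ w → w + x * n ≡ x * pred n + (x + w)
    shuffle w = trans (cong (λ z → w + x * z) (sym (suc-pred n))) (lemma w x (pred n))
  collision : ∀ x₁ y₁ x₂ y₂ → x₁ < x₂ → x₂ ≤ s → y₁ ≤ s → y₂ ≤ s → (x₁ * a + y₁) % n ≡ (x₂ * a + y₂) % n →
    ∃[ p ] ∃[ q ] (0 < p × p ≤ s × 0 < q × q ≤ s × ((q * a) % n ≡ p % n ⊎ n ∣ q * a + p))
  collision x₁ y₁ x₂ y₂ x₁<x₂ x₂≤s y₁≤s y₂≤s eq = decide (<-cmp y₁ y₂)
    where
    q = x₂ ∸ x₁
    0<q : 0 < q
    0<q = m<n⇒0<n∸m x₁<x₂
    q≤s : q ≤ s
    q≤s = ≤-trans (m∸n≤m x₂ x₁) x₂≤s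
    difference : y₁ % n ≡ (q * a + y₂) % n
    difference = cancel-% (x₁ * a) y₁ (q * a + y₂) (trans eq (cong (_% n)
      (trans (cong (λ z → z * a + y₂) (sym (m+[n∸m]≡n (<⇒≤ x₁<x₂)))) (lemma x₁ q a y₂))))
      where
      lemma : ∀ x q a y → (x + q) * a + y ≡ x * a + (q * a + y)
      lemma = ℕ-Solver.solve-∀
    decide : Tri (y₁ < y₂) (y₁ ≡ y₂) (y₂ < y₁) → _
    decide (tri< y₁<y₂ _ _) = y₂ ∸ y₁ , q , m<n⇒0<n∸m y₁<y₂ , ≤-trans (m∸n≤m y₂ y₁) y₂≤s , 0<q , q≤s ,
      inj₂ (m%n≡0⇒n∣m _ n (sym (trans (sym (0%n n)) (cancel-% y₁ 0 (q * a + (y₂ ∸ y₁))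
        (trans (cong (_% n) (+-identityʳ y₁)) (trans difference (cong (_% n) (trans (cong (λ z → q * a + z) (sym (m+[n∸m]≡n (<⇒≤ y₁<y₂)))) (lemma (q * a) y₁ (y₂ ∸ y₁))))))))))
      where
      0%n : ∀ n .{{_ : NonZero n}} → 0 % n ≡ 0
      0%n n = n∣m⇒m%n≡0 0 n (n ∣0)
      lemma : ∀ x y z → x + (y + z) ≡ y + (x + z)
      lemma = ℕ-Solver.solve-∀
    decide (tri≈ _ refl _) = contradiction
      (m%n≡0⇒n∣m (q * a) n (sym (trans (sym (n∣m⇒m%n≡0 0 n (n ∣0))) (cancel-% y₁ 0 (q * a)
        (trans (cong (_% n) (+-identityʳ y₁)) (trans difference (cong (_% n) (+-comm (q * a) y₁))))))))
      (small-multiple q 0<q q≤s)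
    decide (tri> _ _ y₂<y₁) = y₁ ∸ y₂ , q , m<n⇒0<n∸m y₂<y₁ , ≤-trans (m∸n≤m y₁ y₂) y₁≤s , 0<q , q≤s ,
      inj₁ (sym (cancel-% y₂ (y₁ ∸ y₂) (q * a) (trans (cong (_% n) (m+[n∸m]≡n (<⇒≤ y₂<y₁))) (trans difference (cong (_% n) (+-comm (q * a) y₂))))))
  search : ∃[ i ] ∃[ j ] (i Fin.< j × f i ≡ f j) → _
  search (i , j , i<j , eq) with <-cmp (X i) (X j)
  ... | tri< Xi<Xj _ _ = collision (X i) (Y i) (X j) (Y j) Xi<Xj (X≤s j) (Y≤s i) (Y≤s j) (same i j eq)
  ... | tri> _ _ Xj<Xi = collision (X j) (Y j) (X i) (Y i) Xj<Xi (X≤s i) (Y≤s j) (Y≤s i) (sym (same i j eq))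
  ... | tri≈ _ Xi≡Xj _ = contradiction (begin
      toℕ i            ≡⟨ m≡m%n+[m/n]*n (toℕ i) S ⟩
      Y i + X i * S    ≡⟨ cong₂ (λ y x → y + x * S) Yi≡Yj Xi≡Xj ⟩
      Y j + X j * S    ≡⟨ m≡m%n+[m/n]*n (toℕ j) S ⟨
      toℕ j            ∎) (<⇒≢ i<j)
    where
    open ≡-Reasoning
    Yi≡Yj : Y i ≡ Y j
    Yi≡Yj = begin
      Y i      ≡⟨ m<n⇒m%n≡m (≤-<-trans (Y≤s i) s<n) ⟨
      Y i % n  ≡⟨ cancel-% (X i * a) (Y i) (Y j) (trans (same i j eq) (cong (λ x → (x * a + Y j) % n) (sym Xi≡Xj))) ⟩
      Y j % n  ≡⟨ m<n⇒m%n≡m (≤-<-trans (Y≤s j) s<n) ⟩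
      Y j      ∎

-- A representative of size at least `s` ensures that equations such as `p * a′ ≡ q + j` with
-- `q ≤ s` are solved by a natural number `j`.
inverse-≥ : ∀ {n} a s .{{_ : NonZero n}} → Coprime a n → ∃[ a′ ] (s ≤ a′ × 0 < a′ × (a * a′) % n ≡ 1 % n)
inverse-≥ {n} a s a⊥n with inverse a⊥n
... | q , aq≡1 = q + suc s * n
  , ≤-trans (n≤1+n s) 1+s≤
  , ≤-trans (s≤s z≤n) 1+s≤
  , trans (cong (_% n) (lemma a q (suc s) n)) (trans (+∣⇒%≡ (a * q) (n∣m*n (a * suc s))) aq≡1)
  where
  1+s≤ : suc s ≤ q + suc s * n
  1+s≤ = ≤-trans (m≤m*n (suc s) n) (m≤n+m (suc s * n) q)
  lemma : ∀ a q s n → a * (q + s * n) ≡ a * q + a * s * n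
  lemma = ℕ-Solver.solve-∀

inverse-coprime : ∀ {n a a′} .{{_ : NonZero n}} → 1 < n → (a * a′) % n ≡ 1 % n → Coprime a′ n
inverse-coprime {n} {a} {a′} 1<n aa′≡1 {r} (r∣a′ , r∣n) = ∣1⇒≡1 (subst (r ∣_) (m<n⇒m%n≡m 1<n)
  (subst (r ∣_) aa′≡1 (%-presˡ-∣ (∣n⇒∣m*n a r∣a′) r∣n)))

-- The bound for the correlation of `1` and `a`.

module CorrelationBound
  (n s : ℕ) (ls : List ℕ) .{{_ : NonZero n}} (n≡ : n ≡ product ls) (ls-prime : All Prime ls)
  (1<n : 1 < n) (2⊥n : Coprime 2 n) (3⊥n : Coprime 3 n) (s<n : s < n) (n<S² : n < suc s * suc s)
  where

  open Units n 1<n 2⊥n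

  -- The `10` is `2 + 4 + 4`: in `estimate`, `2 * d` comes from `Φ-estimate` and the boundary term
  -- of the summation by parts, `4 * (d * p)` and `4 * (d * q)` from the sign changes, and each
  -- product is at most `s`.
  E Err : ℕ
  E = sieveError ls
  Err = 10 * (s * suc E)

  sieved : ∀ e → SieveBound n e (density e ls) E
  sieved e = subst (λ z → SieveBound z e (density e ls) E) (sym n≡) (sieve e ls ls-prime)

  -- The error is subtracted once, truncated at `0`, so that the case distinctions below deal with
  -- main terms only.
  excess : ℕ → ℕ
  excess a = ∣ correlation n 1 a ∣ ∸ Err

  Strong Weak : ℕ → Set
  Strong a = 10 * excess a ≤ 3 * ∣ Φ n ∣
  Weak a = 3 * excess a ≤ ∣ Φ n ∣

  ThreeRelated : ℕ → Set
  ThreeRelated a = a % n ≡ 3 % n ⊎ (3 * a) % n ≡ 1 % n ⊎ (n ∣ a + 3) ⊎ (n ∣ 3 * a + 1)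

  prime-divisor-odd : ∀ {l} → Prime l → l ∣ n → ∃[ h ] l ≡ 1 + 2 * h
  prime-divisor-odd {l} l-prime l∣n with even⊎odd l
  ... | inj₂ odd = odd
  ... | inj₁ (h , refl) = contradiction (2⊥n (∣-refl , ∣-trans (m∣m*n h) l∣n)) λ ()

  prime-divisor-large : ∀ {l} → Prime l → l ∣ n → FiveOrMore l
  prime-divisor-large {0} l-prime l∣n = contradiction l-prime ¬prime[0]
  prime-divisor-large {1} l-prime l∣n = contradiction l-prime ¬prime[1]
  prime-divisor-large {2} l-prime l∣n = contradiction (2⊥n (∣-refl , l∣n)) λ ()
  prime-divisor-large {3} l-prime l∣n = contradiction (3⊥n (∣-refl , l∣n)) λ ()
  prime-divisor-large {4} l-prime l∣n = contradiction (2⊥n (∣-refl , ∣-trans (divides 2 refl) l∣n)) λ ()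
  prime-divisor-large {5} l-prime l∣n = inj₁ refl
  prime-divisor-large {6} l-prime l∣n = contradiction (2⊥n (∣-refl , ∣-trans (divides 3 refl) l∣n)) λ ()
  prime-divisor-large {suc (suc (suc (suc (suc (suc (suc l))))))} l-prime l∣n = inj₂ (m≤m+n 7 l)

  prime-divisor-≥5 : ∀ {l} → Prime l → l ∣ n → 5 ≤ l
  prime-divisor-≥5 l-prime l∣n with prime-divisor-large l-prime l∣n
  ... | inj₁ refl = ≤-refl
  ... | inj₂ 7≤l  = ≤-trans (m≤m+n 5 2) 7≤l

  estimate : ∀ {d m p q k a} α → NonZero p → n ≡ d * m → q * a ≡ p + k * m → Coprime p q → d * p ≤ s → d * q ≤ s → α ≤ 10 →
    10 * ∣ ∑ d (λ c → χ d c ⊛ cross n p q a c) ∣ ≤ α * (∣ Φ d ∣ * n) → 10 * p * excess a ≤ α * ∣ Φ n ∣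
  estimate {d} {m} {p} {q} {k} {a} α p≢0 n≡dm qa≡ p⊥q dp≤s dq≤s α≤10 small = begin
    10 * p * excess a                  ≡⟨ *-distribˡ-∸ (10 * p) ∣ correlation n 1 a ∣ Err ⟩
    10 * p * ∣ correlation n 1 a ∣ ∸ 10 * p * Err
      ≤⟨ m≤n+o⇒m∸n≤o (10 * p * ∣ correlation n 1 a ∣) (10 * p * Err) total ⟩
    α * ∣ Φ n ∣                        ∎
    where
    open ≤-Reasoning
    instance _ = p≢0
    w = d * (suc E * (1 + 4 * (p + q)))
    d≤dp : d ≤ d * p
    d≤dp = m≤m*n d p
    error : α * (d * E) + 10 * p * w ≤ 10 * p * Err
    error = begin
      α * (d * E) + 10 * p * w                     ≤⟨ +-monoˡ-≤ (10 * p * w) (*-mono-≤ (≤-trans α≤10 (m≤m*n 10 p)) (*-monoʳ-≤ d (n≤1+n E))) ⟩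
      10 * p * (d * suc E) + 10 * p * w            ≡⟨ collect p d (suc E) q ⟩
      10 * p * ((2 * d + 4 * (d * p) + 4 * (d * q)) * suc E)
        ≤⟨ *-monoʳ-≤ (10 * p) (*-monoˡ-≤ (suc E) (+-mono-≤ (+-mono-≤ (*-monoʳ-≤ 2 (≤-trans d≤dp dp≤s)) (*-monoʳ-≤ 4 dp≤s)) (*-monoʳ-≤ 4 dq≤s))) ⟩
      10 * p * ((2 * s + 4 * s + 4 * s) * suc E)   ≡⟨ cong (10 * p *_) (tens s (suc E)) ⟩
      10 * p * Err                                 ∎
      where
      collect : ∀ p d e q → 10 * p * (d * e) + 10 * p * (d * (e * (1 + 4 * (p + q)))) ≡ 10 * p * ((2 * d + 4 * (d * p) + 4 * (d * q)) * e)
      collect = ℕ-Solver.solve-∀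
      tens : ∀ s e → (2 * s + 4 * s + 4 * s) * e ≡ 10 * (s * e)
      tens = ℕ-Solver.solve-∀
    total : 10 * p * ∣ correlation n 1 a ∣ ≤ 10 * p * Err + α * ∣ Φ n ∣
    total = begin
      10 * p * ∣ correlation n 1 a ∣
        ≤⟨ Progressions.conclusion n d m p q k a (density (d * q) ls) E n≡dm qa≡ p⊥q
             (≤-trans (density≤product (d * q) ls) (≤-reflexive (sym n≡))) (sieved (d * q)) α small ⟩
      α * (∣ Φ n ∣ + d * E) + 10 * p * w              ≡⟨ cong (_+ 10 * p * w) (*-distribˡ-+ α ∣ Φ n ∣ (d * E)) ⟩
      α * ∣ Φ n ∣ + α * (d * E) + 10 * p * w          ≡⟨ +-assoc (α * ∣ Φ n ∣) (α * (d * E)) (10 * p * w) ⟩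
      α * ∣ Φ n ∣ + (α * (d * E) + 10 * p * w)        ≤⟨ +-monoʳ-≤ (α * ∣ Φ n ∣) error ⟩
      α * ∣ Φ n ∣ + 10 * p * Err                      ≡⟨ +-comm (α * ∣ Φ n ∣) (10 * p * Err) ⟩
      10 * p * Err + α * ∣ Φ n ∣                      ∎

  -- p / q approximates a modulo n / D.
  record Approximation (a p q : ℕ) : Set where
    field
      D j     : ℕ
      D≢0     : NonZero D
      Dp≤s    : D * p ≤ s
      Dq≤s    : D * q ≤ s
      0<p     : 0 < p
      0<q     : 0 < q
      p⊥q     : Coprime p q
      qa≡p+j  : q * a ≡ p + j
      n∣Dj    : n ∣ D * j

  record Reduced (a p q : ℕ) (j : ℕ) : Set where
    field
      d m k : ℕ
      n≡dm  : n ≡ d * m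
      j≡km  : j ≡ k * m
      k⊥d   : Coprime k d
      dp≤s  : d * p ≤ s
      dq≤s  : d * q ≤ s

  -- The modulus `m = gcd j n` is the largest possible. Its cofactor `d` divides `D`, so the size
  -- bounds persist, and `k = j / m` becomes prime to `d`, as the average over shifts requires.
  reduce : ∀ {a p q} (A : Approximation a p q) → Reduced a p q (Approximation.j A)
  reduce A with gcd-split (Approximation.j A) n
  ... | m , k , d , j≡km , n≡dm , k⊥d , m≢0 = record
    { d = d ; m = m ; k = k ; n≡dm = n≡dm ; j≡km = j≡km ; k⊥d = k⊥d
    ; dp≤s = ≤-trans (*-monoˡ-≤ _ d≤D) Dp≤s ; dq≤s = ≤-trans (*-monoˡ-≤ _ d≤D) Dq≤s }
    where
    open Approximation A
    d∣kD : d ∣ k * D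
    d∣kD = *-cancelʳ-∣ m {{m≢0}} (subst₂ _∣_ n≡dm (trans (cong (D *_) j≡km) (lemma D k m)) n∣Dj)
      where
      lemma : ∀ D k m → D * (k * m) ≡ k * D * m
      lemma = ℕ-Solver.solve-∀
    d≤D : d ≤ D
    d≤D = ∣⇒≤ {{D≢0}} (Coprimality.coprime-divisor (Coprimality.sym k⊥d) d∣kD)

  strong-or-small : ∀ {a p q} → Approximation a p q → Strong a ⊎ (p ≡ 1 ⊎ p ≡ 3)
  strong-or-small {a} {p} {q} A with reduce A | even⊎odd p
  ... | reduced | inj₁ (h , p≡2h) = inj₁ (≤-trans (≤-trans (*-monoˡ-≤ (excess a) (m≤m*n 10 p {{p≢0}}))
      (estimate {d} {m} {k = k} 0 p≢0 n≡dm (trans qa≡p+j (cong (λ z → p + z) j≡km)) p⊥q dp≤s dq≤s z≤n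
        (≤-reflexive (cong (λ z → 10 * ∣ z ∣) (trans (∑-cong′ d λ c → trans (cong (χ d c ⊛_) (cross-even n q a c h (Coprimality.sym p⊥q) p≡2h {{p≢0}})) (ℤₚ.*-zeroʳ (χ d c))) (∑-zero d))))))
      z≤n)
    where
    open Approximation A
    open Reduced reduced
    p≢0 : NonZero p
    p≢0 = >-nonZero 0<p
  ... | _ | inj₂ (0 , p≡1) = inj₂ (inj₁ p≡1)
  ... | _ | inj₂ (1 , p≡3) = inj₂ (inj₂ p≡3)
  -- Now `p` is at least `5`, and the saving `1 / p ≤ 1 / 5` is already better than 3/10.
  ... | reduced | inj₂ (h@(suc (suc h′)) , p≡) = inj₁ (*-cancelˡ-≤ 5 (begin
      5 * (10 * X)      ≡⟨ swap X ⟩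
      10 * 5 * X        ≤⟨ *-monoˡ-≤ X (*-monoʳ-≤ 10 5≤p) ⟩
      10 * p * X        ≤⟨ estimate {d} {m} {k = k} 10 (>-nonZero 0<p) n≡dm (trans qa≡p+j (cong (λ z → p + z) j≡km)) p⊥q dp≤s dq≤s ≤-refl
                             (*-monoʳ-≤ 10 (∣∑χ∣≤Φ d n (cross n p q a) λ c → ∣cross-odd∣≤ n q a c h (Coprimality.sym p⊥q) p≡)) ⟩
      10 * ∣ Φ n ∣      ≤⟨ *-monoˡ-≤ ∣ Φ n ∣ (m≤m+n 10 5) ⟩
      15 * ∣ Φ n ∣      ≡⟨ *-assoc 5 3 ∣ Φ n ∣ ⟩
      5 * (3 * ∣ Φ n ∣) ∎))
    where
    open ≤-Reasoning
    open Approximation A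
    open Reduced reduced
    X = excess a
    swap : ∀ x → 5 * (10 * x) ≡ 10 * 5 * x
    swap = ℕ-Solver.solve-∀
    5≤p : 5 ≤ p
    5≤p = subst (5 ≤_) (sym p≡) (s≤s (*-monoʳ-≤ 2 (s≤s (s≤s z≤n))))

  -- If `d = 1`, the congruence holds modulo `n` itself and the saving is `1 / p`. If `d > 1`, it
  -- holds modulo a proper divisor, and a prime of `d` supplies 3/10 whatever `p` is.
  integral : ∀ {a p} h → p ≡ 1 + 2 * h → Approximation a p 1 → Strong a ⊎ (a % n ≡ p % n × 10 * p * excess a ≤ 10 * ∣ Φ n ∣)
  integral {a} {p} h p-odd A with reduce A
  ... | reduced = split (d ≟ 1)
    where
    open Approximation A
    open Reduced reduced
    p≢0 : NonZero p
    p≢0 = >-nonZero 0<p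
    d≢0 : NonZero d
    d≢0 = m*n≢0⇒m≢0 d {{subst NonZero n≡dm (≢-nonZero (≢-nonZero⁻¹ n))}}
    a≡p+j : a ≡ p + j
    a≡p+j = trans (sym (*-identityˡ a)) qa≡p+j
    qa≡p+km : 1 * a ≡ p + k * m
    qa≡p+km = trans qa≡p+j (cong (λ z → p + z) j≡km)
    split : Dec (d ≡ 1) → _
    split (yes d≡1) = inj₂
      ( trans (cong (_% n) a≡p+j) (+∣⇒%≡ p (subst₂ _∣_ (sym (trans n≡dm (trans (cong (_* m) d≡1) (*-identityˡ m)))) (sym j≡km) (n∣m*n k)))
      , estimate {d} {m} {k = k} 10 p≢0 n≡dm qa≡p+km p⊥q dp≤s dq≤s ≤-refl
          (*-monoʳ-≤ 10 (∣∑χ∣≤Φ d n (cross n p 1 a) λ c → ∣cross-odd∣≤ n 1 a c h (Coprimality.sym p⊥q) p-odd)))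
    split (no d≢1) with primeDivisor d {{d≢0}} d≢1
    ... | l , l-prime , l∣d with prime-divisor-odd l-prime (∣-trans l∣d (subst (d ∣_) (sym n≡dm) (m∣m*n m)))
    ... | i , l-odd = inj₁ (≤-trans (*-monoˡ-≤ (excess a) (m≤m*n 10 p {{p≢0}}))
        (estimate {d} {m} {k = k} 3 p≢0 n≡dm qa≡p+km p⊥q dp≤s dq≤s (m≤m+n 3 7)
          (≤-trans (≤-reflexive (cong (λ z → 10 * ∣ z ∣) (∑-cong′ d λ c → cong (χ d c ⊛_) (cross-1 n a c h (k * m) p-odd (trans a≡p+j (cong (λ z → p + z) j≡km))))))
            (∣∑χ-autocorrelation∣≤ n d m k i n≡dm k⊥d l-prime l∣d (prime-divisor-≥5 l-prime (∣-trans l∣d (subst (d ∣_) (sym n≡dm) (m∣m*n m)))) l-odd))))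

  -- Inverting `a` exchanges numerator and denominator and, by `excess-inverse`, keeps the
  -- correlation. What is known about `p` thus carries over to `q`.
  swap : ∀ {a a′ p q} → (a * a′) % n ≡ 1 % n → s ≤ a′ → Approximation a p q → Approximation a′ q p
  swap {a} {a′} {p} {q} aa′≡1 s≤a′ A = record
    { D = D ; j = j′ ; D≢0 = D≢0 ; Dp≤s = Dq≤s ; Dq≤s = Dp≤s ; 0<p = 0<q ; 0<q = 0<p
    ; p⊥q = Coprimality.sym p⊥q ; qa≡p+j = pa′≡q+j′ ; n∣Dj = ∣m+n∣n⇒∣m n∣sum (∣n⇒∣m*n a′ n∣Dj) }
    where
    open Approximation A
    j′ u : ℕ
    j′ = p * a′ ∸ q
    u = (a * a′) / n
    q≤pa′ : q ≤ p * a′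
    q≤pa′ = ≤-trans (m≤n*m q D {{D≢0}}) (≤-trans Dq≤s (≤-trans s≤a′ (m≤n*m a′ p {{>-nonZero 0<p}})))
    pa′≡q+j′ : p * a′ ≡ q + j′
    pa′≡q+j′ = sym (m+[n∸m]≡n q≤pa′)
    aa′≡ : a * a′ ≡ 1 + u * n
    aa′≡ = trans (m≡m%n+[m/n]*n (a * a′) n) (cong (_+ u * n) (trans aa′≡1 (m<n⇒m%n≡m 1<n)))
    -- `D * q * a * a′` is evaluated in two ways, by the approximation of `a` and by `a * a′ ≡ 1`.
    n∣sum : n ∣ D * j′ + a′ * (D * j)
    n∣sum = divides (D * q * u) (+-cancelˡ-≡ (D * q) _ _ (begin
      D * q + (D * j′ + a′ * (D * j))  ≡⟨ lemma₁ D q j′ a′ j ⟩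
      D * (q + j′) + a′ * D * j        ≡⟨ cong (λ z → D * z + a′ * D * j) pa′≡q+j′ ⟨
      D * (p * a′) + a′ * D * j        ≡⟨ lemma₂ D p a′ j ⟩
      D * a′ * (p + j)                 ≡⟨ cong (D * a′ *_) qa≡p+j ⟨
      D * a′ * (q * a)                 ≡⟨ lemma₃ D a′ q a ⟩
      D * q * (a * a′)                 ≡⟨ cong (D * q *_) aa′≡ ⟩
      D * q * (1 + u * n)              ≡⟨ lemma₄ (D * q) u n ⟩
      D * q + D * q * u * n            ∎))
      where
      open ≡-Reasoning
      lemma₁ : ∀ D q j′ a′ j → D * q + (D * j′ + a′ * (D * j)) ≡ D * (q + j′) + a′ * D * j
      lemma₁ = ℕ-Solver.solve-∀
      lemma₂ : ∀ D p a′ j → D * (p * a′) + a′ * D * j ≡ D * a′ * (p + j)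
      lemma₂ = ℕ-Solver.solve-∀
      lemma₃ : ∀ D a′ q a → D * a′ * (q * a) ≡ D * q * (a * a′)
      lemma₃ = ℕ-Solver.solve-∀
      lemma₄ : ∀ x u n → x * (1 + u * n) ≡ x + x * u * n
      lemma₄ = ℕ-Solver.solve-∀

  excess-inverse : ∀ a a′ → Coprime a n → (a * a′) % n ≡ 1 % n → excess a′ ≡ excess a
  excess-inverse a a′ a⊥n aa′≡1 = cong (λ z → ∣ z ∣ ∸ Err) (begin
    correlation n 1 a′             ≡⟨ correlation-* a 1 a′ a⊥n ⟨
    correlation n (1 * a) (a′ * a) ≡⟨ correlation-% (1 * a) a (a′ * a) 1 (cong (_% n) (*-identityˡ a)) (trans (cong (_% n) (*-comm a′ a)) aa′≡1) ⟩
    correlation n a 1              ≡⟨ correlation-comm a 1 ⟩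
    correlation n 1 a              ∎)
    where open ≡-Reasoning

  weaken : ∀ {a} → 10 * 3 * excess a ≤ 10 * ∣ Φ n ∣ → Weak a
  weaken {a} le = *-cancelˡ-≤ 10 (≤-trans (≤-reflexive (sym (*-assoc 10 3 (excess a)))) le)

  approximable : ∀ {a p q} → Coprime a n → a % n ≢ 1 % n → Approximation a p q →
    Strong a ⊎ (Weak a × (a % n ≡ 3 % n ⊎ (3 * a) % n ≡ 1 % n))
  approximable {a} {p} {q} a⊥n a≢1 A with inverse-≥ a s a⊥n
  ... | a′ , s≤a′ , _ , aa′≡1 = cases (strong-or-small A) (strong-or-small A′)
    where
    A′ : Approximation a′ q p
    A′ = swap aa′≡1 s≤a′ A
    cases : Strong a ⊎ (p ≡ 1 ⊎ p ≡ 3) → Strong a′ ⊎ (q ≡ 1 ⊎ q ≡ 3) → Strong a ⊎ (Weak a × (a % n ≡ 3 % n ⊎ (3 * a) % n ≡ 1 % n))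
    cases (inj₁ strong) _ = inj₁ strong
    cases (inj₂ _) (inj₁ strong) = inj₁ (subst (λ x → 10 * x ≤ 3 * ∣ Φ n ∣) (excess-inverse a a′ a⊥n aa′≡1) strong)
    cases (inj₂ (inj₁ refl)) (inj₂ (inj₁ refl)) with integral 0 refl A
    ... | inj₁ strong    = inj₁ strong
    ... | inj₂ (a≡1 , _) = contradiction a≡1 a≢1
    cases (inj₂ (inj₂ refl)) (inj₂ (inj₁ refl)) with integral 1 refl A
    ... | inj₁ strong     = inj₁ strong
    ... | inj₂ (a≡3 , le) = inj₂ (weaken {a} le , inj₁ a≡3)
    cases (inj₂ (inj₁ refl)) (inj₂ (inj₂ refl)) with integral 1 refl A′
    ... | inj₁ strong      = inj₁ (subst (λ x → 10 * x ≤ 3 * ∣ Φ n ∣) (excess-inverse a a′ a⊥n aa′≡1) strong)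
    ... | inj₂ (a′≡3 , le) = inj₂
      ( subst (λ x → 3 * x ≤ ∣ Φ n ∣) (excess-inverse a a′ a⊥n aa′≡1) (weaken {a′} le)
      , inj₂ (trans (*-congˡ-% {3} {a′} a (sym a′≡3)) (trans (cong (_% n) (*-comm a′ a)) aa′≡1)))
    cases (inj₂ (inj₂ refl)) (inj₂ (inj₂ refl)) = contradiction (Approximation.p⊥q A (∣-refl , ∣-refl)) λ ()

  -- The common factor `e` of `p` and `q` may fail to be invertible modulo `n`. It is kept as `D`:
  -- cancelling it leaves `n ∣ D * j`, and the bounds by `s` still include it.
  approximation : ∀ {a p q} → s ≤ a → 0 < p → p ≤ s → 0 < q → q ≤ s → (q * a) % n ≡ p % n →
    ∃[ p′ ] ∃[ q′ ] Approximation a p′ q′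
  approximation {a} {p} {q} s≤a 0<p p≤s 0<q q≤s qa≡p with gcd-split p q {{>-nonZero 0<q}}
  ... | e , p′ , q′ , refl , refl , p′⊥q′ , e≢0 = p′ , q′ , record
    { D = e ; j = j′ ; D≢0 = e≢0 ; Dp≤s = subst (_≤ s) (*-comm p′ e) p≤s ; Dq≤s = subst (_≤ s) (*-comm q′ e) q≤s
    ; 0<p = >-nonZero⁻¹ p′ {{m*n≢0⇒m≢0 p′ {{>-nonZero 0<p}}}} ; 0<q = 0<q′ ; p⊥q = p′⊥q′ ; qa≡p+j = q′a≡
    ; n∣Dj = n∣ej′ }
    where
    j′ = q′ * a ∸ p′
    0<q′ : 0 < q′
    0<q′ = >-nonZero⁻¹ q′ {{m*n≢0⇒m≢0 q′ {{>-nonZero 0<q}}}}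
    q′a≡ : q′ * a ≡ p′ + j′
    q′a≡ = sym (m+[n∸m]≡n (≤-trans (m≤m*n p′ e {{e≢0}}) (≤-trans p≤s (≤-trans s≤a (m≤n*m a q′ {{>-nonZero 0<q′}})))))
    expand : p′ * e + e * j′ ≡ q′ * e * a
    expand = trans (lemma₁ p′ e j′) (trans (cong (e *_) (sym q′a≡)) (lemma₂ e q′ a))
      where
      lemma₁ : ∀ p e j → p * e + e * j ≡ e * (p + j)
      lemma₁ = ℕ-Solver.solve-∀
      lemma₂ : ∀ e q a → e * (q * a) ≡ q * e * a
      lemma₂ = ℕ-Solver.solve-∀
    n∣ej′ : n ∣ e * j′
    n∣ej′ = subst (n ∣_) (sym ej′≡) n∣difference
      where
      n∣difference : n ∣ (q′ * e * a) ∸ p′ * e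
      n∣difference = subst (n ∣_) (difference (q′ * e * a) (p′ * e) qa≡p (≤-trans (m≤m+n (p′ * e) (e * j′)) (≤-reflexive expand))) (n∣m*n (q′ * e * a / n ∸ p′ * e / n))
        where
        difference : ∀ x y → x % n ≡ y % n → y ≤ x → (x / n ∸ y / n) * n ≡ x ∸ y
        difference x y x≡y y≤x = sym (begin
          x ∸ y                                          ≡⟨ cong₂ _∸_ (m≡m%n+[m/n]*n x n) (m≡m%n+[m/n]*n y n) ⟩
          x % n + x / n * n ∸ (y % n + y / n * n)        ≡⟨ cong (λ z → z + x / n * n ∸ (y % n + y / n * n)) x≡y ⟩
          y % n + x / n * n ∸ (y % n + y / n * n)        ≡⟨ [m+n]∸[m+o]≡n∸o (y % n) (x / n * n) (y / n * n) ⟩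
          x / n * n ∸ y / n * n                          ≡⟨ *-distribʳ-∸ n (x / n) (y / n) ⟨
          (x / n ∸ y / n) * n                            ∎)
          where open ≡-Reasoning
      ej′≡ : e * j′ ≡ (q′ * e * a) ∸ p′ * e
      ej′≡ = trans (sym (m+n∸m≡n (p′ * e) (e * j′))) (cong (_∸ p′ * e) expand)

  -- When Thue's lemma yields `q * a ≡ -p`, the argument runs for `a* = pred n * a`, a
  -- representative of the negative of `a`, whose correlation differs only in sign.
  correlation-bound : ∀ a → s ≤ a → Coprime a n → a % n ≢ 1 % n → ¬ n ∣ a + 1 →
    Strong a ⊎ (Weak a × ThreeRelated a)
  correlation-bound a s≤a a⊥n a≢1 a≢-1 = split (thue n s a n<S² s<n a⊥n)
    where
    a* = pred n * a
    n∣a+a* : n ∣ a + a*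
    n∣a+a* = divides a (trans (cong (_* a) (suc-pred n)) (*-comm n a))
    a*⊥n : Coprime a* n
    a*⊥n {r} (r∣a* , r∣n) = a⊥n (∣m+n∣n⇒∣m (∣-trans r∣n n∣a+a*) r∣a* , r∣n)
    s≤a* : s ≤ a*
    s≤a* = ≤-trans s≤a (m≤n*m a (pred n) {{>-nonZero (≤-pred (≤-trans 1<n (≤-reflexive (sym (suc-pred n)))))}})
    qa*≡p : ∀ p q → n ∣ q * a + p → (q * a*) % n ≡ p % n
    qa*≡p p q n∣qa+p = begin
      (q * a*) % n                   ≡⟨ +∣⇒%≡ (q * a*) n∣qa+p ⟨
      (q * a* + (q * a + p)) % n     ≡⟨ cong (_% n) (lemma q a* a p) ⟩
      (p + q * (a + a*)) % n         ≡⟨ +∣⇒%≡ p (∣n⇒∣m*n q n∣a+a*) ⟩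
      p % n                          ∎
      where
      open ≡-Reasoning
      lemma : ∀ q x a p → q * x + (q * a + p) ≡ p + q * (a + x)
      lemma = ℕ-Solver.solve-∀
    excess* : excess a* ≡ excess a
    excess* = cong (_∸ Err) (trans (cong ∣_∣ (correlation-neg 1 a a* a⊥n n∣a+a*)) (ℤₚ.∣-i∣≡∣i∣ (correlation n 1 a)))
    positive : Strong a ⊎ (Weak a × (a % n ≡ 3 % n ⊎ (3 * a) % n ≡ 1 % n)) → Strong a ⊎ (Weak a × ThreeRelated a)
    positive (inj₁ strong)             = inj₁ strong
    positive (inj₂ (weak , inj₁ a≡3))  = inj₂ (weak , inj₁ a≡3)
    positive (inj₂ (weak , inj₂ 3a≡1)) = inj₂ (weak , inj₂ (inj₁ 3a≡1))
    negative : Strong a* ⊎ (Weak a* × (a* % n ≡ 3 % n ⊎ (3 * a*) % n ≡ 1 % n)) → Strong a ⊎ (Weak a × ThreeRelated a)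
    negative (inj₁ strong)              = inj₁ (subst (λ x → 10 * x ≤ 3 * ∣ Φ n ∣) excess* strong)
    negative (inj₂ (weak , inj₁ a*≡3))  = inj₂ (subst (λ x → 3 * x ≤ ∣ Φ n ∣) excess* weak , inj₂ (inj₂ (inj₁ (%≡⇒∣+ n∣a+a* a*≡3))))
    negative (inj₂ (weak , inj₂ 3a*≡1)) = inj₂ (subst (λ x → 3 * x ≤ ∣ Φ n ∣) excess* weak , inj₂ (inj₂ (inj₂
      (%≡⇒∣+ (subst (n ∣_) (*-distribˡ-+ 3 a a*) (∣n⇒∣m*n 3 n∣a+a*)) 3a*≡1))))
    split : ∃[ p ] ∃[ q ] (0 < p × p ≤ s × 0 < q × q ≤ s × ((q * a) % n ≡ p % n ⊎ n ∣ q * a + p)) → Strong a ⊎ (Weak a × ThreeRelated a)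
    split (p , q , 0<p , p≤s , 0<q , q≤s , inj₁ qa≡p) =
      positive (approximable a⊥n a≢1 (proj₂ (proj₂ (approximation s≤a 0<p p≤s 0<q q≤s qa≡p))))
    split (p , q , 0<p , p≤s , 0<q , q≤s , inj₂ n∣qa+p) =
      negative (approximable a*⊥n (λ a*≡1 → a≢-1 (%≡⇒∣+ n∣a+a* a*≡1)) (proj₂ (proj₂ (approximation s≤a* 0<p p≤s 0<q q≤s (qa*≡p p q n∣qa+p)))))

-- From integers modulo `n` to natural representatives.

∣-via-multiple : ∀ n {x} t → x ≡ t ⊛ + n → n ∣ ∣ x ∣
∣-via-multiple n t refl = divides ∣ t ∣ (ℤₚ.∣i*j∣≡∣i∣*∣j∣ t (+ n))

%-representation : ∀ n y z .{{_ : NonZero n}} → y % n ≡ z % n → ∃[ w ] + y ≡ + z ⊕ w ⊛ + n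
%-representation n y z y≡z = + (y / n) ⊖ + (z / n) , (begin
  + y                                                 ≡⟨ expand y ⟩
  + (y % n) ⊕ + (y / n) ⊛ + n                         ≡⟨ cong (λ r → + r ⊕ + (y / n) ⊛ + n) y≡z ⟩
  + (z % n) ⊕ + (y / n) ⊛ + n                         ≡⟨ lemma (+ (z % n)) (+ (y / n)) (+ (z / n)) (+ n) ⟩
  + (z % n) ⊕ + (z / n) ⊛ + n ⊕ (+ (y / n) ⊖ + (z / n)) ⊛ + n ≡⟨ cong (_⊕ (+ (y / n) ⊖ + (z / n)) ⊛ + n) (expand z) ⟨
  + z ⊕ (+ (y / n) ⊖ + (z / n)) ⊛ + n                 ∎)
  where
  open ≡-Reasoning
  expand : ∀ y → + y ≡ + (y % n) ⊕ + (y / n) ⊛ + n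
  expand y = trans (cong +_ (m≡m%n+[m/n]*n y n)) (cong (+ (y % n) ⊕_) (ℤₚ.pos-* (y / n) n))
  lemma : ∀ r y z n → r ⊕ y ⊛ n ≡ r ⊕ z ⊛ n ⊕ (y ⊖ z) ⊛ n
  lemma = ℤ-Solver.solve-∀

%ℕ-representation : ∀ n {x} k z .{{_ : NonZero n}} → x ≡ + k ⊕ z ⊛ + n → x %ℕ n ≡ k % n
%ℕ-representation n {x} k z x≡ = ℤₚ.+-injective (ℤₚ.i-j≡0⇒i≡j (+ r) (+ r′) (ℤₚ.∣i∣≡0⇒i≡0 (bounded ∣ w ∣ multiple below)))
  where
  open ≡-Reasoning
  r r′ : ℕ
  r = x %ℕ n
  r′ = k % n
  w : ℤ
  w = + (k / n) ⊕ z ⊖ x /ℕ n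
  difference : + r ⊖ + r′ ≡ w ⊛ + n
  difference = begin
    + r ⊖ + r′                                                        ≡⟨ lemma₁ (+ r) (+ r′) (x /ℕ n) (+ n) ⟩
    (+ r ⊕ x /ℕ n ⊛ + n) ⊖ (+ r′ ⊕ x /ℕ n ⊛ + n)                       ≡⟨ cong (_⊖ (+ r′ ⊕ x /ℕ n ⊛ + n)) (trans (sym (a≡a%ℕn+[a/ℕn]*n x n)) x≡) ⟩
    (+ k ⊕ z ⊛ + n) ⊖ (+ r′ ⊕ x /ℕ n ⊛ + n)                            ≡⟨ cong (λ y → (y ⊕ z ⊛ + n) ⊖ (+ r′ ⊕ x /ℕ n ⊛ + n)) (trans (cong +_ (m≡m%n+[m/n]*n k n)) (cong (+ r′ ⊕_) (ℤₚ.pos-* (k / n) n))) ⟩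
    (+ r′ ⊕ + (k / n) ⊛ + n ⊕ z ⊛ + n) ⊖ (+ r′ ⊕ x /ℕ n ⊛ + n)         ≡⟨ lemma₂ (+ r′) (+ (k / n)) (+ n) z (x /ℕ n) ⟩
    w ⊛ + n                                                           ∎
    where
    lemma₁ : ∀ r r′ q n → r ⊖ r′ ≡ (r ⊕ q ⊛ n) ⊖ (r′ ⊕ q ⊛ n)
    lemma₁ = ℤ-Solver.solve-∀
    lemma₂ : ∀ r′ k n z q → (r′ ⊕ k ⊛ n ⊕ z ⊛ n) ⊖ (r′ ⊕ q ⊛ n) ≡ (k ⊕ z ⊖ q) ⊛ n
    lemma₂ = ℤ-Solver.solve-∀
  multiple : ∣ + r ⊖ + r′ ∣ ≡ ∣ w ∣ * n
  multiple = trans (cong ∣_∣ difference) (ℤₚ.∣i*j∣≡∣i∣*∣j∣ w (+ n))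
  below : ∣ + r ⊖ + r′ ∣ < n
  below = ≤-<-trans (∣⊖∣≤ (≤-trans (m≤m⊔n r r′) (m≤n+m (r ⊔ r′) r′)) (≤-trans (m≤n⊔m r r′) (m≤n+m (r ⊔ r′) r)))
    (⊔-pres-<m (n%ℕd<d x n) (m%n<n k n))
  bounded : ∀ {x} t → x ≡ t * n → x < n → x ≡ 0
  bounded zero    x≡ x<n = x≡
  bounded (suc t) x≡ x<n = contradiction (≤-trans (m≤m+n n (t * n)) (≤-reflexive (sym x≡))) (<⇒≱ x<n)

𝟙-×-dec : ∀ {P Q : Set} (d : Dec P) (e : Dec Q) → 𝟙 (d ×-dec e) ≡ 𝟙 d ⊛ 𝟙 e
𝟙-×-dec (yes _) (yes _) = refl
𝟙-×-dec (yes _) (no _)  = refl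
𝟙-×-dec (no _)  (yes _) = refl
𝟙-×-dec (no _)  (no _)  = refl

+φ : ∀ n → + φ n ≡ Φ n
+φ n = trans (∑-indicator (λ g → coprime? g n) (λ g → g) n) (∑-cong′ n λ g → sym (χ≡𝟙 n g))

representative : ∀ n s x .{{_ : NonZero n}} → ∃[ ξ ] ∃[ z ] (s ≤ ξ × x ≡ + ξ ⊕ z ⊛ + n)
representative n s x = x %ℕ n + s * n , x /ℕ n ⊖ + s , ≤-trans (m≤m*n s n) (m≤n+m (s * n) (x %ℕ n)) , (begin
  x                                                ≡⟨ a≡a%ℕn+[a/ℕn]*n x n ⟩
  + (x %ℕ n) ⊕ x /ℕ n ⊛ + n                        ≡⟨ lemma (+ (x %ℕ n)) (x /ℕ n) (+ s) (+ n) ⟩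
  + (x %ℕ n) ⊕ + s ⊛ + n ⊕ (x /ℕ n ⊖ + s) ⊛ + n    ≡⟨ cong (λ y → + (x %ℕ n) ⊕ y ⊕ (x /ℕ n ⊖ + s) ⊛ + n) (ℤₚ.pos-* s n) ⟨
  + (x %ℕ n + s * n) ⊕ (x /ℕ n ⊖ + s) ⊛ + n        ∎)
  where
  open ≡-Reasoning
  lemma : ∀ r q s n → r ⊕ q ⊛ n ≡ r ⊕ s ⊛ n ⊕ (q ⊖ s) ⊛ n
  lemma = ℤ-Solver.solve-∀

representative-coprime : ∀ n {x} ξ z → x ≡ + ξ ⊕ z ⊛ + n → Coprime ∣ x ∣ n → Coprime ξ n
representative-coprime n {x} ξ z refl x⊥n {r} (divides u ξ≡ , divides v n≡) =
  x⊥n (∣-via-multiple r (+ u ⊕ z ⊛ + v) (trans (cong₂ (λ ξ n → + ξ ⊕ z ⊛ + n) ξ≡ n≡)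
    (trans (cong₂ (λ y w → y ⊕ z ⊛ w) (ℤₚ.pos-* u r) (ℤₚ.pos-* v r)) (lemma (+ u) z (+ v) (+ r)))) , divides v n≡)
  where
  lemma : ∀ u z v r → u ⊛ r ⊕ z ⊛ (v ⊛ r) ≡ (u ⊕ z ⊛ v) ⊛ r
  lemma = ℤ-Solver.solve-∀

count-∑ : ∀ n a b α β z w .{{_ : NonZero n}} → a ≡ + α ⊕ z ⊛ + n → b ≡ + β ⊕ w ⊛ + n →
  + count n a b ≡ ∑ n (λ g → χ n g ⊛ (below-half n (g % n) ⊛ (below-half n ((α * g) % n) ⊛ below-half n ((β * g) % n))))
count-∑ n@(suc _) a b α β z w a≡ b≡ = trans
  (∑-indicator (λ g → coprime? g n ×-dec inI? n (+ g) ×-dec inI? n (a ⊛ + g) ×-dec inI? n (b ⊛ + g)) (λ g → g) n)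
  (∑-cong′ n λ g → trans (𝟙-×-dec (coprime? g n) (inI? n (+ g) ×-dec inI? n (a ⊛ + g) ×-dec inI? n (b ⊛ + g))) (cong₂ _⊛_ (sym (χ≡𝟙 n g))
    (trans (𝟙-×-dec (inI? n (+ g)) (inI? n (a ⊛ + g) ×-dec inI? n (b ⊛ + g))) (cong (below-half n (g % n) ⊛_)
      (trans (𝟙-×-dec (inI? n (a ⊛ + g)) (inI? n (b ⊛ + g))) (cong₂ _⊛_
        (cong (below-half n) (residue a α z a≡ g)) (cong (below-half n) (residue b β w b≡ g))))))))
  where
  residue : ∀ a α z → a ≡ + α ⊕ z ⊛ + n → ∀ g → (a ⊛ + g) %ℕ n ≡ (α * g) % n
  residue a α z a≡ g = %ℕ-representation n (α * g) (z ⊛ + g)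
    (trans (cong (_⊛ + g) a≡) (trans (lemma (+ α) z (+ n) (+ g)) (cong (_⊕ z ⊛ + g ⊛ + n) (sym (ℤₚ.pos-* α g)))))
    where
    lemma : ∀ a z n g → (a ⊕ z ⊛ n) ⊛ g ≡ a ⊛ g ⊕ z ⊛ g ⊛ n
    lemma = ℤ-Solver.solve-∀

isqrt : ∀ n → ∃[ s ] (s * s ≤ n × n < suc s * suc s)
isqrt zero = 0 , z≤n , s≤s z≤n
isqrt (suc n) with isqrt n
... | s , ss≤n , n<SS with suc s * suc s ≤? suc n
... | yes SS≤1+n = suc s , SS≤1+n , ≤-trans (s≤s n<SS) (*-mono-< (n<1+n (suc s)) (n<1+n (suc s)))
... | no SS≰1+n  = s , m≤n⇒m≤1+n ss≤n , ≰⇒> SS≰1+n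

-- Compared in sixteenth powers: of the `n ^ 9` in the weight, `n ^ 8` pays for `s ^ 16` and the
-- remaining `n` for the constant `k * t ^ 16`.
density-lower-bound : ∀ k t n s P B .{{_ : NonZero k}} → k * t ^ 16 ≤ n → s * s ≤ n → P ^ 16 * n ^ 9 ≤ k * B ^ 16 → t * s * P ≤ B
density-lower-bound k t n s P B kt≤n ss≤n weight≤ with t * s * P ≤? B
... | yes le = le
... | no ¬le = contradiction (^-monoˡ-< 16 (≰⇒> ¬le)) (≤⇒≯ (*-cancelˡ-≤ k (begin
  k * (t * s * P) ^ 16              ≡⟨ cong (k *_) (trans (*-^ 16 (t * s) P) (cong (_* P ^ 16) (*-^ 16 t s))) ⟩
  k * (t ^ 16 * s ^ 16 * P ^ 16)    ≡⟨ shuffle k (t ^ 16) (s ^ 16) (P ^ 16) ⟩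
  P ^ 16 * (k * t ^ 16 * s ^ 16)    ≤⟨ *-monoʳ-≤ (P ^ 16) (*-mono-≤ kt≤n s^16≤n^8) ⟩
  P ^ 16 * n ^ 9                    ≤⟨ weight≤ ⟩
  k * B ^ 16                        ∎)))
  where
  open ≤-Reasoning
  shuffle : ∀ k t s p → k * (t * s * p) ≡ p * (k * t * s)
  shuffle = ℕ-Solver.solve-∀
  s^16≤n^8 : s ^ 16 ≤ n ^ 8
  s^16≤n^8 = ≤-trans (≤-reflexive (trans (^-distribˡ-+-* s 8 8) (sym (*-^ 8 s s)))) (^-monoˡ-≤ 8 ss≤n)

-- The count and the final balance of constants.

module Count
  (n s : ℕ) (ls : List ℕ) .{{_ : NonZero n}} (n≡ : n ≡ product ls) (ls-prime : All Prime ls)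
  (1<n : 1 < n) (2⊥n : Coprime 2 n) (3⊥n : Coprime 3 n) (s<n : s < n) (n<S² : n < suc s * suc s)
  where

  open Units n 1<n 2⊥n
  open CorrelationBound n s ls n≡ ls-prime 1<n 2⊥n 3⊥n s<n n<S²

  pairExcess : ℕ → ℕ → ℕ
  pairExcess ξ η = ∣ correlation n ξ η ∣ ∸ Err

  -- A substitution on the units reduces the pair to `1` and the ratio `γ = η * ξ′`. Since
  -- `y ≡ γ * x`, congruences for `γ` become relations between `x` and `y`; `relation` and
  -- `relation⁺` treat the two signs.
  pair-bound : ∀ x y ξ η z w → x ≡ + ξ ⊕ z ⊛ + n → y ≡ + η ⊕ w ⊛ + n → Coprime ξ n → Coprime η n → s ≤ η →
    ¬ PlusMinus n x y → 10 * pairExcess ξ η ≤ 3 * φ n ⊎ (3 * pairExcess ξ η ≤ φ n × ¬ NoThreeRel n x y)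
  pair-bound x y ξ η z w x≡ y≡ ξ⊥n η⊥n s≤η ¬pm with inverse-≥ ξ s ξ⊥n
  ... | ξ′ , s≤ξ′ , 0<ξ′ , ξξ′≡1 = transfer (correlation-bound γ (≤-trans s≤η (m≤m*n η ξ′ {{>-nonZero 0<ξ′}}))
      (unit-* η⊥n (inverse-coprime {n} {ξ} {ξ′} 1<n ξξ′≡1)) γ≢1 γ≢-1)
    where
    γ : ℕ
    γ = η * ξ′
    γξ≡η : (γ * ξ) % n ≡ η % n
    γξ≡η = trans (cong (_% n) (lemma η ξ′ ξ)) (trans (*-congˡ-% {ξ * ξ′} {1} η ξξ′≡1) (cong (_% n) (*-identityˡ η)))
      where
      lemma : ∀ η ξ′ ξ → η * ξ′ * ξ ≡ ξ * ξ′ * η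
      lemma = ℕ-Solver.solve-∀
    ratio : ∃[ v ] y ≡ + γ ⊛ x ⊕ v ⊛ + n
    ratio with %-representation n (γ * ξ) η γξ≡η
    ... | u , γξ≡ = w ⊖ u ⊖ + γ ⊛ z , (begin
      y                                                     ≡⟨ y≡ ⟩
      + η ⊕ w ⊛ + n                                         ≡⟨ lemma₁ (+ η) w (+ n) u ⟩
      (+ η ⊕ u ⊛ + n) ⊕ (w ⊖ u) ⊛ + n                       ≡⟨ cong (_⊕ (w ⊖ u) ⊛ + n) (trans (sym γξ≡) (ℤₚ.pos-* γ ξ)) ⟩
      + γ ⊛ + ξ ⊕ (w ⊖ u) ⊛ + n                             ≡⟨ lemma₂ (+ γ) (+ ξ) (w ⊖ u) (+ n) z ⟩
      + γ ⊛ (+ ξ ⊕ z ⊛ + n) ⊕ (w ⊖ u ⊖ + γ ⊛ z) ⊛ + n       ≡⟨ cong (λ x → + γ ⊛ x ⊕ (w ⊖ u ⊖ + γ ⊛ z) ⊛ + n) x≡ ⟨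
      + γ ⊛ x ⊕ (w ⊖ u ⊖ + γ ⊛ z) ⊛ + n                     ∎)
      where
      open ≡-Reasoning
      lemma₁ : ∀ h w n u → h ⊕ w ⊛ n ≡ (h ⊕ u ⊛ n) ⊕ (w ⊖ u) ⊛ n
      lemma₁ = ℤ-Solver.solve-∀
      lemma₂ : ∀ g k v n z → g ⊛ k ⊕ v ⊛ n ≡ g ⊛ (k ⊕ z ⊛ n) ⊕ (v ⊖ g ⊛ z) ⊛ n
      lemma₂ = ℤ-Solver.solve-∀
    v : ℤ
    v = proj₁ ratio
    y≡γx : y ≡ + γ ⊛ x ⊕ v ⊛ + n
    y≡γx = proj₂ ratio
    relation : ∀ i j → (i * γ) % n ≡ j % n → n ∣ ∣ + j ⊛ x ⊖ + i ⊛ y ∣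
    relation i j iγ≡j with %-representation n (i * γ) j iγ≡j
    ... | u , iγ≡ = ∣-via-multiple n (⊝ (u ⊛ x) ⊖ + i ⊛ v) (begin
      + j ⊛ x ⊖ + i ⊛ y                                                    ≡⟨ cong (λ y → + j ⊛ x ⊖ + i ⊛ y) y≡γx ⟩
      + j ⊛ x ⊖ + i ⊛ (+ γ ⊛ x ⊕ v ⊛ + n)                                  ≡⟨ lemma₁ (+ i) (+ j) x (+ γ) v (+ n) ⟩
      + j ⊛ x ⊖ + i ⊛ + γ ⊛ x ⊖ + i ⊛ v ⊛ + n
        ≡⟨ cong (λ k → + j ⊛ x ⊖ k ⊛ x ⊖ + i ⊛ v ⊛ + n) (trans (sym (ℤₚ.pos-* i γ)) iγ≡) ⟩
      + j ⊛ x ⊖ (+ j ⊕ u ⊛ + n) ⊛ x ⊖ + i ⊛ v ⊛ + n                        ≡⟨ lemma₂ (+ i) (+ j) x u v (+ n) ⟩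
      (⊝ (u ⊛ x) ⊖ + i ⊛ v) ⊛ + n                                          ∎)
      where
      open ≡-Reasoning
      lemma₁ : ∀ i j x g v n → j ⊛ x ⊖ i ⊛ (g ⊛ x ⊕ v ⊛ n) ≡ j ⊛ x ⊖ i ⊛ g ⊛ x ⊖ i ⊛ v ⊛ n
      lemma₁ = ℤ-Solver.solve-∀
      lemma₂ : ∀ i j x u v n → j ⊛ x ⊖ (j ⊕ u ⊛ n) ⊛ x ⊖ i ⊛ v ⊛ n ≡ (⊝ (u ⊛ x) ⊖ i ⊛ v) ⊛ n
      lemma₂ = ℤ-Solver.solve-∀
    relation⁺ : ∀ i j → n ∣ i * γ + j → n ∣ ∣ + j ⊛ x ⊕ + i ⊛ y ∣
    relation⁺ i j (divides t iγ+j≡) = ∣-via-multiple n (+ t ⊛ x ⊕ + i ⊛ v) (begin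
      + j ⊛ x ⊕ + i ⊛ y                                  ≡⟨ cong (λ y → + j ⊛ x ⊕ + i ⊛ y) y≡γx ⟩
      + j ⊛ x ⊕ + i ⊛ (+ γ ⊛ x ⊕ v ⊛ + n)                ≡⟨ lemma₁ (+ i) (+ j) x (+ γ) v (+ n) ⟩
      (+ i ⊛ + γ ⊕ + j) ⊛ x ⊕ + i ⊛ v ⊛ + n              ≡⟨ cong (λ k → k ⊛ x ⊕ + i ⊛ v ⊛ + n) (trans (cong (_⊕ + j) (sym (ℤₚ.pos-* i γ))) (trans (cong +_ iγ+j≡) (ℤₚ.pos-* t n))) ⟩
      + t ⊛ + n ⊛ x ⊕ + i ⊛ v ⊛ + n                      ≡⟨ lemma₂ (+ i) (+ t) x v (+ n) ⟩
      (+ t ⊛ x ⊕ + i ⊛ v) ⊛ + n                          ∎)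
      where
      open ≡-Reasoning
      lemma₁ : ∀ i j x g v n → j ⊛ x ⊕ i ⊛ (g ⊛ x ⊕ v ⊛ n) ≡ (i ⊛ g ⊕ j) ⊛ x ⊕ i ⊛ v ⊛ n
      lemma₁ = ℤ-Solver.solve-∀
      lemma₂ : ∀ i t x v n → t ⊛ n ⊛ x ⊕ i ⊛ v ⊛ n ≡ (t ⊛ x ⊕ i ⊛ v) ⊛ n
      lemma₂ = ℤ-Solver.solve-∀
    1⊛ : ∀ u → + 1 ⊛ u ≡ u
    1⊛ = ℤₚ.*-identityˡ
    γ≢1 : γ % n ≢ 1 % n
    γ≢1 γ≡1 = ¬pm (inj₂ (subst (λ u → n ∣ ∣ u ∣) (cong₂ _⊖_ (1⊛ x) (1⊛ y)) (relation 1 1 (trans (cong (_% n) (*-identityˡ γ)) γ≡1))))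
    γ≢-1 : ¬ n ∣ γ + 1
    γ≢-1 n∣γ+1 = ¬pm (inj₁ (subst (λ u → n ∣ ∣ u ∣) (cong₂ _⊕_ (1⊛ x) (1⊛ y)) (relation⁺ 1 1 (subst (λ u → n ∣ u + 1) (sym (*-identityˡ γ)) n∣γ+1))))
    three : ThreeRelated γ → ¬ NoThreeRel n x y
    three (inj₁ γ≡3) (_ , _ , _ , h) = h (subst (λ u → n ∣ ∣ u ∣) (cong (+ 3 ⊛ x ⊖_) (1⊛ y)) (relation 1 3 (trans (cong (_% n) (*-identityˡ γ)) γ≡3)))
    three (inj₂ (inj₁ 3γ≡1)) (_ , h , _ , _) = h (subst (λ u → n ∣ ∣ u ∣) (cong (_⊖ + 3 ⊛ y) (1⊛ x)) (relation 3 1 3γ≡1))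
    three (inj₂ (inj₂ (inj₁ n∣γ+3))) (_ , _ , h , _) = h (subst (λ u → n ∣ ∣ u ∣) (cong (+ 3 ⊛ x ⊕_) (1⊛ y)) (relation⁺ 1 3 (subst (λ u → n ∣ u + 3) (sym (*-identityˡ γ)) n∣γ+3)))
    three (inj₂ (inj₂ (inj₂ n∣3γ+1))) (h , _ , _ , _) = h (subst (λ u → n ∣ ∣ u ∣) (cong (_⊕ + 3 ⊛ y) (1⊛ x)) (relation⁺ 3 1 n∣3γ+1))
    same-excess : excess γ ≡ pairExcess ξ η
    same-excess = cong (λ c → ∣ c ∣ ∸ Err) (trans (sym (correlation-* ξ 1 γ ξ⊥n))
      (correlation-% (1 * ξ) ξ (γ * ξ) η (cong (_% n) (*-identityˡ ξ)) γξ≡η))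
    ∣Φ∣≡φ : ∣ Φ n ∣ ≡ φ n
    ∣Φ∣≡φ = cong ∣_∣ (sym (+φ n))
    transfer : Strong γ ⊎ (Weak γ × ThreeRelated γ) → _
    transfer (inj₁ strong) = inj₁ (subst₂ (λ X F → 10 * X ≤ 3 * F) same-excess ∣Φ∣≡φ strong)
    transfer (inj₂ (weak , related)) = inj₂ (subst₂ (λ X F → 3 * X ≤ F) same-excess ∣Φ∣≡φ weak , three related)

  -- The sieve over all `g < n` bounds `φ n` from below by the density minus `E`. Of the `1801`
  -- shares, `1800 = 180 * 10` cover `180 * Err` and one covers this `E`.
  error-bound : 0 < s → 1801 * s * 2 ^ length ls ≤ density 1 ls → 180 * Err ≤ φ n
  error-bound 0<s large = +-cancelʳ-≤ E (180 * Err) (φ n) (begin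
    180 * Err + E                        ≡⟨ cong (_+ E) (tens s (suc E)) ⟩
    1800 * (s * suc E) + E               ≤⟨ +-monoʳ-≤ (1800 * (s * suc E)) (≤-trans (n≤1+n E) (m≤n*m (suc E) s {{>-nonZero 0<s}})) ⟩
    1800 * (s * suc E) + s * suc E       ≡⟨ combine s (suc E) ⟩
    1801 * s * suc E                     ≡⟨ cong (1801 * s *_) (suc-sieveError ls) ⟩
    1801 * s * 2 ^ length ls             ≤⟨ large ⟩
    density 1 ls                         ≤⟨ *-cancelˡ-≤ n bound ⟩
    φ n + E                              ∎)
    where
    open ≤-Reasoning
    tens : ∀ s e → 180 * (10 * (s * e)) ≡ 1800 * (s * e)
    tens s e = sym (*-assoc 180 10 (s * e))
    combine : ∀ s e → 1800 * (s * e) + s * e ≡ 1801 * s * e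
    combine s e = trans (+-comm (1800 * (s * e)) (s * e)) (sym (*-assoc 1801 s e))
    B = density 1 ls
    bound : n * B ≤ n * (φ n + E)
    bound = begin
      n * B                                           ≡⟨ *-comm n B ⟩
      B * n                                           ≡⟨ cong ∣_∣ (trans (ℤₚ.pos-* B n) (lemma (+ B ⊛ + n) (+ n ⊛ Φ n))) ⟩
      ∣ + n ⊛ Φ n ⊖ (+ n ⊛ Φ n ⊖ + B ⊛ + n) ∣         ≤⟨ ℤₚ.∣i-j∣≤∣i∣+∣j∣ (+ n ⊛ Φ n) (+ n ⊛ Φ n ⊖ + B ⊛ + n) ⟩
      ∣ + n ⊛ Φ n ∣ + ∣ + n ⊛ Φ n ⊖ + B ⊛ + n ∣       ≤⟨ +-mono-≤
        (≤-reflexive (trans (ℤₚ.∣i*j∣≡∣i∣*∣j∣ (+ n) (Φ n)) (cong (λ c → n * ∣ c ∣) (sym (+φ n)))))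
        (subst (λ c → ∣ + n ⊛ c ⊖ + B ⊛ + n ∣ ≤ n * E) (∑-cong′ n λ t → cong (χ n) (*-identityˡ t))
          (sieved 1 0 (λ _ r∣1 _ → ∣1⇒≡1 r∣1) n)) ⟩
      n * φ n + n * E                                 ≡⟨ *-distribˡ-+ n (φ n) E ⟨
      n * (φ n + E)                                   ∎
      where
      lemma : ∀ x y → x ≡ y ⊖ (y ⊖ x)
      lemma = ℤ-Solver.solve-∀

  φ≤count+excess : ∀ C α β → + C ≡ ∑ n (λ g → χ n g ⊛ (below-half n (g % n) ⊛ (below-half n ((α * g) % n) ⊛ below-half n ((β * g) % n)))) →
    Coprime α n → Coprime β n →
    φ n ≤ 8 * C + (pairExcess 1 α + Err + (pairExcess 1 β + Err) + (pairExcess α β + Err))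
  φ≤count+excess C α β C≡ α⊥n β⊥n = begin
    φ n                                              ≡⟨ cong ∣_∣ identity ⟩
    ∣ + (8 * C) ⊖ (S₁ ⊕ S₂ ⊕ S₃) ∣                   ≤⟨ ℤₚ.∣i-j∣≤∣i∣+∣j∣ (+ (8 * C)) (S₁ ⊕ S₂ ⊕ S₃) ⟩
    8 * C + ∣ S₁ ⊕ S₂ ⊕ S₃ ∣
      ≤⟨ +-monoʳ-≤ (8 * C) (≤-trans (ℤₚ.∣i+j∣≤∣i∣+∣j∣ (S₁ ⊕ S₂) S₃) (+-monoˡ-≤ ∣ S₃ ∣ (ℤₚ.∣i+j∣≤∣i∣+∣j∣ S₁ S₂))) ⟩
    8 * C + (∣ S₁ ∣ + ∣ S₂ ∣ + ∣ S₃ ∣)               ≤⟨ +-monoʳ-≤ (8 * C) (+-mono-≤ (+-mono-≤ (split ∣ S₁ ∣) (split ∣ S₂ ∣)) (split ∣ S₃ ∣)) ⟩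
    8 * C + (pairExcess 1 α + Err + (pairExcess 1 β + Err) + (pairExcess α β + Err)) ∎
    where
    open ≤-Reasoning
    S₁ S₂ S₃ : ℤ
    S₁ = correlation n 1 α
    S₂ = correlation n 1 β
    S₃ = correlation n α β
    split : ∀ x → x ≤ x ∸ Err + Err
    split x = ≤-trans (m≤n+m∸n x Err) (≤-reflexive (+-comm Err (x ∸ Err)))
    identity : + φ n ≡ + (8 * C) ⊖ (S₁ ⊕ S₂ ⊕ S₃)
    identity = trans (+φ n) (trans (lemma (Φ n) S₁ S₂ S₃)
      (cong (_⊖ (S₁ ⊕ S₂ ⊕ S₃)) (trans (sym (count-formula α β α⊥n β⊥n)) (trans (cong (+ 8 ⊛_) (sym C≡)) (sym (ℤₚ.pos-* 8 C))))))
      where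
      lemma : ∀ f a b c → f ≡ (f ⊕ a ⊕ b ⊕ c) ⊖ (a ⊕ b ⊕ c)
      lemma = ℤ-Solver.solve-∀

-- Multiplied by `60`, the three correlations take `20 + 20 + 18` of the `60` shares of `F`. Of the
-- two left, one pays for `60 * 3 * Err` and one is the result, against `60 * 8 = 480` counts.
combine-bounds : ∀ F C Err X Y Z → F ≤ 8 * C + (X + Err + (Y + Err) + (Z + Err)) → 180 * Err ≤ F →
  3 * X ≤ F → 3 * Y ≤ F → 10 * Z ≤ 3 * F → 1 * F ≤ 480 * C
combine-bounds F C Err X Y Z total small X≤ Y≤ Z≤ = +-cancelʳ-≤ (59 * F) (1 * F) (480 * C) (begin
  1 * F + 59 * F                                                                 ≡⟨ *-distribʳ-+ F 1 59 ⟨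
  60 * F                                                                         ≤⟨ *-monoʳ-≤ 60 total ⟩
  60 * (8 * C + (X + Err + (Y + Err) + (Z + Err)))                               ≡⟨ expand C Err X Y Z ⟩
  480 * C + (20 * (3 * X) + 20 * (3 * Y) + 6 * (10 * Z) + 180 * Err)
    ≤⟨ +-monoʳ-≤ (480 * C) (+-mono-≤ (+-mono-≤ (+-mono-≤ (*-monoʳ-≤ 20 X≤) (*-monoʳ-≤ 20 Y≤)) (*-monoʳ-≤ 6 Z≤)) small) ⟩
  480 * C + (20 * F + 20 * F + 6 * (3 * F) + F)                                  ≡⟨ cong (λ u → 480 * C + u) (collect F) ⟩
  480 * C + 59 * F                                                               ∎)
  where
  open ≤-Reasoning
  expand : ∀ C e x y z → 60 * (8 * C + (x + e + (y + e) + (z + e))) ≡ 480 * C + (20 * (3 * x) + 20 * (3 * y) + 6 * (10 * z) + 180 * e)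
  expand = ℕ-Solver.solve-∀
  collect : ∀ F → 20 * F + 20 * F + 6 * (3 * F) + F ≡ 59 * F
  collect = ℕ-Solver.solve-∀

-- The condition `k * t ^ 16 ≤ n` of `density-lower-bound`, with `k = 30` for the prime `5` and
-- `t = 1801` from `error-bound`.
threshold : ℕ
threshold = 30 * 1801 ^ 16

theorem2 : ∃[ p ] ∃[ q ] ∃[ N ] (0 < p × 0 < q ×
    ((n : ℕ) (a b : ℤ) → N < n → Coprime n 6 →
    Coprime ∣ a ∣ n → Coprime ∣ b ∣ n →
    ¬ PlusMinus n (+ 1) a → ¬ PlusMinus n (+ 1) b → ¬ PlusMinus n a b →
    (NoThreeRel n (+ 1) a ⊎ NoThreeRel n (+ 1) b ⊎ NoThreeRel n a b) →
    p * φ n ≤ q * count n a b))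
theorem2 = 1 , 480 , threshold , s≤s z≤n , s≤s z≤n , bound
  where
  bound : (n : ℕ) (a b : ℤ) → threshold < n → Coprime n 6 →
    Coprime ∣ a ∣ n → Coprime ∣ b ∣ n →
    ¬ PlusMinus n (+ 1) a → ¬ PlusMinus n (+ 1) b → ¬ PlusMinus n a b →
    (NoThreeRel n (+ 1) a ⊎ NoThreeRel n (+ 1) b ⊎ NoThreeRel n a b) →
    1 * φ n ≤ 480 * count n a b
  bound n a b N<n n⊥6 a⊥n b⊥n ¬1a ¬1b ¬ab three = factored (isqrt n) (factorise n {{>-nonZero (≤-<-trans z≤n N<n)}})
    where
    factored : ∃[ s ] (s * s ≤ n × n < suc s * suc s) → PrimeFactorisation n → 1 * φ n ≤ 480 * count n a b
    factored (s , ss≤n , n<SS) (record { factors = ls ; isFactorisation = n≡ ; factorsPrime = ls-prime }) = conclude (representative n s a) (representative n s b)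
      where
      1<n : 1 < n
      1<n = ≤-<-trans (≤ᵇ⇒≤ 1 threshold tt) N<n
      instance
        n≢0 : NonZero n
        n≢0 = >-nonZero (<-trans (s≤s z≤n) 1<n)
      2⊥n : Coprime 2 n
      2⊥n = Coprimality.sym (coprime-∣ ∣-refl (divides 3 refl) n⊥6)
      3⊥n : Coprime 3 n
      3⊥n = Coprimality.sym (coprime-∣ ∣-refl (divides 2 refl) n⊥6)
      s<n : s < n
      s<n = ≰⇒> λ n≤s → <⇒≱ (m<m*n n n 1<n) (≤-trans (*-mono-≤ n≤s n≤s) ss≤n)
      0<s : 0 < s
      0<s = positive s n<SS
        where
        positive : ∀ s → n < suc s * suc s → 0 < s
        positive zero    n<1 = contradiction n<1 (<⇒≯ 1<n)
        positive (suc s) _   = s≤s z≤n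
      open Count n s ls n≡ ls-prime 1<n 2⊥n 3⊥n s<n n<SS
      open CorrelationBound n s ls n≡ ls-prime 1<n 2⊥n 3⊥n s<n n<SS using (Err; prime-divisor-large)
      fiveOrMore : ∀ ls → product ls ∣ n → All Prime ls → All FiveOrMore ls
      fiveOrMore []       _   []                     = []
      fiveOrMore (l ∷ ls) ∣n (l-prime ∷ ls-prime) =
        prime-divisor-large l-prime (∣-trans (m∣m*n (product ls)) ∣n) ∷ fiveOrMore ls (∣-trans (n∣m*n l) ∣n) ls-prime
      weight≤ : (2 ^ length ls) ^ 16 * n ^ 9 ≤ 30 * density 1 ls ^ 16
      weight≤ = subst₂ (λ c m → c * m ^ 9 ≤ 30 * density 1 ls ^ 16)
        (trans (^-*-assoc 2 16 (length ls)) (trans (cong (2 ^_) (*-comm 16 (length ls))) (sym (^-*-assoc 2 (length ls) 16)))) (sym n≡)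
        -- `30` is the least integer above `2 ^ 16 * 5 ^ 9 / 4 ^ 16`, about 29.8. The inequality at
        -- `7` has a margin of less than 7 percent, so the exponent 9/16 could hardly be larger.
        (proj₂ (weight≤density (2 ^ 16) 30
          (≤ᵇ⇒≤ (2 ^ 16 * 7 ^ 9) (6 ^ 16) tt) (≤ᵇ⇒≤ (2 ^ 16 * 5 ^ 9 * 30) (30 * 5 ^ 16) tt)
          (≤ᵇ⇒≤ (2 ^ 16 * 5 ^ 9 * 1) (30 * 4 ^ 16) tt) (s≤s z≤n)
          ls (fiveOrMore ls (∣-reflexive (sym n≡)) ls-prime)))
      Err-small : 180 * Err ≤ φ n
      Err-small = error-bound 0<s (density-lower-bound 30 1801 n s (2 ^ length ls) (density 1 ls) (<⇒≤ N<n) ss≤n weight≤)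
      conclude : ∃[ α ] ∃[ z ] (s ≤ α × a ≡ + α ⊕ z ⊛ + n) → ∃[ β ] ∃[ w ] (s ≤ β × b ≡ + β ⊕ w ⊛ + n) → 1 * φ n ≤ 480 * count n a b
      conclude (α , z , s≤α , a≡) (β , w , s≤β , b≡) = cases
          (pair-bound (+ 1) a 1 α (+ 0) z refl a≡ 1⊥n α⊥n s≤α ¬1a)
          (pair-bound (+ 1) b 1 β (+ 0) w refl b≡ 1⊥n β⊥n s≤β ¬1b)
          (pair-bound a b α β z w a≡ b≡ α⊥n β⊥n s≤β ¬ab) three
        where
        1⊥n : Coprime 1 n
        1⊥n = Coprimality.1-coprimeTo n
        α⊥n : Coprime α n
        α⊥n = representative-coprime n α z a≡ a⊥n
        β⊥n : Coprime β n
        β⊥n = representative-coprime n β w b≡ b⊥n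
        F C X Y Z : ℕ
        F = φ n
        C = count n a b
        X = pairExcess 1 α
        Y = pairExcess 1 β
        Z = pairExcess α β
        total : F ≤ 8 * C + (X + Err + (Y + Err) + (Z + Err))
        total = φ≤count+excess C α β (count-∑ n a b α β z w a≡ b≡) α⊥n β⊥n
        Bound : ℕ → Set → Set
        Bound X related = 10 * X ≤ 3 * F ⊎ (3 * X ≤ F × ¬ related)
        weak : ∀ X related → Bound X related → 3 * X ≤ F
        weak X _ (inj₂ (le , _)) = le
        weak X _ (inj₁ le) = *-cancelˡ-≤ 10 (begin
          10 * (3 * X)   ≡⟨ swap X ⟩
          3 * (10 * X)   ≤⟨ *-monoʳ-≤ 3 le ⟩
          3 * (3 * F)    ≡⟨ *-assoc 3 3 F ⟨
          9 * F          ≤⟨ *-monoˡ-≤ F (n≤1+n 9) ⟩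
          10 * F         ∎)
          where
          open ≤-Reasoning
          swap : ∀ x → 10 * (3 * x) ≡ 3 * (10 * x)
          swap = ℕ-Solver.solve-∀
        strong : ∀ X related → Bound X related → related → 10 * X ≤ 3 * F
        strong _ _ (inj₁ le)             _       = le
        strong _ _ (inj₂ (_ , ¬related)) related = contradiction related ¬related
        rotate : ∀ c x y z e → 8 * c + (x + e + (y + e) + (z + e)) ≡ 8 * c + (y + e + (z + e) + (x + e))
        rotate = ℕ-Solver.solve-∀
        exchange : ∀ c x y z e → 8 * c + (x + e + (y + e) + (z + e)) ≡ 8 * c + (x + e + (z + e) + (y + e))
        exchange = ℕ-Solver.solve-∀
        R₁ R₂ R₃ : Set
        R₁ = NoThreeRel n (+ 1) a
        R₂ = NoThreeRel n (+ 1) b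
        R₃ = NoThreeRel n a b
        cases : Bound X R₁ → Bound Y R₂ → Bound Z R₃ → R₁ ⊎ R₂ ⊎ R₃ → 1 * F ≤ 480 * C
        cases bx by bz (inj₁ h)        = combine-bounds F C Err Y Z X (subst (F ≤_) (rotate C X Y Z Err) total) Err-small (weak Y R₂ by) (weak Z R₃ bz) (strong X R₁ bx h)
        cases bx by bz (inj₂ (inj₁ h)) = combine-bounds F C Err X Z Y (subst (F ≤_) (exchange C X Y Z Err) total) Err-small (weak X R₁ bx) (weak Z R₃ bz) (strong Y R₂ by h)
        cases bx by bz (inj₂ (inj₂ h)) = combine-bounds F C Err X Y Z total Err-small (weak X R₁ bx) (weak Y R₂ by) (strong Z R₃ bz h)
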